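{- Let $n_1,n_2$ be integers with $0\le n_1\le n_2$ and $n_2\ge2$. Put $\alpha=(n_1+n_2-2)_3\,(n_1+n_2-1)_2$, $\beta=n_1(n_2+1)(n_1^2+n_2^2+n_1n_2-2n_1-n_2)$, and $\gamma=(n_1+n_2-2)_3\,(n_1^3+n_2^3+3n_1^2n_2+3n_1n_2^2-3n_1^2-3n_2^2-7n_1n_2+n_1+2n_2)$. Then $Y=T_{\mathfrak G_{n_1,n_2},v_2}(X)$ satisfies $$(\alpha X+\beta X^2)Y''+(\alpha+\alpha X+\beta X^2)Y'-(\gamma+(n_1+n_2-2)\beta X)Y=0.$$
   Context: $(z)_k=z(z+1)\cdots(z+k-1)$ is the Pochhammer symbol. For integers $0\le n_1\le n_2$, $\mathfrak G_{n_1,n_2}$ is the digraph with vertices $v_1,\dots,v_{n_2},u_1,\dots,u_{n_1}$ and arcs $(v_j,v_{j+1})$ for $1\le j<n_2$, $(u_j,u_{j+1})$ for $1\le j<n_1$, and $(v_j,u_j)$ for $1\le j\le n_1$. For a finite simple digraph $\mathfrak G=(V,A)$ with $|V|=n$, a disposition is a bijection $f:V\to\{1,\dots,n\}$ with $f(w_1)>f(w_2)$ whenever $(w_1,w_2)\in A$, and $\sigma(\mathfrak G)$ is the number of dispositions. For $v\in V$ and $i\ge0$, $\mathfrak G_i$ is obtained from $\mathfrak G$ by adding new vertices $z_1,\dots,z_i$ and arcs $(z_0,z_1),\dots,(z_{i-1},z_i)$ with $z_0=v$. The companion polynomial $T_{\mathfrak G,v}(X)$ is the (polynomial) power series satisfying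 $\sum_{i\ge0}\sigma(\mathfrak G_i)X^i/i!=T_{\mathfrak G,v}(X)\exp(X)$. -}

module Defs where

open import Data.Nat as ℕ using (ℕ; zero; suc; _!; _≤_)
open import Data.Nat.Properties using (_!≢0)
open import Data.Integer as ℤ using (ℤ; +_)
open import Data.Rational as ℚ using (ℚ; 0ℚ; 1ℚ; _+_; _*_; _-_; -_)
open import Data.Fin as Fin using (Fin; inject₁; fromℕ; _↑ˡ_; _↑ʳ_; inject≤; fromℕ<)
open import Data.Fin.Properties using (all?; any?) renaming (_≟_ to _≟ᶠ_)
open import Data.List as List using (List; []; _∷_; _++_; map; concatMap; length; filter)
open import Data.List.Relation.Unary.All as All using (All)
open import Data.Product using (_×_; _,_; ∃; proj₁; proj₂)
open import Relation.Binary.PropositionalEquality using (_≡_)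
open import Relation.Nullary using (Dec; yes; no)
open import Relation.Nullary.Decidable using (_×-dec_; _→-dec_)

record Digraph : Set where
  constructor mkDigraph
  field
    size : ℕ
    arcs : List (Fin size × Fin size)
open Digraph public

-- f is a bijection V → {1,…,n}  (here encoded as Fin n → Fin n)
Bijection : {n : ℕ} → (Fin n → Fin n) → Set
Bijection {n} f = (∀ i j → f i ≡ f j → i ≡ j) × (∀ y → ∃ λ x → f x ≡ y)

IsDisposition : (G : Digraph) → (Fin (size G) → Fin (size G)) → Set
IsDisposition G f =
  Bijection f × All (λ a → f (proj₂ a) Fin.< f (proj₁ a)) (arcs G)

isDisposition? : (G : Digraph) → (f : Fin (size G) → Fin (size G)) → Dec (IsDisposition G f)
isDisposition? G f =
  (all? (λ i → all? (λ j → (f i ≟ᶠ f j) →-dec (i ≟ᶠ j)))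
   ×-dec all? (λ y → any? (λ x → f x ≟ᶠ y)))
  ×-dec All.all? (λ a → f (proj₂ a) Fin.<? f (proj₁ a)) (arcs G)

allFuns : (m n : ℕ) → List (Fin m → Fin n)
allFuns zero    n = (λ ()) ∷ []
allFuns (suc m) n =
  concatMap (λ g → map (λ x → λ { Fin.zero → x ; (Fin.suc i) → g i }) (List.allFin n))
            (allFuns m n)

σ : Digraph → ℕ
σ G = length (filter (isDisposition? G) (allFuns (size G) (size G)))

-- G_i : add new vertices z₁,…,z_i and arcs (z₀,z₁),…,(z_{i-1},z_i), z₀ = v

addLeaf : (G : Digraph) → Fin (size G) → Digraph
addLeaf (mkDigraph n as) v =
  mkDigraph (suc n) ((inject₁ v , fromℕ n) ∷ map (λ a → inject₁ (proj₁ a) , inject₁ (proj₂ a)) as)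

extend : (G : Digraph) → Fin (size G) → ℕ → Digraph
extend G v zero    = G
extend G v (suc i) = extend (addLeaf G v) (fromℕ (size G)) i

-- the digraph 𝔊_{n₁,n₂}: v_j ↦ (j-1) ↑ˡ n₁, u_j ↦ n₂ ↑ʳ (j-1)

pathArcs : (m : ℕ) → List (Fin m × Fin m)
pathArcs zero          = []
pathArcs (suc zero)    = []
pathArcs (suc (suc m)) =
  (Fin.zero , Fin.suc Fin.zero) ∷ map (λ a → Fin.suc (proj₁ a) , Fin.suc (proj₂ a)) (pathArcs (suc m))

𝔊 : (n₁ n₂ : ℕ) → n₁ ≤ n₂ → Digraph
𝔊 n₁ n₂ le = mkDigraph (n₂ ℕ.+ n₁)
  (  map (λ a → vv (proj₁ a) , vv (proj₂ a)) (pathArcs n₂)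
  ++ map (λ a → uu (proj₁ a) , uu (proj₂ a)) (pathArcs n₁)
  ++ map (λ k → vv (inject≤ k le) , uu k) (List.allFin n₁))
  where
  vv : Fin n₂ → Fin (n₂ ℕ.+ n₁)
  vv k = k ↑ˡ n₁
  uu : Fin n₁ → Fin (n₂ ℕ.+ n₁)
  uu k = n₂ ↑ʳ k

v₂ : (n₁ n₂ : ℕ) → 2 ≤ n₂ → Fin (n₂ ℕ.+ n₁)
v₂ n₁ n₂ h = fromℕ< {1} {n₂} h ↑ˡ n₁

PS : Set
PS = ℕ → ℚ

ℕ→ℚ : ℕ → ℚ
ℕ→ℚ n = (+ n) ℚ./ 1

_⊕_ : PS → PS → PS
(A ⊕ B) k = A k + B k

_⊖_ : PS → PS → PS
(A ⊖ B) k = A k - B k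

_·_ : ℚ → PS → PS
(c · A) k = c * A k

shiftX : PS → PS
shiftX A zero    = 0ℚ
shiftX A (suc k) = A k

D : PS → PS
D A k = ℕ→ℚ (suc k) * A (suc k)

-- Cauchy product: (A ⊛ B)_k = Σ_{j=0}^k A_j B_{k-j}
convo : PS → PS → ℕ → ℚ
convo A B zero    = A 0 * B 0
convo A B (suc k) = convo A (λ m → B (suc m)) k + A (suc k) * B 0

_⊛_ : PS → PS → PS
(A ⊛ B) k = convo A B k

expPS : PS
expPS k = (+ 1 ℚ./ (k !)) {{k !≢0}}

sigmaEGF : (G : Digraph) → Fin (size G) → PS
sigmaEGF G v i = ((+ σ (extend G v i)) ℚ./ (i !)) {{i !≢0}}

-- T is the companion polynomial T_{G,v}: Σ σ(G_i) X^i/i! = T(X) exp(X)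
IsCompanion : (G : Digraph) → Fin (size G) → PS → Set
IsCompanion G v T = ∀ k → (T ⊛ expPS) k ≡ sigmaEGF G v k

poch : ℚ → ℕ → ℚ
poch z zero    = 1ℚ
poch z (suc k) = poch z k * (z + ℕ→ℚ k)

module Consts (n₁ n₂ : ℕ) where
  a b : ℚ
  a = ℕ→ℚ n₁
  b = ℕ→ℚ n₂
  s : ℚ
  s = a + b - ℕ→ℚ 2
  α β γ : ℚ
  α = poch s 3 * poch (a + b - 1ℚ) 2
  β = a * (b + 1ℚ) * (a * a + b * b + a * b - ℕ→ℚ 2 * a - b)
  γ = poch s 3 * (a * a * a + b * b * b + ℕ→ℚ 3 * a * a * b + ℕ→ℚ 3 * a * b * b
                  - ℕ→ℚ 3 * a * a - ℕ→ℚ 3 * b * b - ℕ→ℚ 7 * a * b + a + ℕ→ℚ 2 * b)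

odeLHS : (n₁ n₂ : ℕ) → PS → PS
odeLHS n₁ n₂ Y =
  (((α · shiftX (D (D Y))) ⊕ (β · shiftX (shiftX (D (D Y)))))
  ⊕ (((α · D Y) ⊕ (α · shiftX (D Y))) ⊕ (β · shiftX (shiftX (D Y)))))
  ⊖ ((γ · Y) ⊕ ((s * β) · shiftX Y))
  where open Consts n₁ n₂

module Submission where

open import Defs
open import Data.Nat using (ℕ; _≤_)
open import Data.Rational using (0ℚ)
open import Relation.Binary.PropositionalEquality using (_≡_)

-- The vertex sent to 1 by a disposition is a sink, so σ(G) is the sum of σ(G - w) over the sinks w of G.
-- For 𝔊_{n₁,n₂} with a chain of c vertices below v₂ the sinks are the last vertices of the three paths,
-- and the resulting three-term recurrence is solved by σ = A C(m + c, c) + B C(m - 1 + c, c), m = n₁ + n₂ - 2,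
-- where A and B count lattice paths to (n₂ - 2, n₁) that stay below the line q = p + 2.
-- By Vandermonde, the companion polynomial is then A L_m + B L_(m-1) with L_m(X) = Σ_j C(m, j) X^j / j!,
-- and L_m solves X Y″ + (1 + X) Y′ = m Y. This reduces the differential equation to two polynomial
-- identities in n₁ and n₂, which hold once A and B are replaced by their closed forms
--   A (p+1)(p+2)(p+3) = C(m, q) ((p+1)(p+2)(p+3) - q(q-1)(q-2)),
--   B (p+1)(p+2) m    = C(m, q) q ((p+1)(p+2) - (q-1)(q-2)),      where p = n₂ - 2 and q = n₁.

module Indicators where
  open import Data.Nat.Base using (ℕ; zero; suc; pred; _+_; _*_; _<_; _≤_)
  import Data.Nat.Properties as ℕ
  open import Data.Nat.Properties using (+-*-semiring; +-identityʳ; *-identityˡ)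
  open import Data.Fin.Base using (Fin; zero; suc; punchIn; toℕ; fromℕ<)
  open import Data.Fin.Properties using (_≟_; punchInᵢ≢i; toℕ-injective; toℕ-fromℕ<)
  open import Data.Product.Base using (_×_; _,_; proj₁; proj₂)
  open import Data.Empty using (⊥; ⊥-elim)
  open import Data.Sum.Base using (_⊎_; inj₁; inj₂; [_,_]′)
  open import Function.Base using (_∘_)
  open import Function.Bundles using (_⇔_; Equivalence)
  open import Relation.Binary.PropositionalEquality
  open import Relation.Nullary.Decidable using (Dec; yes; no; _×-dec_)
  open import Relation.Nullary.Negation.Core using (¬_; contradiction)

  open import Algebra.Properties.Semiring.Sum +-*-semiring public
    using (sum; sum-syntax; sum-cong-≗; sum-remove; sum-replicate-zero; ∑-comm; ∑-distrib-+; *-distribˡ-sum)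

  χ : ∀ {a} {A : Set a} → Dec A → ℕ
  χ (yes _) = 1
  χ (no _)  = 0

  χ-cong : ∀ {a b} {A : Set a} {B : Set b} → (A → B) → (B → A) →
           (a? : Dec A) (b? : Dec B) → χ a? ≡ χ b?
  χ-cong f g (yes a) (yes b) = refl
  χ-cong f g (yes a) (no ¬b) = contradiction (f a) ¬b
  χ-cong f g (no ¬a) (yes b) = contradiction (g b) ¬a
  χ-cong f g (no ¬a) (no ¬b) = refl

  χ-yes : ∀ {a} {A : Set a} (a? : Dec A) → A → χ a? ≡ 1
  χ-yes (yes _) _ = refl
  χ-yes (no ¬a) a = contradiction a ¬a

  χ-no : ∀ {a} {A : Set a} (a? : Dec A) → ¬ A → χ a? ≡ 0
  χ-no (yes a) ¬a = contradiction a ¬a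
  χ-no (no _)  _  = refl

  χ-× : ∀ {a b} {A : Set a} {B : Set b} (a? : Dec A) (b? : Dec B) (ab? : Dec (A × B)) →
        χ ab? ≡ χ a? * χ b?
  χ-× a? b? ab? with a? | b? | ab?
  ... | yes a | yes b | yes _  = refl
  ... | yes a | yes b | no ¬ab = contradiction (a , b) ¬ab
  ... | _     | no ¬b | yes ab = contradiction (proj₂ ab) ¬b
  ... | yes _ | no _  | no _   = refl
  ... | no ¬a | _     | yes ab = contradiction (proj₁ ab) ¬a
  ... | no _  | _     | no _   = refl

  χ*-cong : ∀ {c} {C : Set c} (c? : Dec C) {x y : ℕ} → (C → x ≡ y) → χ c? * x ≡ χ c? * y
  χ*-cong (yes c) x≡y = cong (1 *_) (x≡y c)
  χ*-cong (no _)  _   = refl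

  ∑-χ≟ : ∀ {n} (w : Fin n) (f : Fin n → ℕ) → ∑[ i < n ] (χ (i ≟ w) * f i) ≡ f w
  ∑-χ≟ {suc n} w f = begin
    ∑[ i < suc n ] (χ (i ≟ w) * f i)
      ≡⟨ sum-remove {i = w} (λ i → χ (i ≟ w) * f i) ⟩
    χ (w ≟ w) * f w + ∑[ i < n ] (χ (punchIn w i ≟ w) * f (punchIn w i))
      ≡⟨ cong₂ _+_ (cong (_* f w) (χ-yes (w ≟ w) refl))
                   (sum-cong-≗ (λ i → cong (_* f (punchIn w i)) (χ-no (punchIn w i ≟ w) (punchInᵢ≢i w i)))) ⟩
    1 * f w + ∑[ i < n ] (0 * f (punchIn w i))
      ≡⟨ cong₂ _+_ (*-identityˡ (f w)) (sum-replicate-zero n) ⟩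
    f w + 0
      ≡⟨ +-identityʳ (f w) ⟩
    f w ∎
    where open ≡-Reasoning

  χ-⊎ : ∀ {a b c} {A : Set a} {B : Set b} {C : Set c} (a? : Dec A) (b? : Dec B) (c? : Dec C) →
        A ⇔ (B ⊎ C) → (B → C → ⊥) → χ a? ≡ χ b? + χ c?
  χ-⊎ a? b? c? A⇔B⊎C disjoint with a? | b? | c?
  ... | yes _ | yes b | yes c = contradiction c (disjoint b)
  ... | yes _ | yes _ | no _  = refl
  ... | yes _ | no _  | yes _ = refl
  ... | yes a | no ¬b | no ¬c = ⊥-elim ([ ¬b , ¬c ]′ (Equivalence.to A⇔B⊎C a))
  ... | no ¬a | yes b | _     = contradiction (Equivalence.from A⇔B⊎C (inj₁ b)) ¬a
  ... | no ¬a | no _  | yes c = contradiction (Equivalence.from A⇔B⊎C (inj₂ c)) ¬a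
  ... | no _  | no _  | no _  = refl

  ∑-χ-toℕ≡ : ∀ {m x} (G : ℕ → ℕ) → x < m → ∑[ w < m ] (χ (toℕ w ℕ.≟ x) * G (toℕ w)) ≡ G x
  ∑-χ-toℕ≡ {m} {x} G x<m = begin
    ∑[ w < m ] (χ (toℕ w ℕ.≟ x) * G (toℕ w))
      ≡⟨ sum-cong-≗ (λ w → cong (_* G (toℕ w)) (χ-cong (λ w≡x → toℕ-injective (trans w≡x (sym (toℕ-fromℕ< x<m))))
                                                        (λ { refl → toℕ-fromℕ< x<m }) (toℕ w ℕ.≟ x) (w ≟ fromℕ< x<m))) ⟩
    ∑[ w < m ] (χ (w ≟ fromℕ< x<m) * G (toℕ w))
      ≡⟨ ∑-χ≟ (fromℕ< x<m) (G ∘ toℕ) ⟩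
    G (toℕ (fromℕ< x<m))
      ≡⟨ cong G (toℕ-fromℕ< x<m) ⟩
    G x ∎
    where open ≡-Reasoning

  ∑-χ-last : ∀ m P {C : Set} (C? : Dec C) (G : ℕ → ℕ) → (C → 0 < P × P ≤ m) →
             ∑[ w < m ] (χ ((suc (toℕ w) ℕ.≟ P) ×-dec C?) * G (toℕ w)) ≡ χ C? * G (pred P)
  ∑-χ-last m P (no ¬c) G _ =
    trans (sum-cong-≗ {m} (λ w → cong (_* G (toℕ w)) (χ-no ((suc (toℕ w) ℕ.≟ P) ×-dec no ¬c) (¬c ∘ proj₂)))) (sum-replicate-zero m)
  ∑-χ-last m (suc P) (yes c) G bounds = begin
    ∑[ w < m ] (χ ((suc (toℕ w) ℕ.≟ suc P) ×-dec yes c) * G (toℕ w))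
      ≡⟨ sum-cong-≗ {m} (λ w → cong (_* G (toℕ w)) (χ-cong (ℕ.suc-injective ∘ proj₁) (λ w≡P → cong suc w≡P , c)
                                                         ((suc (toℕ w) ℕ.≟ suc P) ×-dec yes c) (toℕ w ℕ.≟ P))) ⟩
    ∑[ w < m ] (χ (toℕ w ℕ.≟ P) * G (toℕ w))
      ≡⟨ ∑-χ-toℕ≡ G (proj₂ (bounds c)) ⟩
    G P
      ≡⟨ sym (+-identityʳ (G P)) ⟩
    χ (yes c) * G (pred (suc P)) ∎
    where open ≡-Reasoning
  ∑-χ-last m zero (yes c) G bounds = contradiction (proj₁ (bounds c)) λ ()

module Sums where
  open import Data.Nat.Base using (ℕ; zero; suc; _+_; _*_)
  open import Data.Nat.Properties using (+-identityʳ)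
  open import Data.Fin.Base using (Fin; zero; suc)
  open import Data.Vec.Functional using (_∷_; insertAt)
  open import Data.List.Base as List using (List; map; allFin; filter; length; concatMap)
  open import Data.List.Properties using (map-++; map-∘) renaming (map-cong to map-cong′)
  open import Data.Nat.ListAction using () renaming (sum to sumList)
  open import Data.Nat.ListAction.Properties using () renaming (sum-++ to sumList-++)
  open import Function.Base using (_∘_)
  open import Relation.Binary.Core using (_Preserves_⟶_)
  open import Relation.Binary.PropositionalEquality
  open import Relation.Nullary.Decidable using (Dec; yes; no)

  open import Defs using (allFuns)
  open Indicators

  sumList-concatMap : ∀ {A B : Set} (F : B → ℕ) (h : A → List B) xs →
                      sumList (map F (concatMap h xs)) ≡ sumList (map (λ x → sumList (map F (h x))) xs)
  sumList-concatMap F h List.[]       = refl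
  sumList-concatMap F h (x List.∷ xs) = begin
    sumList (map F (h x List.++ concatMap h xs))
      ≡⟨ cong sumList (map-++ F (h x) (concatMap h xs)) ⟩
    sumList (map F (h x) List.++ map F (concatMap h xs))
      ≡⟨ sumList-++ (map F (h x)) _ ⟩
    sumList (map F (h x)) + sumList (map F (concatMap h xs))
      ≡⟨ cong (sumList (map F (h x)) +_) (sumList-concatMap F h xs) ⟩
    sumList (map F (h x)) + sumList (map (λ x → sumList (map F (h x))) xs) ∎
    where open ≡-Reasoning

  sumList-map-tabulate : ∀ {A : Set} n (F : A → ℕ) (g : Fin n → A) →
                         sumList (map F (List.tabulate g)) ≡ ∑[ i < n ] F (g i)
  sumList-map-tabulate zero    F g = refl
  sumList-map-tabulate (suc n) F g = cong (F (g zero) +_) (sumList-map-tabulate n F (g ∘ suc))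

  length-filter≡sum-χ : ∀ {A : Set} {P : A → Set} (P? : ∀ x → Dec (P x)) xs →
                        length (filter P? xs) ≡ sumList (map (χ ∘ P?) xs)
  length-filter≡sum-χ P? List.[] = refl
  length-filter≡sum-χ P? (x List.∷ xs) with P? x
  ... | yes _ = cong suc (length-filter≡sum-χ P? xs)
  ... | no _  = length-filter≡sum-χ P? xs

  sumFun : (m n : ℕ) → ((Fin m → Fin n) → ℕ) → ℕ
  sumFun zero    n F = F (λ ())
  sumFun (suc m) n F = sumFun m n (λ g → ∑[ x < n ] F (x ∷ g))

  sumFun-cong : ∀ m n {F G : (Fin m → Fin n) → ℕ} → (∀ f → F f ≡ G f) → sumFun m n F ≡ sumFun m n G
  sumFun-cong zero    n F≡G = F≡G _
  sumFun-cong (suc m) n F≡G = sumFun-cong m n (λ g → sum-cong-≗ (λ x → F≡G (x ∷ g)))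

  sumFun-∑-comm : ∀ m n k (F : Fin k → (Fin m → Fin n) → ℕ) →
                  sumFun m n (λ f → ∑[ w < k ] F w f) ≡ ∑[ w < k ] sumFun m n (F w)
  sumFun-∑-comm zero    n k F = refl
  sumFun-∑-comm (suc m) n k F = begin
    sumFun m n (λ g → ∑[ x < n ] ∑[ w < k ] F w (x ∷ g))
      ≡⟨ sumFun-cong m n (λ g → ∑-comm (λ x w → F w (x ∷ g))) ⟩
    sumFun m n (λ g → ∑[ w < k ] ∑[ x < n ] F w (x ∷ g))
      ≡⟨ sumFun-∑-comm m n k (λ w g → ∑[ x < n ] F w (x ∷ g)) ⟩
    ∑[ w < k ] sumFun (suc m) n (F w) ∎
    where open ≡-Reasoning

  sumFun-*ˡ : ∀ m n c (F : (Fin m → Fin n) → ℕ) → sumFun m n (λ f → c * F f) ≡ c * sumFun m n F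
  sumFun-*ˡ zero    n c F = refl
  sumFun-*ˡ (suc m) n c F = trans (sumFun-cong m n (λ g → sym (*-distribˡ-sum c (λ x → F (x ∷ g)))))
                                  (sumFun-*ˡ m n c _)

  ∷-cong : ∀ {m n} (x : Fin n) {f g : Fin m → Fin n} → f ≗ g → (x ∷ f) ≗ (x ∷ g)
  ∷-cong x f≗g zero    = refl
  ∷-cong x f≗g (suc i) = f≗g i

  sum-∷-Preserves : ∀ m n {F : (Fin (suc m) → Fin n) → ℕ} → F Preserves _≗_ ⟶ _≡_ →
                    (λ g → ∑[ x < n ] F (x ∷ g)) Preserves _≗_ ⟶ _≡_
  sum-∷-Preserves m n F-resp f≗g = sum-cong-≗ (λ x → F-resp (∷-cong x f≗g))

  sumList-allFuns : ∀ m n (F : (Fin m → Fin n) → ℕ) → F Preserves _≗_ ⟶ _≡_ →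
                    sumList (map F (allFuns m n)) ≡ sumFun m n F
  sumList-allFuns zero    n F F-resp = trans (+-identityʳ _) (F-resp (λ ()))
  sumList-allFuns (suc m) n F F-resp =
    trans (sumList-concatMap F _ (allFuns m n))
          (trans (cong sumList (map-cong′ (λ g → row _ g (λ x → λ { zero → refl ; (suc i) → refl })) (allFuns m n)))
                 (sumList-allFuns m n _ (sum-∷-Preserves m n F-resp)))
    where
    row : ∀ (φ : Fin n → Fin (suc m) → Fin n) g → (∀ x → φ x ≗ x ∷ g) →
          sumList (map F (map φ (allFin n))) ≡ ∑[ x < n ] F (x ∷ g)
    row φ g φ≗ = trans (cong sumList (sym (map-∘ (allFin n))))
                       (trans (sumList-map-tabulate n _ (λ x → x)) (sum-cong-≗ (λ x → F-resp (φ≗ x))))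

  insertAt-zero : ∀ {m n} (g : Fin m → Fin n) x → insertAt g zero x ≗ x ∷ g
  insertAt-zero g x zero    = refl
  insertAt-zero g x (suc i) = refl

  insertAt-∷ : ∀ {m n} (g : Fin m → Fin n) w x y → insertAt (y ∷ g) (suc w) x ≗ y ∷ insertAt g w x
  insertAt-∷ g w x y zero    = refl
  insertAt-∷ g w x y (suc i) = refl

  suc-∷ : ∀ {m n} (g : Fin m → Fin n) x → suc x ∷ (suc ∘ g) ≗ suc ∘ (x ∷ g)
  suc-∷ g x zero    = refl
  suc-∷ g x (suc i) = refl

  sumFun-insertAt : ∀ m n (w : Fin (suc m)) (F : (Fin (suc m) → Fin n) → ℕ) → F Preserves _≗_ ⟶ _≡_ →
                    sumFun (suc m) n F ≡ sumFun m n (λ g → ∑[ x < n ] F (insertAt g w x))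
  sumFun-insertAt m n zero F F-resp =
    sumFun-cong m n (λ g → sum-cong-≗ (λ x → sym (F-resp (insertAt-zero g x))))
  sumFun-insertAt (suc m) n (suc w) F F-resp = begin
    sumFun (suc m) n G
      ≡⟨ sumFun-insertAt m n w G (sum-∷-Preserves (suc m) n F-resp) ⟩
    sumFun m n (λ g → ∑[ x < n ] ∑[ y < n ] F (y ∷ insertAt g w x))
      ≡⟨ sumFun-cong m n (λ g → ∑-comm (λ x y → F (y ∷ insertAt g w x))) ⟩
    sumFun m n (λ g → ∑[ y < n ] ∑[ x < n ] F (y ∷ insertAt g w x))
      ≡⟨ sumFun-cong m n (λ g → sum-cong-≗ (λ y → sum-cong-≗ (λ x → sym (F-resp (insertAt-∷ g w x y))))) ⟩
    sumFun (suc m) n (λ g → ∑[ x < n ] F (insertAt g (suc w) x)) ∎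
    where
    open ≡-Reasoning
    G : (Fin (suc m) → Fin n) → ℕ
    G g = ∑[ y < n ] F (y ∷ g)

  sumFun-suc : ∀ m n (F : (Fin m → Fin (suc n)) → ℕ) → F Preserves _≗_ ⟶ _≡_ →
               (∀ g i → g i ≡ zero → F g ≡ 0) →
               sumFun m (suc n) F ≡ sumFun m n (λ g → F (suc ∘ g))
  sumFun-suc zero    n F F-resp F-zero = F-resp (λ ())
  sumFun-suc (suc m) n F F-resp F-zero = begin
    sumFun m (suc n) (λ g → F (zero ∷ g) + ∑[ x < n ] F (suc x ∷ g))
      ≡⟨ sumFun-cong m (suc n) (λ g → cong (_+ ∑[ x < n ] F (suc x ∷ g)) (F-zero (zero ∷ g) zero refl)) ⟩
    sumFun m (suc n) (λ g → ∑[ x < n ] F (suc x ∷ g))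
      ≡⟨ sumFun-suc m n _ (λ f≗g → sum-cong-≗ (λ x → F-resp (∷-cong (suc x) f≗g))) G-zero ⟩
    sumFun m n (λ g → ∑[ x < n ] F (suc x ∷ (suc ∘ g)))
      ≡⟨ sumFun-cong m n (λ g → sum-cong-≗ (λ x → F-resp (suc-∷ g x))) ⟩
    sumFun (suc m) n (λ g → F (suc ∘ g)) ∎
    where
    open ≡-Reasoning
    G-zero : ∀ g i → g i ≡ zero → ∑[ x < n ] F (suc x ∷ g) ≡ 0
    G-zero g i gi≡0 = trans (sum-cong-≗ (λ x → F-zero (suc x ∷ g) (suc i) gi≡0)) (sum-replicate-zero n)

module Dispositions where
  open import Level using (0ℓ)
  open import Data.Nat.Base as ℕ using (ℕ; zero; suc; _*_; z<s; s<s)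
  open import Data.Nat.Properties using (n≮0; *-identityʳ; *-zeroʳ)
  open import Data.Fin as Fin using (Fin; zero; suc; toℕ; punchIn; punchOut)
  open import Data.Fin.Properties
    using (all?; any?; _≟_; toℕ<n; suc-injective; punchIn-injective; punchIn-punchOut; punchInᵢ≢i)
  open import Data.Vec.Functional using (insertAt)
  open import Data.Vec.Functional.Properties using (insertAt-lookup; insertAt-punchIn)
  open import Data.List.Membership.Propositional using (_∈_)
  open import Data.List.Relation.Unary.All as All using ()
  open import Data.List.Base using (map)
  open import Data.Nat.ListAction using () renaming (sum to sumList)
  open import Data.Product.Base using (_×_; _,_; proj₁; proj₂; ∃)
  open import Function.Base using (_∘_)
  open import Function.Bundles using (_⇔_; Equivalence)
  open import Relation.Binary.Core using (Rel; _Preserves_⟶_)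
  open import Relation.Binary.Definitions using (Decidable)
  open import Relation.Binary.PropositionalEquality
  open import Relation.Nullary.Decidable using (Dec; yes; no; _×-dec_; _→-dec_; ¬?)
  open import Relation.Nullary.Negation.Core using (¬_; contradiction)

  open import Defs using (Bijection; σ; IsDisposition; isDisposition?; Digraph; size; arcs; allFuns)
  open Indicators
  open Sums

  Disposition : Rel ℕ 0ℓ → ∀ n → (Fin n → Fin n) → Set
  Disposition S n f = Bijection f × (∀ i j → S (toℕ i) (toℕ j) → f j Fin.< f i)

  bijection? : ∀ {n} (f : Fin n → Fin n) → Dec (Bijection f)
  bijection? f = all? (λ i → all? (λ j → (f i ≟ f j) →-dec (i ≟ j))) ×-dec all? (λ y → any? (λ x → f x ≟ y))

  disposition? : ∀ {S} → Decidable S → ∀ n f → Dec (Disposition S n f)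
  disposition? S? n f =
    bijection? f ×-dec all? (λ i → all? (λ j → S? (toℕ i) (toℕ j) →-dec (f j Fin.<? f i)))

  #dispositions : ∀ {S} → Decidable S → ℕ → ℕ
  #dispositions S? n = sumFun n n (χ ∘ disposition? S? n)

  Bijection-resp-≗ : ∀ {n} {f g : Fin n → Fin n} → f ≗ g → Bijection f → Bijection g
  Bijection-resp-≗ f≗g (inj , surj) =
    (λ i j gi≡gj → inj i j (trans (f≗g i) (trans gi≡gj (sym (f≗g j))))) ,
    (λ y → proj₁ (surj y) , trans (sym (f≗g _)) (proj₂ (surj y)))

  Disposition-resp-≗ : ∀ {S n} {f g : Fin n → Fin n} → f ≗ g → Disposition S n f → Disposition S n g
  Disposition-resp-≗ f≗g (bij , arc) =
    Bijection-resp-≗ f≗g bij , (λ i j s → subst₂ Fin._<_ (f≗g j) (f≗g i) (arc i j s))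

  χ-disposition-resp-≗ : ∀ {S} (S? : Decidable S) n → (χ ∘ disposition? S? n) Preserves _≗_ ⟶ _≡_
  χ-disposition-resp-≗ {S} S? n {f} {g} f≗g =
    χ-cong (Disposition-resp-≗ {S} f≗g) (Disposition-resp-≗ {S} (sym ∘ f≗g)) (disposition? S? n f) (disposition? S? n g)

  #dispositions-cong : ∀ {S T} (S? : Decidable S) (T? : Decidable T) n →
                       (∀ x y → x ℕ.< n → y ℕ.< n → S x y ⇔ T x y) →
                       #dispositions S? n ≡ #dispositions T? n
  #dispositions-cong {S} {T} S? T? n S⇔T =
    sumFun-cong n n (λ f → χ-cong (to f) (from f) (disposition? S? n f) (disposition? T? n f))
    where
    S⇔T′ : ∀ (i j : Fin n) → S (toℕ i) (toℕ j) ⇔ T (toℕ i) (toℕ j)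
    S⇔T′ i j = S⇔T (toℕ i) (toℕ j) (toℕ<n i) (toℕ<n j)
    to : ∀ f → Disposition S n f → Disposition T n f
    to f (bij , arc) = bij , λ i j t → arc i j (Equivalence.from (S⇔T′ i j) t)
    from : ∀ f → Disposition T n f → Disposition S n f
    from f (bij , arc) = bij , λ i j s → arc i j (Equivalence.to (S⇔T′ i j) s)

  σ≡#dispositions : ∀ (G : Digraph) {S} (S? : Decidable S) →
                    (∀ i j → S (toℕ i) (toℕ j) ⇔ (i , j) ∈ arcs G) →
                    σ G ≡ #dispositions S? (size G)
  σ≡#dispositions G {S} S? S⇔arc = begin
    σ G
      ≡⟨ length-filter≡sum-χ (isDisposition? G) (allFuns n n) ⟩
    sumList (map (χ ∘ isDisposition? G) (allFuns n n))
      ≡⟨ sumList-allFuns n n _ (λ {f} {g} f≗g → χ-cong (IsDisposition-resp f≗g) (IsDisposition-resp (sym ∘ f≗g))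
                                                     (isDisposition? G f) (isDisposition? G g)) ⟩
    sumFun n n (χ ∘ isDisposition? G)
      ≡⟨ sumFun-cong n n (λ f → χ-cong (to f) (from f) (isDisposition? G f) (disposition? S? n f)) ⟩
    #dispositions S? n ∎
    where
    open ≡-Reasoning
    n = size G
    IsDisposition-resp : ∀ {f g} → f ≗ g → IsDisposition G f → IsDisposition G g
    IsDisposition-resp f≗g (bij , arc) =
      Bijection-resp-≗ f≗g bij , All.map (λ {a} → subst₂ Fin._<_ (f≗g (proj₂ a)) (f≗g (proj₁ a))) arc
    to : ∀ f → IsDisposition G f → Disposition S n f
    to f (bij , arc) = bij , λ i j s → All.lookup arc (Equivalence.to (S⇔arc i j) s)
    from : ∀ f → Disposition S n f → IsDisposition G f
    from f (bij , arc) = bij , All.tabulate (λ {(i , j)} a → arc i j (Equivalence.from (S⇔arc i j) a))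

  ∑-χ-preimage : ∀ {n} {f : Fin n → Fin n} → Bijection f → ∀ y → ∑[ w < n ] χ (f w ≟ y) ≡ 1
  ∑-χ-preimage {n} {f} (inj , surj) y with surj y
  ... | w₀ , fw₀≡y = trans (sum-cong-≗ (λ w → trans (χ-cong (λ fw≡y → inj w w₀ (trans fw≡y (sym fw₀≡y)))
                                                              (λ { refl → fw₀≡y }) (f w ≟ y) (w ≟ w₀))
                                                      (sym (*-identityʳ _))))
                           (∑-χ≟ w₀ (λ _ → 1))

  Sink : Rel ℕ 0ℓ → ∀ n → Fin n → Set
  Sink S n w = ∀ (j : Fin n) → ¬ S (toℕ w) (toℕ j)

  sink? : ∀ {S} → Decidable S → ∀ n w → Dec (Sink S n w)
  sink? S? n w = all? (λ j → ¬? (S? (toℕ w) (toℕ j)))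

  punchInℕ : ℕ → ℕ → ℕ
  punchInℕ zero    x       = suc x
  punchInℕ (suc w) zero    = zero
  punchInℕ (suc w) (suc x) = suc (punchInℕ w x)

  toℕ-punchIn : ∀ {n} (w : Fin (suc n)) i → toℕ (punchIn w i) ≡ punchInℕ (toℕ w) (toℕ i)
  toℕ-punchIn zero    i       = refl
  toℕ-punchIn (suc w) zero    = refl
  toℕ-punchIn (suc w) (suc i) = cong suc (toℕ-punchIn w i)

  -- Graphs are relations on vertex indices, so deleting vertex w is the renumbering punchInℕ w.
  removeVertex : Rel ℕ 0ℓ → ℕ → Rel ℕ 0ℓ
  removeVertex S w x y = S (punchInℕ w x) (punchInℕ w y)

  removeVertex? : ∀ {S} → Decidable S → ∀ w → Decidable (removeVertex S w)
  removeVertex? S? w x y = S? (punchInℕ w x) (punchInℕ w y)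

  data PunchInView {n} (w : Fin (suc n)) : Fin (suc n) → Set where
    at     : PunchInView w w
    beside : ∀ i → PunchInView w (punchIn w i)

  punchInView : ∀ {n} (w j : Fin (suc n)) → PunchInView w j
  punchInView w j with w ≟ j
  ... | yes refl = at
  ... | no w≢j   = subst (PunchInView w) (punchIn-punchOut w≢j) (beside (punchOut w≢j))

  module _ {S : Rel ℕ 0ℓ} (S? : Decidable S) {n : ℕ} (w : Fin (suc n)) where

    sendToBottom : (Fin n → Fin n) → Fin (suc n) → Fin (suc n)
    sendToBottom g = insertAt (suc ∘ g) w zero

    private
      S₋ = removeVertex S (toℕ w)

      at-w : ∀ g → sendToBottom g w ≡ zero
      at-w g = insertAt-lookup (suc ∘ g) w zero

      at-punchIn : ∀ g i → sendToBottom g (punchIn w i) ≡ suc (g i)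
      at-punchIn g i = insertAt-punchIn (suc ∘ g) w zero i

      S⇒S₋ : ∀ {i j} → S (toℕ (punchIn w i)) (toℕ (punchIn w j)) → S₋ (toℕ i) (toℕ j)
      S⇒S₋ {i} {j} = subst₂ S (toℕ-punchIn w i) (toℕ-punchIn w j)

      S₋⇒S : ∀ {i j} → S₋ (toℕ i) (toℕ j) → S (toℕ (punchIn w i)) (toℕ (punchIn w j))
      S₋⇒S {i} {j} = subst₂ S (sym (toℕ-punchIn w i)) (sym (toℕ-punchIn w j))

    detachSink : ∀ g → Disposition S (suc n) (sendToBottom g) → Sink S (suc n) w × Disposition S₋ n g
    detachSink g ((inj , surj) , arc) = sink , (inj′ , surj′) , arc′
      where
      sink : Sink S (suc n) w
      sink j s = n≮0 (subst (λ z → toℕ (sendToBottom g j) ℕ.< toℕ z) (at-w g) (arc w j s))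
      inj′ : ∀ i j → g i ≡ g j → i ≡ j
      inj′ i j gi≡gj = punchIn-injective w i j
        (inj _ _ (trans (at-punchIn g i) (trans (cong suc gi≡gj) (sym (at-punchIn g j)))))
      surj′ : ∀ y → ∃ λ x → g x ≡ y
      surj′ y with surj (suc y)
      ... | x , fx≡y with punchInView w x
      ...   | at       = contradiction (trans (sym (at-w g)) fx≡y) λ ()
      ...   | beside i = i , suc-injective (trans (sym (at-punchIn g i)) fx≡y)
      arc′ : ∀ i j → S₋ (toℕ i) (toℕ j) → g j Fin.< g i
      arc′ i j s = ℕ.s<s⁻¹ (subst₂ Fin._<_ (at-punchIn g j) (at-punchIn g i)
                                          (arc (punchIn w i) (punchIn w j) (S₋⇒S s)))

    attachSink : ∀ g → Sink S (suc n) w × Disposition S₋ n g → Disposition S (suc n) (sendToBottom g)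
    attachSink g (sink , (inj′ , surj′) , arc′) = (inj , surj) , arc
      where
      inj : ∀ x y → sendToBottom g x ≡ sendToBottom g y → x ≡ y
      inj x y fx≡fy with punchInView w x | punchInView w y
      ... | at       | at       = refl
      ... | at       | beside j = contradiction (trans (sym (at-w g)) (trans fx≡fy (at-punchIn g j))) λ ()
      ... | beside i | at       = contradiction (trans (sym (at-w g)) (trans (sym fx≡fy) (at-punchIn g i))) λ ()
      ... | beside i | beside j = cong (punchIn w) (inj′ i j (suc-injective
              (trans (sym (at-punchIn g i)) (trans fx≡fy (at-punchIn g j)))))
      surj : ∀ y → ∃ λ x → sendToBottom g x ≡ y
      surj zero    = w , at-w g
      surj (suc y) = punchIn w (proj₁ (surj′ y)) , trans (at-punchIn g _) (cong suc (proj₂ (surj′ y)))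
      arc : ∀ x y → S (toℕ x) (toℕ y) → sendToBottom g y Fin.< sendToBottom g x
      arc x y s with punchInView w x | punchInView w y
      ... | at       | _        = contradiction s (sink y)
      ... | beside i | at       = subst₂ Fin._<_ (sym (at-w g)) (sym (at-punchIn g i)) z<s
      ... | beside i | beside j = subst₂ Fin._<_ (sym (at-punchIn g j)) (sym (at-punchIn g i))
                                         (s<s (arc′ i j (S⇒S₋ s)))

    #dispositions-at-bottom : sumFun (suc n) (suc n) (λ f → χ (f w ≟ zero) * χ (disposition? S? (suc n) f)) ≡
                              χ (sink? S? (suc n) w) * #dispositions (removeVertex? S? (toℕ w)) n
    #dispositions-at-bottom = begin
      sumFun (suc n) (suc n) (λ f → χ (f w ≟ zero) * δ f)
        ≡⟨ sumFun-insertAt n (suc n) w _ (λ {f} {g} f≗g → cong₂ _*_ (cong (χ ∘ (_≟ zero)) (f≗g w)) (δ-resp f≗g)) ⟩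
      sumFun n (suc n) (λ g → ∑[ x < suc n ] (χ (insertAt g w x w ≟ zero) * δ (insertAt g w x)))
        ≡⟨ sumFun-cong n (suc n) (λ g → sum-cong-≗ (λ x →
             cong (λ y → χ (y ≟ zero) * δ (insertAt g w x)) (insertAt-lookup g w x))) ⟩
      sumFun n (suc n) (λ g → ∑[ x < suc n ] (χ (x ≟ zero) * δ (insertAt g w x)))
        ≡⟨ sumFun-cong n (suc n) (λ g → ∑-χ≟ zero (λ x → δ (insertAt g w x))) ⟩
      sumFun n (suc n) (λ g → δ (insertAt g w zero))
        ≡⟨ sumFun-suc n n _ (λ g≗h → δ-resp (insertAt-cong g≗h)) not-injective ⟩
      sumFun n n (λ g → δ (sendToBottom g))
        ≡⟨ sumFun-cong n n (λ g → trans (χ-cong (detachSink g) (attachSink g) _ (sink? S? (suc n) w ×-dec disposition? S?₋ n g))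
                                         (χ-× (sink? S? (suc n) w) (disposition? S?₋ n g) _)) ⟩
      sumFun n n (λ g → χ (sink? S? (suc n) w) * χ (disposition? S?₋ n g))
        ≡⟨ sumFun-*ˡ n n (χ (sink? S? (suc n) w)) (χ ∘ disposition? S?₋ n) ⟩
      χ (sink? S? (suc n) w) * #dispositions S?₋ n ∎
      where
      open ≡-Reasoning
      S?₋ = removeVertex? S? (toℕ w)
      δ : (Fin (suc n) → Fin (suc n)) → ℕ
      δ = χ ∘ disposition? S? (suc n)
      δ-resp : δ Preserves _≗_ ⟶ _≡_
      δ-resp = χ-disposition-resp-≗ S? (suc n)
      insertAt-cong : ∀ {g h : Fin n → Fin (suc n)} → g ≗ h → insertAt g w zero ≗ insertAt h w zero
      insertAt-cong {g} {h} g≗h x with punchInView w x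
      ... | at       = trans (insertAt-lookup g w zero) (sym (insertAt-lookup h w zero))
      ... | beside i = trans (insertAt-punchIn g w zero i) (trans (g≗h i) (sym (insertAt-punchIn h w zero i)))
      not-injective : ∀ g i → g i ≡ zero → δ (insertAt g w zero) ≡ 0
      not-injective g i gi≡0 = χ-no (disposition? S? (suc n) (insertAt g w zero)) λ ((inj , _) , _) →
        punchInᵢ≢i w i (inj (punchIn w i) w
          (trans (insertAt-punchIn g w zero i) (trans gi≡0 (sym (insertAt-lookup g w zero)))))

  #dispositions-sinks : ∀ {S} (S? : Decidable S) n →
                        #dispositions S? (suc n) ≡
                        ∑[ w < suc n ] (χ (sink? S? (suc n) w) * #dispositions (removeVertex? S? (toℕ w)) n)
  #dispositions-sinks S? n = begin
    sumFun (suc n) (suc n) δ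
      ≡⟨ sumFun-cong (suc n) (suc n) split-at-bottom ⟩
    sumFun (suc n) (suc n) (λ f → ∑[ w < suc n ] (χ (f w ≟ zero) * δ f))
      ≡⟨ sumFun-∑-comm (suc n) (suc n) (suc n) (λ w f → χ (f w ≟ zero) * δ f) ⟩
    ∑[ w < suc n ] sumFun (suc n) (suc n) (λ f → χ (f w ≟ zero) * δ f)
      ≡⟨ sum-cong-≗ (#dispositions-at-bottom S?) ⟩
    ∑[ w < suc n ] (χ (sink? S? (suc n) w) * #dispositions (removeVertex? S? (toℕ w)) n) ∎
    where
    open ≡-Reasoning
    δ : (Fin (suc n) → Fin (suc n)) → ℕ
    δ = χ ∘ disposition? S? (suc n)
    split-at-bottom : ∀ f → δ f ≡ ∑[ w < suc n ] (χ (f w ≟ zero) * δ f)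
    split-at-bottom f with disposition? S? (suc n) f
    ... | yes (bij , _) = sym (trans (sum-cong-≗ (λ w → *-identityʳ (χ (f w ≟ zero)))) (∑-χ-preimage bij zero))
    ... | no _          = sym (trans (sum-cong-≗ (λ w → *-zeroʳ (χ (f w ≟ zero)))) (sum-replicate-zero (suc n)))

module Vertices where
  open import Data.Nat.Base using (ℕ; zero; suc; _+_; _<_; z<s; s<s)
  open import Data.Nat.Properties using (_≟_)
  open import Relation.Binary.PropositionalEquality
  open import Relation.Nullary.Decidable using (Dec; yes; no)

  open Dispositions using (punchInℕ)

  data Vertex : Set where
    V U Z : ℕ → Vertex

  data Arc : Vertex → Vertex → Set where
    v→v : ∀ {i} → Arc (V i) (V (suc i))
    v→u : ∀ {i} → Arc (V i) (U i)
    v₂→z₁ : Arc (V 1) (Z 0)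
    u→u : ∀ {j} → Arc (U j) (U (suc j))
    z→z : ∀ {k} → Arc (Z k) (Z (suc k))

  arc? : ∀ a b → Dec (Arc a b)
  arc? (V i) (V j) with j ≟ suc i
  ... | yes refl = yes v→v
  ... | no j≢1+i = no λ { v→v → j≢1+i refl }
  arc? (V i) (U j) with j ≟ i
  ... | yes refl = yes v→u
  ... | no j≢i = no λ { v→u → j≢i refl }
  arc? (V i) (Z k) with i ≟ 1 | k ≟ 0
  ... | yes refl | yes refl = yes v₂→z₁
  ... | no i≢1   | _        = no λ { v₂→z₁ → i≢1 refl }
  ... | _        | no k≢0   = no λ { v₂→z₁ → k≢0 refl }
  arc? (U i) (U j) with j ≟ suc i
  ... | yes refl = yes u→u
  ... | no j≢1+i = no λ { u→u → j≢1+i refl }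
  arc? (Z i) (Z j) with j ≟ suc i
  ... | yes refl = yes z→z
  ... | no j≢1+i = no λ { z→z → j≢1+i refl }
  arc? (U i) (V j) = no λ ()
  arc? (U i) (Z j) = no λ ()
  arc? (Z i) (V j) = no λ ()
  arc? (Z i) (U j) = no λ ()

  shiftV shiftU : Vertex → Vertex
  shiftV (V i) = V (suc i)
  shiftV a     = a
  shiftU (U j) = U (suc j)
  shiftU a     = a

  -- Vertex x of the graph with p vertices v, q vertices u and a chain of z's hanging from v₂,
  -- numbered as in Defs: v_(i+1) ↦ i, u_(j+1) ↦ p + j, z_(k+1) ↦ p + q + k.
  vertex : ℕ → ℕ → ℕ → Vertex
  vertex (suc p) q       zero    = V 0
  vertex (suc p) q       (suc x) = shiftV (vertex p q x)
  vertex zero    (suc q) zero    = U 0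
  vertex zero    (suc q) (suc x) = shiftU (vertex zero q x)
  vertex zero    zero    x       = Z x

  data Position (p q : ℕ) : ℕ → Set where
    inV : ∀ {i} → i < p → Position p q i
    inU : ∀ {j} → j < q → Position p q (p + j)
    inZ : ∀ k → Position p q (p + q + k)

  position : ∀ p q x → Position p q x
  position (suc p) q zero = inV z<s
  position (suc p) q (suc x) with position p q x
  ... | inV i<p = inV (s<s i<p)
  ... | inU j<q = inU j<q
  ... | inZ k   = inZ k
  position zero (suc q) zero = inU z<s
  position zero (suc q) (suc x) with position zero q x
  ... | inU j<q = inU (s<s j<q)
  ... | inZ k   = inZ k
  position zero zero x = inZ x

  vertex-V : ∀ {p} q {i} → i < p → vertex p q i ≡ V i
  vertex-V q {zero}  (s<s _)   = refl
  vertex-V q {suc i} (s<s i<p) = cong shiftV (vertex-V q i<p)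

  vertex-U : ∀ p {q j} → j < q → vertex p q (p + j) ≡ U j
  vertex-U (suc p) j<q = cong shiftV (vertex-U p j<q)
  vertex-U zero {j = zero}  (s<s _)   = refl
  vertex-U zero {j = suc j} (s<s j<q) = cong shiftU (vertex-U zero j<q)

  vertex-Z : ∀ p q k → vertex p q (p + q + k) ≡ Z k
  vertex-Z (suc p) q       k = cong shiftV (vertex-Z p q k)
  vertex-Z zero    (suc q) k = cong shiftU (vertex-Z zero q k)
  vertex-Z zero    zero    k = refl

  𝔊Rel : ℕ → ℕ → ℕ → ℕ → Set
  𝔊Rel p q x y = Arc (vertex p q x) (vertex p q y)

  𝔊Rel? : ∀ p q x y → Dec (𝔊Rel p q x y)
  𝔊Rel? p q x y = arc? (vertex p q x) (vertex p q y)

  vertex-zero-notV : ∀ q x → shiftV (vertex zero q x) ≡ vertex zero q x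
  vertex-zero-notV q x with position zero q x
  ... | inU j<q = trans (cong shiftV (vertex-U zero j<q)) (sym (vertex-U zero j<q))
  ... | inZ k   = trans (cong shiftV (vertex-Z zero q k)) (sym (vertex-Z zero q k))

  vertex-punchIn-V : ∀ p q x → vertex (suc p) q (punchInℕ p x) ≡ vertex p q x
  vertex-punchIn-V zero    q x       = vertex-zero-notV q x
  vertex-punchIn-V (suc p) q zero    = refl
  vertex-punchIn-V (suc p) q (suc x) = cong shiftV (vertex-punchIn-V p q x)

  vertex-punchIn-U : ∀ p q x → vertex p (suc q) (punchInℕ (p + q) x) ≡ vertex p q x
  vertex-punchIn-U (suc p) q       zero    = refl
  vertex-punchIn-U (suc p) q       (suc x) = cong shiftV (vertex-punchIn-U p q x)
  vertex-punchIn-U zero    zero    x       = refl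
  vertex-punchIn-U zero    (suc q) zero    = refl
  vertex-punchIn-U zero    (suc q) (suc x) = cong shiftU (vertex-punchIn-U zero q x)

  punchInℕ-< : ∀ {n x} → x < n → punchInℕ n x ≡ x
  punchInℕ-< {suc n} {zero}  _         = refl
  punchInℕ-< {suc n} {suc x} (s<s x<n) = cong suc (punchInℕ-< x<n)

module ExtendedGraph where
  open import Data.Nat.Base using (ℕ; zero; suc; _+_; _∸_; _<_; _≤_; z<s; s<s; s≤s; s<s⁻¹)
  open import Data.Nat.Properties
  open import Data.Fin.Base using (Fin; zero; suc; toℕ; fromℕ; fromℕ<; inject≤; _↑ˡ_; _↑ʳ_)
  open import Data.Fin.Properties
    using (toℕ<n; toℕ-injective; toℕ-↑ˡ; toℕ-↑ʳ; toℕ-fromℕ; toℕ-fromℕ<; toℕ-inject₁; toℕ-inject≤)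
  open import Data.List.Base using (map)
  open import Data.List.Membership.Propositional using (_∈_)
  open import Data.List.Membership.Propositional.Properties
    using (∈-map⁺; ∈-map⁻; ∈-++⁺ˡ; ∈-++⁺ʳ; ∈-++⁻; ∈-allFin)
  open import Data.List.Relation.Unary.Any using (here; there)
  open import Data.Product.Base using (_×_; _,_; ∃₂)
  open import Data.Sum.Base as Sum using (_⊎_; inj₁; inj₂)
  open import Function.Bundles using (_⇔_; mk⇔; Equivalence)
  open import Relation.Binary.PropositionalEquality
  open import Relation.Nullary.Negation.Core using (contradiction)

  open import Defs using (Digraph; size; arcs; addLeaf; extend; pathArcs; 𝔊; v₂; σ)
  open Dispositions using (#dispositions; σ≡#dispositions)
  open Vertices

  ArcIndex : Digraph → ℕ → ℕ → Set
  ArcIndex G x y = ∃₂ λ i j → (i , j) ∈ arcs G × toℕ i ≡ x × toℕ j ≡ y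

  ∈-arcs⇔ArcIndex : ∀ G i j → (i , j) ∈ arcs G ⇔ ArcIndex G (toℕ i) (toℕ j)
  ∈-arcs⇔ArcIndex G i j = mk⇔ (λ a → i , j , a , refl , refl)
    λ (i′ , j′ , a , i′≡i , j′≡j) → subst (_∈ arcs G) (cong₂ _,_ (toℕ-injective i′≡i) (toℕ-injective j′≡j)) a

  ArcIndex-addLeaf : ∀ G v x y → ArcIndex (addLeaf G v) x y ⇔ ((x ≡ toℕ v × y ≡ size G) ⊎ ArcIndex G x y)
  ArcIndex-addLeaf G v x y = mk⇔ to from
    where
    to : ArcIndex (addLeaf G v) x y → (x ≡ toℕ v × y ≡ size G) ⊎ ArcIndex G x y
    to (_ , _ , here refl , refl , refl) = inj₁ (toℕ-inject₁ v , toℕ-fromℕ (size G))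
    to (_ , _ , there a , refl , refl) with ∈-map⁻ _ a
    ... | (i , j) , a′ , refl = inj₂ (i , j , a′ , sym (toℕ-inject₁ i) , sym (toℕ-inject₁ j))
    from : (x ≡ toℕ v × y ≡ size G) ⊎ ArcIndex G x y → ArcIndex (addLeaf G v) x y
    from (inj₁ (refl , refl)) = _ , _ , here refl , toℕ-inject₁ v , toℕ-fromℕ (size G)
    from (inj₂ (i , j , a , refl , refl)) =
      _ , _ , there (∈-map⁺ _ a) , toℕ-inject₁ i , toℕ-inject₁ j

  data ChainArc (v n : ℕ) : ℕ → ℕ → ℕ → Set where
    root : ∀ {c} → ChainArc v n (suc c) v n
    next : ∀ {c x} → n ≤ x → suc x < n + c → ChainArc v n c x (suc x)

  root-of-pos : ∀ {v n c} → 0 < c → ChainArc v n c v n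
  root-of-pos {c = suc c} _ = root

  ChainArc-suc : ∀ v n c x y → ChainArc v n (suc c) x y ⇔ ((x ≡ v × y ≡ n) ⊎ ChainArc n (suc n) c x y)
  ChainArc-suc v n c x y = mk⇔ to from
    where
    to : ChainArc v n (suc c) x y → (x ≡ v × y ≡ n) ⊎ ChainArc n (suc n) c x y
    to root = inj₁ (refl , refl)
    to (next n≤x x<) with m≤n⇒m<n∨m≡n n≤x
    ... | inj₁ n<x  = inj₂ (next n<x (subst (suc x <_) (+-suc n c) x<))
    ... | inj₂ refl = inj₂ (root-of-pos (+-cancelˡ-< n 0 c (subst (_< n + c) (sym (+-identityʳ n))
                                                                (s<s⁻¹ (subst (suc n <_) (+-suc n c) x<)))))
    from : (x ≡ v × y ≡ n) ⊎ ChainArc n (suc n) c x y → ChainArc v n (suc c) x y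
    from (inj₁ (refl , refl)) = root
    from (inj₂ (root {c′})) = next ≤-refl (subst (suc n <_) (sym (+-suc n (suc c′))) (s<s (m<m+n n z<s)))
    from (inj₂ (next {x = x} n<x x<)) = next (<⇒≤ n<x) (subst (suc x <_) (sym (+-suc n c)) x<)

  ArcIndex-extend : ∀ c G v x y → ArcIndex (extend G v c) x y ⇔ (ArcIndex G x y ⊎ ChainArc (toℕ v) (size G) c x y)
  ArcIndex-extend zero G v x y = mk⇔ inj₁ from
    where
    from : ArcIndex G x y ⊎ ChainArc (toℕ v) (size G) 0 x y → ArcIndex G x y
    from (inj₁ a) = a
    from (inj₂ (next n≤x x<)) = contradiction (≤-trans n≤x (n≤1+n x)) (<⇒≱ (subst (_ <_) (+-identityʳ _) x<))
  ArcIndex-extend (suc c) G v x y = mk⇔ to from′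
    where
    n = size G
    ih = ArcIndex-extend c (addLeaf G v) (fromℕ n) x y
    leaf = ArcIndex-addLeaf G v x y
    chain = ChainArc-suc (toℕ v) n c x y
    attach : ∀ {w w′} → w ≡ w′ → ChainArc w (suc n) c x y → ChainArc w′ (suc n) c x y
    attach refl ch = ch
    to : ArcIndex (extend G v (suc c)) x y → ArcIndex G x y ⊎ ChainArc (toℕ v) n (suc c) x y
    to a with Equivalence.to ih a
    ... | inj₂ ch = inj₂ (Equivalence.from chain (inj₂ (attach (toℕ-fromℕ n) ch)))
    ... | inj₁ a′ with Equivalence.to leaf a′
    ...   | inj₁ e  = inj₂ (Equivalence.from chain (inj₁ e))
    ...   | inj₂ a″ = inj₁ a″
    from′ : ArcIndex G x y ⊎ ChainArc (toℕ v) n (suc c) x y → ArcIndex (extend G v (suc c)) x y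
    from′ (inj₁ a) = Equivalence.from ih (inj₁ (Equivalence.from leaf (inj₂ a)))
    from′ (inj₂ ch) with Equivalence.to chain ch
    ... | inj₁ e   = Equivalence.from ih (inj₁ (Equivalence.from leaf (inj₁ e)))
    ... | inj₂ ch′ = Equivalence.from ih (inj₂ (attach (sym (toℕ-fromℕ n)) ch′))

  ∈-pathArcs⇔ : ∀ m (i j : Fin m) → (i , j) ∈ pathArcs m ⇔ (toℕ j ≡ suc (toℕ i))
  ∈-pathArcs⇔ m i j = mk⇔ (to m i j) (from m i j)
    where
    to : ∀ m (i j : Fin m) → (i , j) ∈ pathArcs m → toℕ j ≡ suc (toℕ i)
    to (suc (suc m)) zero (suc zero) (here refl) = refl
    to (suc (suc m)) i j (there a) with ∈-map⁻ _ a
    ... | (i′ , j′) , a′ , refl = cong suc (to (suc m) i′ j′ a′)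
    from : ∀ m (i j : Fin m) → toℕ j ≡ suc (toℕ i) → (i , j) ∈ pathArcs m
    from (suc (suc m)) zero    (suc zero)    _ = here refl
    from (suc (suc m)) (suc i) (suc j)       e = there (∈-map⁺ _ (from (suc m) i j (suc-injective e)))
    from (suc zero)    zero    (suc ())      _
    from (suc (suc m)) zero    (suc (suc j)) ()

  data 𝔊Arc (p q : ℕ) : ℕ → ℕ → Set where
    vv : ∀ {x} → suc x < p → 𝔊Arc p q x (suc x)
    uu : ∀ {x} → p ≤ x → suc x < p + q → 𝔊Arc p q x (suc x)
    vu : ∀ {x} → x < q → 𝔊Arc p q x (p + x)

  module _ (n₁ n₂ : ℕ) (le : n₁ ≤ n₂) where

    private
      next-v : ∀ {x y} → y ≡ suc x → y < n₂ → 𝔊Arc n₂ n₁ x y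
      next-v refl = vv
      next-u : ∀ {x y} → n₂ ≤ x → y ≡ suc x → y < n₂ + n₁ → 𝔊Arc n₂ n₁ x y
      next-u n₂≤x refl = uu n₂≤x
      rung : ∀ {x y} → x < n₁ → y ≡ n₂ + x → 𝔊Arc n₂ n₁ x y
      rung x<n₁ refl = vu x<n₁

    ArcIndex-𝔊⇒ : ∀ {x y} → ArcIndex (𝔊 n₁ n₂ le) x y → 𝔊Arc n₂ n₁ x y
    ArcIndex-𝔊⇒ (_ , _ , a , refl , refl) with ∈-++⁻ (map _ (pathArcs n₂)) a
    ... | inj₁ a₁ with ∈-map⁻ _ a₁
    ...   | (i , j) , p , refl =
            next-v (trans (toℕ-↑ˡ j n₁) (trans (Equivalence.to (∈-pathArcs⇔ n₂ i j) p) (cong suc (sym (toℕ-↑ˡ i n₁)))))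
                   (subst (_< n₂) (sym (toℕ-↑ˡ j n₁)) (toℕ<n j))
    ArcIndex-𝔊⇒ (_ , _ , a , refl , refl) | inj₂ a₂ with ∈-++⁻ (map _ (pathArcs n₁)) a₂
    ... | inj₁ a₁ with ∈-map⁻ _ a₁
    ...   | (i , j) , p , refl =
            next-u (subst (n₂ ≤_) (sym (toℕ-↑ʳ n₂ i)) (m≤m+n n₂ (toℕ i)))
                   (trans (toℕ-↑ʳ n₂ j) (trans (cong (n₂ +_) (Equivalence.to (∈-pathArcs⇔ n₁ i j) p))
                                               (trans (+-suc n₂ (toℕ i)) (cong suc (sym (toℕ-↑ʳ n₂ i))))))
                   (toℕ<n (n₂ ↑ʳ j))
    ArcIndex-𝔊⇒ (_ , _ , a , refl , refl) | inj₂ a₂ | inj₂ a₃ with ∈-map⁻ _ a₃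
    ... | k , _ , refl =
            rung (subst (_< n₁) (sym (trans (toℕ-↑ˡ (inject≤ k le) n₁) (toℕ-inject≤ k le))) (toℕ<n k))
                 (trans (toℕ-↑ʳ n₂ k) (cong (n₂ +_) (sym (trans (toℕ-↑ˡ (inject≤ k le) n₁) (toℕ-inject≤ k le)))))

    ArcIndex-𝔊⇐ : ∀ {x y} → 𝔊Arc n₂ n₁ x y → ArcIndex (𝔊 n₁ n₂ le) x y
    ArcIndex-𝔊⇐ (vv {x} x+1<n₂) =
      fromℕ< x<n₂ ↑ˡ n₁ , fromℕ< x+1<n₂ ↑ˡ n₁ ,
      ∈-++⁺ˡ (∈-map⁺ _ (Equivalence.from (∈-pathArcs⇔ n₂ _ _)
                          (trans (toℕ-fromℕ< x+1<n₂) (cong suc (sym (toℕ-fromℕ< x<n₂)))))) ,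
      trans (toℕ-↑ˡ _ n₁) (toℕ-fromℕ< x<n₂) , trans (toℕ-↑ˡ _ n₁) (toℕ-fromℕ< x+1<n₂)
      where x<n₂ = <-trans (n<1+n x) x+1<n₂
    ArcIndex-𝔊⇐ (uu {x} n₂≤x x+1<) =
      n₂ ↑ʳ fromℕ< j<n₁ , n₂ ↑ʳ fromℕ< j+1<n₁ ,
      ∈-++⁺ʳ (map _ (pathArcs n₂)) (∈-++⁺ˡ (∈-map⁺ _ (Equivalence.from (∈-pathArcs⇔ n₁ _ _)
                          (trans (toℕ-fromℕ< j+1<n₁) (cong suc (sym (toℕ-fromℕ< j<n₁))))))) ,
      trans (toℕ-↑ʳ n₂ _) (trans (cong (n₂ +_) (toℕ-fromℕ< j<n₁)) n₂+j≡x) ,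
      trans (toℕ-↑ʳ n₂ _) (trans (cong (n₂ +_) (toℕ-fromℕ< j+1<n₁)) (trans (+-suc n₂ j) (cong suc n₂+j≡x)))
      where
      j = x ∸ n₂
      n₂+j≡x = m+[n∸m]≡n n₂≤x
      j+1<n₁ = +-cancelˡ-< n₂ (suc j) n₁ (subst (_< n₂ + n₁) (trans (cong suc (sym n₂+j≡x)) (sym (+-suc n₂ j))) x+1<)
      j<n₁ = <-trans (n<1+n j) j+1<n₁
    ArcIndex-𝔊⇐ (vu x<n₁) =
      inject≤ k le ↑ˡ n₁ , n₂ ↑ʳ k ,
      ∈-++⁺ʳ (map _ (pathArcs n₂)) (∈-++⁺ʳ (map _ (pathArcs n₁)) (∈-map⁺ _ (∈-allFin k))) ,
      trans (toℕ-↑ˡ _ n₁) (trans (toℕ-inject≤ k le) (toℕ-fromℕ< x<n₁)) ,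
      trans (toℕ-↑ʳ n₂ k) (cong (n₂ +_) (toℕ-fromℕ< x<n₁))
      where k = fromℕ< x<n₁

  ExtendedArc : ℕ → ℕ → ℕ → ℕ → ℕ → Set
  ExtendedArc p q c x y = 𝔊Arc p q x y ⊎ ChainArc 1 (p + q) c x y

  module _ {p q c : ℕ} (q≤p : q ≤ p) (2≤p : 2 ≤ p) where

    private
      arc-at : ∀ {x y a b} → vertex p q x ≡ a → vertex p q y ≡ b → Arc a b → 𝔊Rel p q x y
      arc-at refl refl ab = ab

      vertex-suc-U : ∀ {j} → suc j < q → vertex p q (suc (p + j)) ≡ U (suc j)
      vertex-suc-U {j} j+1<q = trans (cong (vertex p q) (sym (+-suc p j))) (vertex-U p j+1<q)

      vertex-suc-Z : ∀ k → vertex p q (suc (p + q + k)) ≡ Z (suc k)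
      vertex-suc-Z k = trans (cong (vertex p q) (sym (+-suc (p + q) k))) (vertex-Z p q (suc k))

      p+q≡p+q+0 : p + q ≡ p + q + 0
      p+q≡p+q+0 = sym (+-identityʳ (p + q))

    ExtendedArc⇒𝔊Rel : ∀ {x y} → ExtendedArc p q c x y → 𝔊Rel p q x y
    ExtendedArc⇒𝔊Rel (inj₁ (vv x+1<p)) = arc-at (vertex-V q (<-trans (n<1+n _) x+1<p)) (vertex-V q x+1<p) v→v
    ExtendedArc⇒𝔊Rel (inj₁ (vu x<q)) = arc-at (vertex-V q (<-≤-trans x<q q≤p)) (vertex-U p x<q) v→u
    ExtendedArc⇒𝔊Rel (inj₁ (uu {x} p≤x x+1<)) with position p q x
    ... | inV i<p = contradiction p≤x (<⇒≱ i<p)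
    ... | inU {j} j<q = arc-at (vertex-U p j<q) (vertex-suc-U j+1<q) u→u
      where j+1<q = +-cancelˡ-< p (suc j) q (subst (_< p + q) (sym (+-suc p j)) x+1<)
    ... | inZ k = contradiction x+1< (<⇒≱ (s≤s (≤-trans (m≤m+n (p + q) k) (n≤1+n _))))
    ExtendedArc⇒𝔊Rel (inj₂ root) = arc-at (vertex-V q 2≤p) (trans (cong (vertex p q) p+q≡p+q+0) (vertex-Z p q 0)) v₂→z₁
    ExtendedArc⇒𝔊Rel (inj₂ (next {x = x} p+q≤x _)) with position p q x
    ... | inV i<p = contradiction (≤-trans (m≤m+n p q) p+q≤x) (<⇒≱ i<p)
    ... | inU {j} j<q = contradiction (+-cancelˡ-≤ p q j p+q≤x) (<⇒≱ j<q)
    ... | inZ k = arc-at (vertex-Z p q k) (vertex-suc-Z k) z→z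

    private
      arc-from : ∀ {x y a b} → vertex p q x ≡ a → vertex p q y ≡ b → 𝔊Rel p q x y → Arc a b
      arc-from refl refl r = r

    𝔊Rel⇒ExtendedArc : ∀ {x y} → y < p + q + c → 𝔊Rel p q x y → ExtendedArc p q c x y
    𝔊Rel⇒ExtendedArc {x} {y} y< r with position p q x | position p q y
    ... | inV i<p | inV i′<p with arc-from (vertex-V q i<p) (vertex-V q i′<p) r
    ...   | v→v = inj₁ (vv i′<p)
    𝔊Rel⇒ExtendedArc y< r | inV i<p | inU j<q with arc-from (vertex-V q i<p) (vertex-U p j<q) r
    ...   | v→u = inj₁ (vu j<q)
    𝔊Rel⇒ExtendedArc y< r | inV i<p | inZ k with arc-from (vertex-V q i<p) (vertex-Z p q k) r
    ...   | v₂→z₁ = inj₂ (subst (ChainArc 1 (p + q) c 1) p+q≡p+q+0 (root-of-pos (+-cancelˡ-< (p + q) 0 c y<)))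
    𝔊Rel⇒ExtendedArc y< r | inU {j} j<q | inU j′<q with arc-from (vertex-U p j<q) (vertex-U p j′<q) r
    ...   | u→u = inj₁ (subst (𝔊Arc p q (p + j)) (sym (+-suc p j))
                               (uu (m≤m+n p j) (subst (_< p + q) (+-suc p j) (+-monoʳ-< p j′<q))))
    𝔊Rel⇒ExtendedArc y< r | inZ k | inZ k′ with arc-from (vertex-Z p q k) (vertex-Z p q k′) r
    ...   | z→z = inj₂ (subst (ChainArc 1 (p + q) c (p + q + k)) (sym (+-suc (p + q) k))
                               (next (m≤m+n (p + q) k) (subst (_< p + q + c) (+-suc (p + q) k) y<)))
    𝔊Rel⇒ExtendedArc y< r | inU j<q | inV i<p with arc-from (vertex-U p j<q) (vertex-V q i<p) r
    ...   | ()
    𝔊Rel⇒ExtendedArc y< r | inU j<q | inZ k with arc-from (vertex-U p j<q) (vertex-Z p q k) r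
    ...   | ()
    𝔊Rel⇒ExtendedArc y< r | inZ k | inV i<p with arc-from (vertex-Z p q k) (vertex-V q i<p) r
    ...   | ()
    𝔊Rel⇒ExtendedArc y< r | inZ k | inU j<q with arc-from (vertex-Z p q k) (vertex-U p j<q) r
    ...   | ()

  -- Opaque because unfolding the count during conversion checking is prohibitively expensive.
  opaque
    σ𝔊 : ℕ → ℕ → ℕ → ℕ
    σ𝔊 p q c = #dispositions (𝔊Rel? p q) (p + q + c)

    σ𝔊-def : ∀ p q c → σ𝔊 p q c ≡ #dispositions (𝔊Rel? p q) (p + q + c)
    σ𝔊-def p q c = refl

  size-extend : ∀ G v c → size (extend G v c) ≡ size G + c
  size-extend G v zero    = sym (+-identityʳ (size G))
  size-extend G v (suc c) = trans (size-extend (addLeaf G v) (fromℕ (size G)) c) (sym (+-suc (size G) c))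

  toℕ-v₂ : ∀ n₁ n₂ (h : 2 ≤ n₂) → toℕ (v₂ n₁ n₂ h) ≡ 1
  toℕ-v₂ n₁ n₂ h = trans (toℕ-↑ˡ (fromℕ< h) n₁) (toℕ-fromℕ< h)

  σ-extend-𝔊 : ∀ n₁ n₂ (le : n₁ ≤ n₂) (h : 2 ≤ n₂) c → σ (extend (𝔊 n₁ n₂ le) (v₂ n₁ n₂ h) c) ≡ σ𝔊 n₂ n₁ c
  σ-extend-𝔊 n₁ n₂ le h c =
    trans (σ≡#dispositions G (𝔊Rel? n₂ n₁) R⇔arc)
          (trans (cong (#dispositions (𝔊Rel? n₂ n₁)) (size-extend (𝔊 n₁ n₂ le) v c)) (sym (σ𝔊-def n₂ n₁ c)))
    where
    open Equivalence
    v = v₂ n₁ n₂ h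
    G = extend (𝔊 n₁ n₂ le) v c
    at-v : ∀ {w w′ x y} → w ≡ w′ → ChainArc w (n₂ + n₁) c x y → ChainArc w′ (n₂ + n₁) c x y
    at-v refl ch = ch
    R⇔arc : ∀ i j → 𝔊Rel n₂ n₁ (toℕ i) (toℕ j) ⇔ (i , j) ∈ arcs G
    R⇔arc i j = mk⇔
      (λ r → from (∈-arcs⇔ArcIndex G i j) (from (ArcIndex-extend c (𝔊 n₁ n₂ le) v (toℕ i) (toℕ j))
               (Sum.map (ArcIndex-𝔊⇐ n₁ n₂ le) (at-v (sym (toℕ-v₂ n₁ n₂ h)))
                        (𝔊Rel⇒ExtendedArc le h (subst (toℕ j <_) (size-extend (𝔊 n₁ n₂ le) v c) (toℕ<n j)) r))))
      (λ a → ExtendedArc⇒𝔊Rel le h (Sum.map (ArcIndex-𝔊⇒ n₁ n₂ le) (at-v (toℕ-v₂ n₁ n₂ h))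
               (to (ArcIndex-extend c (𝔊 n₁ n₂ le) v (toℕ i) (toℕ j)) (to (∈-arcs⇔ArcIndex G i j) a))))

module SinkRecurrence where
  open import Data.Nat.Base as ℕ using (ℕ; suc; pred; _+_; _*_; _<_; _≤_; z<s; s≤s; z≤n; s≤s⁻¹)
  open import Data.Nat.Properties
  open import Data.Fin.Base using (Fin; toℕ; fromℕ<)
  open import Data.Fin.Properties using (toℕ<n; toℕ-fromℕ<)
  open import Data.Product.Base using (_×_; _,_)
  open import Data.Sum.Base using (_⊎_; inj₁; inj₂)
  open import Data.Empty using (⊥)
  open import Function.Bundles using (_⇔_; mk⇔; Equivalence)
  open import Relation.Binary.PropositionalEquality
  open import Relation.Nullary.Decidable using (Dec; yes; no; _×-dec_; _→-dec_; _⊎-dec_)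
  open import Relation.Nullary.Negation.Core using (¬_; contradiction)

  open Indicators
  open Dispositions
  open Vertices
  open ExtendedGraph using (σ𝔊; σ𝔊-def)

  -- The last v is a sink unless it has a u below it or it is v₂ carrying the chain.
  LastVSink : ℕ → ℕ → ℕ → Set
  LastVSink p q c = q < p × (p ≡ 2 → c ≡ 0)

  lastVSink? : ∀ p q c → Dec (LastVSink p q c)
  lastVSink? p q c = (q <? p) ×-dec ((p ≟ 2) →-dec (c ≟ 0))

  module LastVertices (p q c m : ℕ) (m+1≡ : suc m ≡ p + q + c) (q≤p : q ≤ p) (c>0⇒2≤p : 0 < c → 2 ≤ p) where

    n : ℕ
    n = suc m

    n≡ : n ≡ p + q + c
    n≡ = m+1≡

    LastV LastU LastZ : ℕ → Set
    LastV x = suc x ≡ p × LastVSink p q c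
    LastU x = suc x ≡ p + q × 0 < q
    LastZ x = suc x ≡ p + q + c × 0 < c

    lastV? : ∀ x → Dec (LastV x)
    lastV? x = (suc x ≟ p) ×-dec lastVSink? p q c
    lastU? : ∀ x → Dec (LastU x)
    lastU? x = (suc x ≟ p + q) ×-dec (0 <? q)
    lastZ? : ∀ x → Dec (LastZ x)
    lastZ? x = (suc x ≟ p + q + c) ×-dec (0 <? c)

    private
      p+q≤n : p + q ≤ n
      p+q≤n = subst (p + q ≤_) (sym n≡) (m≤m+n (p + q) c)

      no-sink : ∀ (w : Fin n) {y} → y < n → 𝔊Rel p q (toℕ w) y → ¬ Sink (𝔊Rel p q) n w
      no-sink w y<n r sink = sink (fromℕ< y<n) (subst (𝔊Rel p q (toℕ w)) (sym (toℕ-fromℕ< y<n)) r)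

      arc-to : ∀ {x y a b} → vertex p q x ≡ a → vertex p q y ≡ b → Arc a b → 𝔊Rel p q x y
      arc-to refl refl ab = ab

      arc-from : ∀ {x y a b} → vertex p q x ≡ a → vertex p q y ≡ b → 𝔊Rel p q x y → Arc a b
      arc-from refl refl r = r

      below : ∀ {x m} → suc x ≡ m → x < m
      below refl = ≤-refl

      last : ∀ {x m} → x < m → ¬ suc x < m → suc x ≡ m
      last x<m ¬x+1<m = ≤-antisym x<m (≮⇒≥ ¬x+1<m)

    OutFree : ℕ → Set
    OutFree x = ∀ y → y < n → ¬ 𝔊Rel p q x y

    Sink⇔OutFree : ∀ (w : Fin n) → Sink (𝔊Rel p q) n w ⇔ OutFree (toℕ w)
    Sink⇔OutFree w = mk⇔ (λ sink y y<n r → no-sink w y<n r sink) (λ free j → free (toℕ j) (toℕ<n j))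

    outFree⇒last : ∀ {x} → x < n → OutFree x → LastV x ⊎ LastU x ⊎ LastZ x
    outFree⇒last {x} x<n free with position p q x
    ... | inV {i} i<p with suc i <? p
    ...   | yes i+1<p = contradiction (arc-to (vertex-V q i<p) (vertex-V q i+1<p) v→v)
                                      (free (suc i) (<-≤-trans i+1<p (≤-trans (m≤m+n p q) p+q≤n)))
    ...   | no ¬i+1<p = inj₁ (i+1≡p , q<p , p≡2⇒c≡0)
      where
      i+1≡p = last i<p ¬i+1<p
      q<p : q < p
      q<p with q <? p
      ... | yes q<p = q<p
      ... | no ¬q<p = contradiction (arc-to (vertex-V q i<p) (vertex-U p i<q) v→u)
                                    (free (p + i) (<-≤-trans (+-monoʳ-< p i<q) p+q≤n))
        where i<q = subst (i <_) (sym (≤-antisym q≤p (≮⇒≥ ¬q<p))) i<p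
      p≡2⇒c≡0 : p ≡ 2 → c ≡ 0
      p≡2⇒c≡0 p≡2 with c ≟ 0
      ... | yes c≡0 = c≡0
      ... | no c≢0 = contradiction (arc-to (vertex-V q i<p) (vertex-Z p q 0) (subst (λ i → Arc (V i) (Z 0)) (sym i≡1) v₂→z₁))
                                   (free (p + q + 0) (subst (p + q + 0 <_) (sym n≡) (+-monoʳ-< (p + q) (n≢0⇒n>0 c≢0))))
        where i≡1 = suc-injective (trans i+1≡p p≡2)
    outFree⇒last x<n free | inU {j} j<q with suc j <? q
    ...   | yes j+1<q = contradiction (arc-to (vertex-U p j<q) (vertex-U p j+1<q) u→u)
                                      (free (p + suc j) (<-≤-trans (+-monoʳ-< p j+1<q) p+q≤n))
    ...   | no ¬j+1<q = inj₂ (inj₁ (trans (sym (+-suc p j)) (cong (p +_) (last j<q ¬j+1<q)) , ≤-<-trans z≤n j<q))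
    outFree⇒last x<n free | inZ k with suc k <? c
    ...   | yes k+1<c = contradiction (arc-to (vertex-Z p q k) (vertex-Z p q (suc k)) z→z)
                                      (free (p + q + suc k) (subst (p + q + suc k <_) (sym n≡) (+-monoʳ-< (p + q) k+1<c)))
    ...   | no ¬k+1<c = inj₂ (inj₂ (trans (sym (+-suc (p + q) k)) (cong (p + q +_) k+1≡c) , subst (0 <_) k+1≡c z<s))
      where
      k<c = +-cancelˡ-< (p + q) k c (subst (p + q + k <_) n≡ x<n)
      k+1≡c = last k<c ¬k+1<c

    lastV⇒outFree : ∀ {x} → LastV x → OutFree x
    lastV⇒outFree {x} (x+1≡p , q<p , p≡2⇒c≡0) y y<n r with position p q y
    ... | inV i<p with arc-from (vertex-V q (below x+1≡p)) (vertex-V q i<p) r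
    ...   | v→v = <-irrefl x+1≡p i<p
    lastV⇒outFree {x} (x+1≡p , q<p , p≡2⇒c≡0) y y<n r | inU j<q with arc-from (vertex-V q (below x+1≡p)) (vertex-U p j<q) r
    ...   | v→u = <⇒≱ j<q (s≤s⁻¹ (subst (q <_) (sym x+1≡p) q<p))
    lastV⇒outFree {x} (x+1≡p , q<p , p≡2⇒c≡0) y y<n r | inZ k with arc-from (vertex-V q (below x+1≡p)) (vertex-Z p q k) r
    ...   | v₂→z₁ = <-irrefl (cong (p + q +_) (sym (p≡2⇒c≡0 (sym x+1≡p)))) (subst (p + q + 0 <_) n≡ y<n)

    lastU⇒outFree : ∀ {x} → LastU x → OutFree x
    lastU⇒outFree {x} (x+1≡p+q , 0<q) y y<n r with position p q x
    ... | inV i<p = <-irrefl x+1≡p+q (<-≤-trans (s≤s i<p) (m<m+n p 0<q))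
    ... | inZ k = <-irrefl (sym x+1≡p+q) (s≤s (m≤m+n (p + q) k))
    ... | inU {j} j<q with position p q y
    ...   | inV i<p with arc-from (vertex-U p j<q) (vertex-V q i<p) r
    ...     | ()
    lastU⇒outFree (x+1≡p+q , 0<q) y y<n r | inU j<q | inZ k with arc-from (vertex-U p j<q) (vertex-Z p q k) r
    ...     | ()
    lastU⇒outFree (x+1≡p+q , 0<q) y y<n r | inU {j} j<q | inU j′<q with arc-from (vertex-U p j<q) (vertex-U p j′<q) r
    ...     | u→u = <-irrefl (+-cancelˡ-≡ p (suc j) q (trans (+-suc p j) x+1≡p+q)) j′<q

    lastZ⇒outFree : ∀ {x} → LastZ x → OutFree x
    lastZ⇒outFree {x} (x+1≡n , 0<c) y y<n r with position p q x
    ... | inV i<p = <-irrefl x+1≡n (<-≤-trans (s≤s i<p) (≤-trans (m<m+n p 0<c) (+-monoˡ-≤ c (m≤m+n p q))))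
    ... | inU j<q = <-irrefl x+1≡n (≤-<-trans (+-monoʳ-< p j<q) (m<m+n (p + q) 0<c))
    ... | inZ k with position p q y
    ...   | inV i<p with arc-from (vertex-Z p q k) (vertex-V q i<p) r
    ...     | ()
    lastZ⇒outFree (x+1≡n , 0<c) y y<n r | inZ k | inU j<q with arc-from (vertex-Z p q k) (vertex-U p j<q) r
    ...     | ()
    lastZ⇒outFree (x+1≡n , 0<c) y y<n r | inZ k | inZ k′ with arc-from (vertex-Z p q k) (vertex-Z p q k′) r
    ...     | z→z = <-irrefl (cong (p + q +_) (+-cancelˡ-≡ (p + q) (suc k) c (trans (+-suc (p + q) k) x+1≡n)))
                             (subst (p + q + suc k <_) n≡ y<n)

    Sink⇔Last : ∀ (w : Fin n) → Sink (𝔊Rel p q) n w ⇔ (LastV (toℕ w) ⊎ LastU (toℕ w) ⊎ LastZ (toℕ w))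
    Sink⇔Last w = mk⇔
      (λ sink → outFree⇒last (toℕ<n w) (Equivalence.to (Sink⇔OutFree w) sink))
      (λ last → Equivalence.from (Sink⇔OutFree w) (case last))
      where
      case : LastV (toℕ w) ⊎ LastU (toℕ w) ⊎ LastZ (toℕ w) → OutFree (toℕ w)
      case (inj₁ l)        = lastV⇒outFree l
      case (inj₂ (inj₁ l)) = lastU⇒outFree l
      case (inj₂ (inj₂ l)) = lastZ⇒outFree l

    χ-sink : ∀ (w : Fin n) → let x = toℕ w in
             χ (sink? (𝔊Rel? p q) n w) ≡ χ (lastV? x) + (χ (lastU? x) + χ (lastZ? x))
    χ-sink w = trans (χ-⊎ (sink? (𝔊Rel? p q) n w) (lastV? x) (lastU? x ⊎-dec lastZ? x) (Sink⇔Last w) V∉U⊎Z)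
                     (cong (χ (lastV? x) +_) (χ-⊎ (lastU? x ⊎-dec lastZ? x) (lastU? x) (lastZ? x) (mk⇔ (λ u → u) (λ u → u)) U∉Z))
      where
      x = toℕ w
      V∉U⊎Z : LastV x → LastU x ⊎ LastZ x → ⊥
      V∉U⊎Z (x+1≡p , _) (inj₁ (x+1≡p+q , 0<q)) = <-irrefl (trans (sym x+1≡p) x+1≡p+q) (m<m+n p 0<q)
      V∉U⊎Z (x+1≡p , _) (inj₂ (x+1≡n , 0<c)) =
        <-irrefl (trans (sym x+1≡p) x+1≡n) (<-≤-trans (m<m+n p 0<c) (+-monoˡ-≤ c (m≤m+n p q)))
      U∉Z : LastU x → LastZ x → ⊥
      U∉Z (x+1≡p+q , _) (x+1≡n , 0<c) = <-irrefl (trans (sym x+1≡p+q) x+1≡n) (m<m+n (p + q) 0<c)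

    H : ℕ → ℕ
    H x = #dispositions (removeVertex? (𝔊Rel? p q) x) m

    #dispositions-by-last-vertices :
      #dispositions (𝔊Rel? p q) n ≡ χ (lastVSink? p q c) * H (pred p) + (χ (0 <? q) * H (pred (p + q)) + χ (0 <? c) * H (pred (p + q + c)))
    #dispositions-by-last-vertices = begin
      #dispositions (𝔊Rel? p q) n
        ≡⟨ #dispositions-sinks (𝔊Rel? p q) m ⟩
      ∑[ w < n ] (χ (sink? (𝔊Rel? p q) n w) * H (toℕ w))
        ≡⟨ sum-cong-≗ {n} (λ w → trans (cong (_* H (toℕ w)) (χ-sink w)) (split (toℕ w))) ⟩
      ∑[ w < n ] (atV w + (atU w + atZ w))
        ≡⟨ trans (∑-distrib-+ {n} atV (λ w → atU w + atZ w)) (cong (sum atV +_) (∑-distrib-+ {n} atU atZ)) ⟩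
      sum atV + (sum atU + sum atZ)
        ≡⟨ cong₂ _+_ (∑-χ-last n p (lastVSink? p q c) H (λ (q<p , _) → ≤-<-trans z≤n q<p , ≤-trans (m≤m+n p q) p+q≤n))
                     (cong₂ _+_ (∑-χ-last n (p + q) (0 <? q) H (λ 0<q → <-≤-trans 0<q (m≤n+m q p) , p+q≤n))
                                (∑-χ-last n (p + q + c) (0 <? c) H (λ 0<c → <-≤-trans 0<c (m≤n+m c (p + q)) , ≤-reflexive (sym n≡)))) ⟩
      χ (lastVSink? p q c) * H (pred p) + (χ (0 <? q) * H (pred (p + q)) + χ (0 <? c) * H (pred (p + q + c))) ∎
      where
      open ≡-Reasoning
      atV atU atZ : Fin n → ℕ
      atV w = χ (lastV? (toℕ w)) * H (toℕ w)
      atU w = χ (lastU? (toℕ w)) * H (toℕ w)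
      atZ w = χ (lastZ? (toℕ w)) * H (toℕ w)
      split : ∀ x → (χ (lastV? x) + (χ (lastU? x) + χ (lastZ? x))) * H x ≡
                    χ (lastV? x) * H x + (χ (lastU? x) * H x + χ (lastZ? x) * H x)
      split x = trans (*-distribʳ-+ (H x) (χ (lastV? x)) (χ (lastU? x) + χ (lastZ? x)))
                      (cong (χ (lastV? x) * H x +_) (*-distribʳ-+ (H x) (χ (lastU? x)) (χ (lastZ? x))))


  private
    Arc-cong : ∀ {a b a′ b′} → a ≡ a′ → b ≡ b′ → Arc a b ⇔ Arc a′ b′
    Arc-cong refl refl = mk⇔ (λ r → r) (λ r → r)

  #dispositions-removeLastV : ∀ p q n → #dispositions (removeVertex? (𝔊Rel? (suc p) q) p) n ≡ #dispositions (𝔊Rel? p q) n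
  #dispositions-removeLastV p q n = #dispositions-cong (removeVertex? (𝔊Rel? (suc p) q) p) (𝔊Rel? p q) n
    (λ x y _ _ → Arc-cong (vertex-punchIn-V p q x) (vertex-punchIn-V p q y))

  #dispositions-removeLastU : ∀ p q n → #dispositions (removeVertex? (𝔊Rel? p (suc q)) (p + q)) n ≡ #dispositions (𝔊Rel? p q) n
  #dispositions-removeLastU p q n = #dispositions-cong (removeVertex? (𝔊Rel? p (suc q)) (p + q)) (𝔊Rel? p q) n
    (λ x y _ _ → Arc-cong (vertex-punchIn-U p q x) (vertex-punchIn-U p q y))

  #dispositions-removeLast : ∀ p q n → #dispositions (removeVertex? (𝔊Rel? p q) n) n ≡ #dispositions (𝔊Rel? p q) n
  #dispositions-removeLast p q n = #dispositions-cong (removeVertex? (𝔊Rel? p q) n) (𝔊Rel? p q) n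
    (λ x y x<n y<n → Arc-cong (cong (vertex p q) (punchInℕ-< x<n)) (cong (vertex p q) (punchInℕ-< y<n)))

  σ𝔊-removeLastV : ∀ p q c {n} → suc n ≡ p + q + c → 0 < p →
                   #dispositions (removeVertex? (𝔊Rel? p q) (pred p)) n ≡ σ𝔊 (pred p) q c
  σ𝔊-removeLastV (suc p) q c {n} n+1≡ _ =
    trans (#dispositions-removeLastV p q n) (trans (cong (#dispositions (𝔊Rel? p q)) (suc-injective n+1≡)) (sym (σ𝔊-def p q c)))

  σ𝔊-removeLastU : ∀ p q c {n} → suc n ≡ p + q + c → 0 < q →
                   #dispositions (removeVertex? (𝔊Rel? p q) (pred (p + q))) n ≡ σ𝔊 p (pred q) c
  σ𝔊-removeLastU p (suc q) c {n} n+1≡ _ = begin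
    #dispositions (removeVertex? (𝔊Rel? p (suc q)) (pred (p + suc q))) n
      ≡⟨ cong (λ x → #dispositions (removeVertex? (𝔊Rel? p (suc q)) x) n) (cong pred (+-suc p q)) ⟩
    #dispositions (removeVertex? (𝔊Rel? p (suc q)) (p + q)) n
      ≡⟨ #dispositions-removeLastU p q n ⟩
    #dispositions (𝔊Rel? p q) n
      ≡⟨ cong (#dispositions (𝔊Rel? p q)) (suc-injective (trans n+1≡ (cong (_+ c) (+-suc p q)))) ⟩
    #dispositions (𝔊Rel? p q) (p + q + c)
      ≡⟨ σ𝔊-def p q c ⟨
    σ𝔊 p q c ∎
    where open ≡-Reasoning

  σ𝔊-removeLastZ : ∀ p q c {n} → suc n ≡ p + q + c → 0 < c →
                   #dispositions (removeVertex? (𝔊Rel? p q) (pred (p + q + c))) n ≡ σ𝔊 p q (pred c)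
  σ𝔊-removeLastZ p q (suc c) {n} n+1≡ _ = begin
    #dispositions (removeVertex? (𝔊Rel? p q) (pred (p + q + suc c))) n
      ≡⟨ cong (λ x → #dispositions (removeVertex? (𝔊Rel? p q) x) n) (cong pred (sym n+1≡)) ⟩
    #dispositions (removeVertex? (𝔊Rel? p q) n) n
      ≡⟨ #dispositions-removeLast p q n ⟩
    #dispositions (𝔊Rel? p q) n
      ≡⟨ cong (#dispositions (𝔊Rel? p q)) (suc-injective (trans n+1≡ (+-suc (p + q) c))) ⟩
    #dispositions (𝔊Rel? p q) (p + q + c)
      ≡⟨ σ𝔊-def p q c ⟨
    σ𝔊 p q c ∎
    where open ≡-Reasoning

  σ𝔊-recurrence : ∀ p q c {m} → suc m ≡ p + q + c → q ≤ p → (0 < c → 2 ≤ p) →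
    σ𝔊 p q c ≡ χ (lastVSink? p q c) * σ𝔊 (pred p) q c + (χ (0 <? q) * σ𝔊 p (pred q) c + χ (0 <? c) * σ𝔊 p q (pred c))
  σ𝔊-recurrence p q c {m} m+1≡ q≤p c>0⇒2≤p = begin
    σ𝔊 p q c
      ≡⟨ trans (σ𝔊-def p q c) (cong (#dispositions (𝔊Rel? p q)) (sym m+1≡)) ⟩
    #dispositions (𝔊Rel? p q) (suc m)
      ≡⟨ #dispositions-by-last-vertices ⟩
    χ (lastVSink? p q c) * H (pred p) + (χ (0 <? q) * H (pred (p + q)) + χ (0 <? c) * H (pred (p + q + c)))
      ≡⟨ cong₂ _+_ (χ*-cong (lastVSink? p q c) (λ (q<p , _) → σ𝔊-removeLastV p q c m+1≡ (≤-<-trans z≤n q<p)))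
                   (cong₂ _+_ (χ*-cong (0 <? q) (σ𝔊-removeLastU p q c m+1≡))
                              (χ*-cong (0 <? c) (σ𝔊-removeLastZ p q c m+1≡))) ⟩
    χ (lastVSink? p q c) * σ𝔊 (pred p) q c + (χ (0 <? q) * σ𝔊 p (pred q) c + χ (0 <? c) * σ𝔊 p q (pred c)) ∎
    where
    open ≡-Reasoning
    open LastVertices p q c m m+1≡ q≤p c>0⇒2≤p

module Binomial where
  open import Data.Nat.Base using (zero; suc; _+_; _*_; _∸_; _≤_; _!)
  open import Data.Nat.Properties
  open import Data.Nat.Combinatorics
    using (_C_; nCk≡n!/k![n-k]!; k![n∸k]!∣n!; nCk+nC[k+1]≡[n+1]C[k+1]; nC1≡n)
  open import Data.Nat.DivMod using (m/n*n≡m)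
  open import Data.Nat.Tactic.RingSolver using (solve-∀)
  open import Data.Fin.Base using (toℕ)
  open import Relation.Binary.PropositionalEquality

  open Indicators using (sum-syntax; sum-cong-≗; ∑-distrib-+; sum-replicate-zero)

  C-pascal : ∀ n k → suc n C suc k ≡ n C k + n C suc k
  C-pascal n k = sym (nCk+nC[k+1]≡[n+1]C[k+1] n k)

  C-factorial : ∀ {n k} → k ≤ n → (n C k) * (k ! * (n ∸ k) !) ≡ n !
  C-factorial {n} {k} k≤n = trans (cong (_* (k ! * (n ∸ k) !)) (nCk≡n!/k![n-k]! k≤n))
                                  (m/n*n≡m {{k !* (n ∸ k) !≢0}} (k![n∸k]!∣n! k≤n))

  C-absorption : ∀ n k → suc k * (suc n C suc k) ≡ suc n * (n C k)
  C-absorption n       zero    = trans (*-identityˡ (suc n C 1)) (trans (nC1≡n (suc n)) (sym (*-identityʳ (suc n))))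
  C-absorption zero    (suc k) = *-zeroʳ (suc (suc k))
  C-absorption (suc n) (suc k) = begin
    suc (suc k) * (suc (suc n) C suc (suc k))
      ≡⟨ cong (suc (suc k) *_) (C-pascal (suc n) (suc k)) ⟩
    suc (suc k) * (x + y)
      ≡⟨ shape (suc k) x y ⟩
    (suc k * x + x) + suc (suc k) * y
      ≡⟨ cong₂ (λ a b → (a + x) + b) (C-absorption n k) (C-absorption n (suc k)) ⟩
    (suc n * (n C k) + x) + suc n * (n C suc k)
      ≡⟨ cong (λ x → (suc n * (n C k) + x) + suc n * (n C suc k)) (C-pascal n k) ⟩
    (suc n * (n C k) + ((n C k) + (n C suc k))) + suc n * (n C suc k)
      ≡⟨ shape′ (suc n) (n C k) (n C suc k) ⟩
    suc (suc n) * ((n C k) + (n C suc k))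
      ≡⟨ cong (suc (suc n) *_) (C-pascal n k) ⟨
    suc (suc n) * (suc n C suc k) ∎
    where
    open ≡-Reasoning
    x = suc n C suc k
    y = suc n C suc (suc k)
    shape : ∀ k x y → suc k * (x + y) ≡ (k * x + x) + suc k * y
    shape = solve-∀
    shape′ : ∀ n x y → (n * x + (x + y)) + n * y ≡ suc n * (x + y)
    shape′ = solve-∀

  C-suc-index : ∀ n k → (n C suc k) * suc k + (n C k) * k ≡ (n C k) * n
  C-suc-index zero    zero    = refl
  C-suc-index zero    (suc k) = refl
  C-suc-index (suc n) zero    = trans (cong (_+ 0) (trans (*-identityʳ _) (nC1≡n (suc n)))) (trans (+-identityʳ _) (sym (*-identityˡ _)))
  C-suc-index (suc n) (suc k) = begin
    (suc n C suc (suc k)) * suc (suc k) + (suc n C suc k) * suc k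
      ≡⟨ cong₂ _+_ (trans (*-comm (suc n C suc (suc k)) (suc (suc k))) (C-absorption n (suc k)))
                   (trans (*-comm (suc n C suc k) (suc k)) (C-absorption n k)) ⟩
    suc n * (n C suc k) + suc n * (n C k)
      ≡⟨ shape (suc n) (n C k) (n C suc k) ⟩
    ((n C k) + (n C suc k)) * suc n
      ≡⟨ cong (_* suc n) (C-pascal n k) ⟨
    (suc n C suc k) * suc n ∎
    where
    open ≡-Reasoning
    shape : ∀ n x y → n * y + n * x ≡ (x + y) * n
    shape = solve-∀

  vandermonde : ∀ m k r → ∑[ j < suc r ] ((m C toℕ j) * (k C (r ∸ toℕ j))) ≡ (m + k) C r
  vandermonde zero    k r       = trans (cong₂ _+_ (+-identityʳ (k C r)) (trans (sum-cong-≗ {r} (λ _ → refl)) (sum-replicate-zero r)))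
                                        (+-identityʳ (k C r))
  vandermonde (suc m) k zero    = refl
  vandermonde (suc m) k (suc r) = begin
    1 * (k C suc r) + ∑[ j < suc r ] ((suc m C suc (toℕ j)) * (k C (r ∸ toℕ j)))
      ≡⟨ cong (1 * (k C suc r) +_) (trans (sum-cong-≗ {suc r} (λ j → trans (cong (_* (k C (r ∸ toℕ j))) (C-pascal m (toℕ j)))
                                                                         (*-distribʳ-+ (k C (r ∸ toℕ j)) (m C toℕ j) _)))
                                           (∑-distrib-+ {suc r} (λ j → (m C toℕ j) * (k C (r ∸ toℕ j)))
                                                                (λ j → (m C suc (toℕ j)) * (k C (r ∸ toℕ j))))) ⟩
    1 * (k C suc r) + (∑[ j < suc r ] ((m C toℕ j) * (k C (r ∸ toℕ j))) + ∑[ j < suc r ] ((m C suc (toℕ j)) * (k C (r ∸ toℕ j))))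
      ≡⟨ cong (λ s → 1 * (k C suc r) + (s + ∑[ j < suc r ] ((m C suc (toℕ j)) * (k C (r ∸ toℕ j))))) (vandermonde m k r) ⟩
    1 * (k C suc r) + ((m + k) C r + ∑[ j < suc r ] ((m C suc (toℕ j)) * (k C (r ∸ toℕ j))))
      ≡⟨ shape (1 * (k C suc r)) ((m + k) C r) _ ⟩
    (m + k) C r + (1 * (k C suc r) + ∑[ j < suc r ] ((m C suc (toℕ j)) * (k C (r ∸ toℕ j))))
      ≡⟨ cong ((m + k) C r +_) (vandermonde m k (suc r)) ⟩
    (m + k) C r + (m + k) C suc r
      ≡⟨ C-pascal (m + k) r ⟨
    (suc m + k) C suc r ∎
    where
    open ≡-Reasoning
    shape : ∀ a b c → a + (b + c) ≡ b + (a + c)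
    shape = solve-∀

  C-ratio : ∀ p q → ((p + suc q) C suc q) * suc q ≡ ((p + suc q) C q) * suc p
  C-ratio p q = +-cancelʳ-≡ (((p + suc q) C q) * q) _ _ (begin
    ((p + suc q) C suc q) * suc q + ((p + suc q) C q) * q ≡⟨ C-suc-index (p + suc q) q ⟩
    ((p + suc q) C q) * (p + suc q)                        ≡⟨ cong (((p + suc q) C q) *_) (+-suc p q) ⟩
    ((p + suc q) C q) * (suc p + q)                        ≡⟨ *-distribˡ-+ ((p + suc q) C q) (suc p) q ⟩
    ((p + suc q) C q) * suc p + ((p + suc q) C q) * q      ∎)
    where open ≡-Reasoning

module ClosedForm where
  open import Data.Nat.Base as ℕ using (ℕ; zero; suc; pred; _+_; _*_; _<_; _≤_; s≤s; z≤n; s≤s⁻¹)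
  open import Data.Nat.Properties
  open import Data.Nat.Combinatorics using (_C_; nCn≡1)
  open import Data.Nat.Tactic.RingSolver using (solve-∀)
  open import Relation.Binary.PropositionalEquality
  open import Function.Base using (const)

  open import Data.Product.Base using (_,_; proj₁)

  open Indicators using (χ; χ-cong; χ*-cong)
  open Binomial using (C-pascal)
  open SinkRecurrence using (lastVSink?; LastVSink; σ𝔊-recurrence)
  open ExtendedGraph using (σ𝔊; σ𝔊-def)

  shuffles : ℕ → ℕ → ℕ
  shuffles m c = (m + c) C c

  shuffles-zero : ∀ c → shuffles 0 c ≡ 1
  shuffles-zero = nCn≡1

  shuffles-pascal : ∀ m c → shuffles (suc m) c ≡ shuffles m c + χ (0 <? c) * shuffles (suc m) (pred c)
  shuffles-pascal m zero    = refl
  shuffles-pascal m (suc c) = begin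
    suc (m + suc c) C suc c
      ≡⟨ C-pascal (m + suc c) c ⟩
    (m + suc c) C c + (m + suc c) C suc c
      ≡⟨ +-comm ((m + suc c) C c) _ ⟩
    shuffles m (suc c) + (m + suc c) C c
      ≡⟨ cong (λ n → shuffles m (suc c) + n C c) (+-suc m c) ⟩
    shuffles m (suc c) + shuffles (suc m) c
      ≡⟨ cong (shuffles m (suc c) +_) (*-identityˡ (shuffles (suc m) c)) ⟨
    shuffles m (suc c) + 1 * shuffles (suc m) c ∎
    where open ≡-Reasoning

  -- Lattice paths with unit steps ending at (p , q) and staying in the region q ≤ p + 2,
  -- where start q counts the paths ending at (0 , q).
  boundedPaths : (ℕ → ℕ) → ℕ → ℕ → ℕ
  boundedPaths start zero    q       = start q
  boundedPaths start (suc p) zero    = boundedPaths start p zero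
  boundedPaths start (suc p) (suc q) =
    χ (suc q <? 3 + p) * boundedPaths start p (suc q) + boundedPaths start (suc p) q

  boundedPaths-rec : ∀ start p q →
    boundedPaths start (suc p) q ≡ χ (q <? 3 + p) * boundedPaths start p q + χ (0 <? q) * boundedPaths start (suc p) (pred q)
  boundedPaths-rec start p zero    = sym (trans (+-identityʳ _) (*-identityˡ _))
  boundedPaths-rec start p (suc q) = cong (χ (suc q <? 3 + p) * boundedPaths start p (suc q) +_)
                                          (sym (*-identityˡ _))

  startB : ℕ → ℕ
  startB zero    = 0
  startB (suc _) = 1

  A B : ℕ → ℕ → ℕ
  A = boundedPaths (const 1)
  B = boundedPaths startB

  B-zero : ∀ p → B p 0 ≡ 0
  B-zero zero    = refl
  B-zero (suc p) = B-zero p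

  σ𝔊-formula : ℕ → ℕ → ℕ → ℕ
  σ𝔊-formula p q c = A p q * shuffles (p + q) c + B p q * shuffles (pred (p + q)) c

  private
    σ𝔊-formula-pred : ∀ p q c → 0 < q →
               σ𝔊-formula (suc p) (pred q) c ≡ A (suc p) (pred q) * shuffles (p + q) c + B (suc p) (pred q) * shuffles (pred (p + q)) c
    σ𝔊-formula-pred p (suc q) c _ rewrite +-suc p q = refl

    B-pascal : ∀ p q c → B (suc p) q * shuffles (p + q) c ≡
               B (suc p) q * (shuffles (pred (p + q)) c + χ (0 <? c) * shuffles (p + q) (pred c))
    B-pascal zero    zero    c = refl
    B-pascal zero    (suc q) c = cong (B 1 (suc q) *_) (shuffles-pascal q c)
    B-pascal (suc p) q       c = cong (B (2 + p) q *_) (shuffles-pascal (p + q) c)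

    combine : ∀ k e d a b a⁻ b⁻ x y z u →
      k * (a * x + b * y) + (e * (a⁻ * x + b⁻ * y) + d * ((k * a + e * a⁻) * z + (k * b + e * b⁻) * u)) ≡
      (k * a + e * a⁻) * (x + d * z) + (k * b + e * b⁻) * (y + d * u)
    combine = solve-∀

  σ𝔊-formula-recurrence : ∀ p q c →
    χ (q <? 3 + p) * σ𝔊-formula p q c + (χ (0 <? q) * σ𝔊-formula (suc p) (pred q) c + χ (0 <? c) * σ𝔊-formula (suc p) q (pred c)) ≡ σ𝔊-formula (suc p) q c
  σ𝔊-formula-recurrence p q c = begin
    k * σ𝔊-formula p q c + (e * σ𝔊-formula (suc p) (pred q) c + d * σ𝔊-formula (suc p) q (pred c))
      ≡⟨ cong (λ t → k * σ𝔊-formula p q c + (t + d * σ𝔊-formula (suc p) q (pred c))) (χ*-cong (0 <? q) (σ𝔊-formula-pred p q c)) ⟩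
    k * (a * x + b * y) + (e * (a⁻ * x + b⁻ * y) + d * (A (suc p) q * z + B (suc p) q * u))
      ≡⟨ cong (λ t → k * (a * x + b * y) + (e * (a⁻ * x + b⁻ * y) + d * t))
              (cong₂ (λ s t → s * z + t * u) (boundedPaths-rec _ p q) (boundedPaths-rec _ p q)) ⟩
    k * (a * x + b * y) + (e * (a⁻ * x + b⁻ * y) + d * ((k * a + e * a⁻) * z + (k * b + e * b⁻) * u))
      ≡⟨ combine k e d a b a⁻ b⁻ x y z u ⟩
    (k * a + e * a⁻) * (x + d * z) + (k * b + e * b⁻) * (y + d * u)
      ≡⟨ cong₂ _+_ (cong₂ _*_ (sym (boundedPaths-rec _ p q)) (sym (shuffles-pascal (p + q) c)))
                   (trans (cong (_* (y + d * u)) (sym (boundedPaths-rec _ p q))) (sym (B-pascal p q c))) ⟩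
    σ𝔊-formula (suc p) q c ∎
    where
    open ≡-Reasoning
    k = χ (q <? 3 + p)
    e = χ (0 <? q)
    d = χ (0 <? c)
    a = A p q
    b = B p q
    a⁻ = A (suc p) (pred q)
    b⁻ = B (suc p) (pred q)
    x = shuffles (p + q) c
    y = shuffles (pred (p + q)) c
    z = shuffles (suc (p + q)) (pred c)
    u = shuffles (p + q) (pred c)

  σ𝔊-formula-start : ∀ q c → σ𝔊-formula 0 (suc q) c ≡ shuffles (suc q) c + shuffles q c
  σ𝔊-formula-start q c = cong₂ _+_ (+-identityʳ (shuffles (suc q) c)) (+-identityʳ (shuffles q c))

  σ𝔊-formula-start₀ : ∀ c → σ𝔊-formula 0 0 c ≡ 1
  σ𝔊-formula-start₀ c = trans (+-identityʳ (shuffles 0 c + 0)) (trans (+-identityʳ (shuffles 0 c)) (shuffles-zero c))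

  private
    shape₁ : ∀ b x → 0 * 1 + (1 * b + 1 * (x + b)) ≡ (b + 1 * x) + b
    shape₁ = solve-∀
    shape₂ : ∀ a b d e → 0 * 1 + (1 * (a + b) + 1 * (d + e)) ≡ (a + 1 * d) + (b + 1 * e)
    shape₂ = solve-∀

  σ𝔊-formula-start-recurrence : ∀ q c → q ≤ 2 →
    χ (lastVSink? 2 q c) * 1 + (χ (0 <? q) * σ𝔊-formula 0 (pred q) c + χ (0 <? c) * σ𝔊-formula 0 q (pred c)) ≡ σ𝔊-formula 0 q c
  σ𝔊-formula-start-recurrence 0 0 _ = refl
  σ𝔊-formula-start-recurrence 1 0 _ = refl
  σ𝔊-formula-start-recurrence 2 0 _ = refl
  σ𝔊-formula-start-recurrence 0 (suc c) _ = trans (+-identityʳ (σ𝔊-formula 0 0 c)) (trans (σ𝔊-formula-start₀ c) (sym (σ𝔊-formula-start₀ (suc c))))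
  σ𝔊-formula-start-recurrence 1 (suc c) _ = begin
    0 * 1 + (1 * σ𝔊-formula 0 0 (suc c) + 1 * σ𝔊-formula 0 1 c)
      ≡⟨ cong₂ (λ a b → 0 * 1 + (1 * a + 1 * b)) (trans (σ𝔊-formula-start₀ (suc c)) (sym (shuffles-zero (suc c))))
                                                 (trans (σ𝔊-formula-start 0 c) (cong (shuffles 1 c +_) (trans (shuffles-zero c) (sym (shuffles-zero (suc c)))))) ⟩
    0 * 1 + (1 * shuffles 0 (suc c) + 1 * (shuffles 1 c + shuffles 0 (suc c)))
      ≡⟨ shape₁ (shuffles 0 (suc c)) (shuffles 1 c) ⟩
    (shuffles 0 (suc c) + 1 * shuffles 1 c) + shuffles 0 (suc c)
      ≡⟨ cong (_+ shuffles 0 (suc c)) (shuffles-pascal 0 (suc c)) ⟨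
    shuffles 1 (suc c) + shuffles 0 (suc c)
      ≡⟨ σ𝔊-formula-start 0 (suc c) ⟨
    σ𝔊-formula 0 1 (suc c) ∎
    where open ≡-Reasoning
  σ𝔊-formula-start-recurrence 2 (suc c) _ = begin
    0 * 1 + (1 * σ𝔊-formula 0 1 (suc c) + 1 * σ𝔊-formula 0 2 c)
      ≡⟨ cong₂ (λ a b → 0 * 1 + (1 * a + 1 * b)) (σ𝔊-formula-start 0 (suc c)) (σ𝔊-formula-start 1 c) ⟩
    0 * 1 + (1 * (shuffles 1 (suc c) + shuffles 0 (suc c)) + 1 * (shuffles 2 c + shuffles 1 c))
      ≡⟨ shape₂ (shuffles 1 (suc c)) (shuffles 0 (suc c)) (shuffles 2 c) (shuffles 1 c) ⟩
    (shuffles 1 (suc c) + 1 * shuffles 2 c) + (shuffles 0 (suc c) + 1 * shuffles 1 c)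
      ≡⟨ cong₂ _+_ (shuffles-pascal 1 (suc c)) (shuffles-pascal 0 (suc c)) ⟨
    shuffles 2 (suc c) + shuffles 1 (suc c)
      ≡⟨ σ𝔊-formula-start 1 (suc c) ⟨
    σ𝔊-formula 0 2 (suc c) ∎
    where open ≡-Reasoning
  σ𝔊-formula-start-recurrence (suc (suc (suc q))) c (s≤s (s≤s ()))

  σ𝔊-one : ∀ q c → LastVSink 2 q c → σ𝔊 1 q c ≡ 1
  σ𝔊-one q c (q<2 , 2≡2⇒c≡0) with 2≡2⇒c≡0 refl | q<2
  ... | refl | s≤s z≤n       = σ𝔊-def 1 0 0
  ... | refl | s≤s (s≤s z≤n) = σ𝔊-def 1 1 0

  σ𝔊-start : ∀ q c → q ≤ 2 → σ𝔊 2 q c ≡ σ𝔊-formula 0 q c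
  σ𝔊-start q c q≤2 = begin
    σ𝔊 2 q c
      ≡⟨ σ𝔊-recurrence 2 q c refl q≤2 (λ _ → ≤-refl) ⟩
    χ (lastVSink? 2 q c) * σ𝔊 1 q c + (χ (0 <? q) * σ𝔊 2 (pred q) c + χ (0 <? c) * σ𝔊 2 q (pred c))
      ≡⟨ cong₂ _+_ (χ*-cong (lastVSink? 2 q c) (σ𝔊-one q c)) (cong₂ _+_ (lower-q q c q≤2) (lower-c q c q≤2)) ⟩
    χ (lastVSink? 2 q c) * 1 + (χ (0 <? q) * σ𝔊-formula 0 (pred q) c + χ (0 <? c) * σ𝔊-formula 0 q (pred c))
      ≡⟨ σ𝔊-formula-start-recurrence q c q≤2 ⟩
    σ𝔊-formula 0 q c ∎
    where
    open ≡-Reasoning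
    lower-q : ∀ q c → q ≤ 2 → χ (0 <? q) * σ𝔊 2 (pred q) c ≡ χ (0 <? q) * σ𝔊-formula 0 (pred q) c
    lower-q zero    c _   = refl
    lower-q (suc q) c q≤2 = χ*-cong (0 <? suc q) λ _ → σ𝔊-start q c (≤-trans (n≤1+n q) q≤2)
    lower-c : ∀ q c → q ≤ 2 → χ (0 <? c) * σ𝔊 2 q (pred c) ≡ χ (0 <? c) * σ𝔊-formula 0 q (pred c)
    lower-c q zero    _   = refl
    lower-c q (suc c) q≤2 = χ*-cong (0 <? suc c) λ _ → σ𝔊-start q c q≤2

  σ𝔊-closedForm : ∀ p q c → q ≤ 2 + p → σ𝔊 (2 + p) q c ≡ σ𝔊-formula p q c
  σ𝔊-closedForm zero    q c q≤2 = σ𝔊-start q c q≤2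
  σ𝔊-closedForm (suc p) q c q≤ = begin
    σ𝔊 (3 + p) q c
      ≡⟨ σ𝔊-recurrence (3 + p) q c refl q≤ (λ _ → s≤s (s≤s z≤n)) ⟩
    χ (lastVSink? (3 + p) q c) * σ𝔊 (2 + p) q c + (χ (0 <? q) * σ𝔊 (3 + p) (pred q) c + χ (0 <? c) * σ𝔊 (3 + p) q (pred c))
      ≡⟨ cong₂ _+_ (trans (cong (_* σ𝔊 (2 + p) q c) (χ-cong proj₁ (λ q< → q< , λ ()) (lastVSink? (3 + p) q c) (q <? 3 + p)))
                          (χ*-cong (q <? 3 + p) (λ q< → σ𝔊-closedForm p q c (s≤s⁻¹ q<))))
                   (cong₂ _+_ (lower-q q c q≤) (lower-c q c q≤)) ⟩
    χ (q <? 3 + p) * σ𝔊-formula p q c + (χ (0 <? q) * σ𝔊-formula (suc p) (pred q) c + χ (0 <? c) * σ𝔊-formula (suc p) q (pred c))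
      ≡⟨ σ𝔊-formula-recurrence p q c ⟩
    σ𝔊-formula (suc p) q c ∎
    where
    open ≡-Reasoning
    lower-q : ∀ q c → q ≤ 3 + p → χ (0 <? q) * σ𝔊 (3 + p) (pred q) c ≡ χ (0 <? q) * σ𝔊-formula (suc p) (pred q) c
    lower-q zero    c _  = refl
    lower-q (suc q) c q≤ = χ*-cong (0 <? suc q) λ _ → σ𝔊-closedForm (suc p) q c (≤-trans (n≤1+n q) q≤)
    lower-c : ∀ q c → q ≤ 3 + p → χ (0 <? c) * σ𝔊 (3 + p) q (pred c) ≡ χ (0 <? c) * σ𝔊-formula (suc p) q (pred c)
    lower-c q zero    _  = refl
    lower-c q (suc c) q≤ = χ*-cong (0 <? suc c) λ _ → σ𝔊-closedForm (suc p) q c q≤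

module Rationals where
  open import Data.Nat.Base as ℕ using (ℕ; zero; suc; _!)
  import Data.Nat.Properties as ℕ
  open import Data.Nat.Combinatorics using (_C_)
  open import Data.Nat.Coprimality using (1-coprimeTo) renaming (sym to coprime-sym)
  open import Data.Integer.Base as ℤ using (+_)
  import Data.Integer.Properties as ℤ
  open import Data.Rational.Base using (mkℚ; 1ℚ; _+_; _*_; 1/_; _/_)
  open import Data.Rational.Properties
    using (normalize-coprime; /-cong; +-identityˡ; +-assoc; *-zeroˡ; *-identityʳ; *-assoc; *-inverseʳ; *-inverseˡ)
  open import Data.Rational.Solver using (module +-*-Solver)
  open import Relation.Binary.PropositionalEquality

  open import Defs using (ℕ→ℚ; expPS)
  open Binomial using (C-factorial)

  open +-*-Solver

  private
    ℕ→ℚ≡mkℚ : ∀ n → ℕ→ℚ n ≡ mkℚ (+ n) 0 (coprime-sym (1-coprimeTo n))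
    ℕ→ℚ≡mkℚ n = normalize-coprime (coprime-sym (1-coprimeTo n))

  ℕ→ℚ-suc : ∀ n → ℕ→ℚ (suc n) ≡ 1ℚ + ℕ→ℚ n
  ℕ→ℚ-suc n = sym (trans (cong (_+_ 1ℚ) (ℕ→ℚ≡mkℚ n))
                         (/-cong {+ 1 ℤ.* + 1 ℤ.+ + n ℤ.* + 1} {1} {+ suc n} {1}
                                 (cong (ℤ._+_ (+ 1)) (ℤ.*-identityʳ (+ n))) refl))

  ℕ→ℚ-+ : ∀ m n → ℕ→ℚ (m ℕ.+ n) ≡ ℕ→ℚ m + ℕ→ℚ n
  ℕ→ℚ-+ zero    n = sym (+-identityˡ (ℕ→ℚ n))
  ℕ→ℚ-+ (suc m) n = begin
    ℕ→ℚ (suc (m ℕ.+ n))     ≡⟨ ℕ→ℚ-suc (m ℕ.+ n) ⟩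
    1ℚ + ℕ→ℚ (m ℕ.+ n)      ≡⟨ cong (_+_ 1ℚ) (ℕ→ℚ-+ m n) ⟩
    1ℚ + (ℕ→ℚ m + ℕ→ℚ n)   ≡⟨ +-assoc 1ℚ (ℕ→ℚ m) (ℕ→ℚ n) ⟨
    (1ℚ + ℕ→ℚ m) + ℕ→ℚ n   ≡⟨ cong (_+ ℕ→ℚ n) (ℕ→ℚ-suc m) ⟨
    ℕ→ℚ (suc m) + ℕ→ℚ n    ∎
    where open ≡-Reasoning

  ℕ→ℚ-* : ∀ m n → ℕ→ℚ (m ℕ.* n) ≡ ℕ→ℚ m * ℕ→ℚ n
  ℕ→ℚ-* zero    n = sym (*-zeroˡ (ℕ→ℚ n))
  ℕ→ℚ-* (suc m) n = begin
    ℕ→ℚ (n ℕ.+ m ℕ.* n)         ≡⟨ ℕ→ℚ-+ n (m ℕ.* n) ⟩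
    ℕ→ℚ n + ℕ→ℚ (m ℕ.* n)       ≡⟨ cong (_+_ (ℕ→ℚ n)) (ℕ→ℚ-* m n) ⟩
    ℕ→ℚ n + ℕ→ℚ m * ℕ→ℚ n      ≡⟨ solve 2 (λ x y → x :+ y :* x := (con 1ℚ :+ y) :* x) refl (ℕ→ℚ n) (ℕ→ℚ m) ⟩
    (1ℚ + ℕ→ℚ m) * ℕ→ℚ n       ≡⟨ cong (_* ℕ→ℚ n) (ℕ→ℚ-suc m) ⟨
    ℕ→ℚ (suc m) * ℕ→ℚ n        ∎
    where open ≡-Reasoning

  *-cancelʳ-ℕ→ℚ : ∀ n .{{_ : ℕ.NonZero n}} {x y} → x * ℕ→ℚ n ≡ y * ℕ→ℚ n → x ≡ y
  *-cancelʳ-ℕ→ℚ n@(suc _) {x} {y} eq = begin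
    x               ≡⟨ *-identityʳ x ⟨
    x * 1ℚ          ≡⟨ cong (x *_) (*-inverseʳ c) ⟨
    x * (c * 1/ c)  ≡⟨ *-assoc x c (1/ c) ⟨
    (x * c) * 1/ c  ≡⟨ cong (λ z → z * 1/ c) (trans (cong (x *_) (sym (ℕ→ℚ≡mkℚ n))) (trans eq (cong (y *_) (ℕ→ℚ≡mkℚ n)))) ⟩
    (y * c) * 1/ c  ≡⟨ *-assoc y c (1/ c) ⟩
    y * (c * 1/ c)  ≡⟨ cong (y *_) (*-inverseʳ c) ⟩
    y * 1ℚ          ≡⟨ *-identityʳ y ⟩
    y               ∎
    where
    open ≡-Reasoning
    c = mkℚ (+ n) 0 (coprime-sym (1-coprimeTo n))

  /≡ℕ→ℚ*1/ : ∀ x d .{{_ : ℕ.NonZero d}} → (+ x) / d ≡ ℕ→ℚ x * ((+ 1) / d)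
  /≡ℕ→ℚ*1/ x d@(suc _) = sym (begin
    ℕ→ℚ x * ((+ 1) / d)
      ≡⟨ cong₂ _*_ (ℕ→ℚ≡mkℚ x) (normalize-coprime (1-coprimeTo d)) ⟩
    mkℚ (+ x) 0 (coprime-sym (1-coprimeTo x)) * mkℚ (+ 1) (ℕ.pred d) (1-coprimeTo d)
      ≡⟨ /-cong {+ x ℤ.* + 1} {1 ℕ.* d} {+ x} {d} (ℤ.*-identityʳ (+ x)) (ℕ.*-identityˡ d) ⟩
    (+ x) / d ∎)
    where open ≡-Reasoning

  1/-*-ℕ→ℚ : ∀ d .{{_ : ℕ.NonZero d}} → ((+ 1) / d) * ℕ→ℚ d ≡ 1ℚ
  1/-*-ℕ→ℚ d@(suc _) = trans (cong₂ _*_ (normalize-coprime (1-coprimeTo d)) (ℕ→ℚ≡mkℚ d)) (*-inverseˡ c)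
    where c = mkℚ (+ d) 0 (coprime-sym (1-coprimeTo d))

  expPS-*-! : ∀ k → expPS k * ℕ→ℚ (k !) ≡ 1ℚ
  expPS-*-! k = 1/-*-ℕ→ℚ (k !) {{k ℕ.!≢0}}

  expPS-suc : ∀ k → expPS (suc k) * ℕ→ℚ (suc k) ≡ expPS k
  expPS-suc k = *-cancelʳ-ℕ→ℚ (k !) {{k ℕ.!≢0}} (begin
    expPS (suc k) * ℕ→ℚ (suc k) * ℕ→ℚ (k !)   ≡⟨ *-assoc (expPS (suc k)) (ℕ→ℚ (suc k)) (ℕ→ℚ (k !)) ⟩
    expPS (suc k) * (ℕ→ℚ (suc k) * ℕ→ℚ (k !)) ≡⟨ cong (expPS (suc k) *_) (ℕ→ℚ-* (suc k) (k !)) ⟨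
    expPS (suc k) * ℕ→ℚ (suc k !)             ≡⟨ expPS-*-! (suc k) ⟩
    1ℚ                                         ≡⟨ expPS-*-! k ⟨
    expPS k * ℕ→ℚ (k !)                        ∎)
    where open ≡-Reasoning

  expPS-* : ∀ a b → expPS a * expPS b ≡ ℕ→ℚ ((a ℕ.+ b) C b) * expPS (a ℕ.+ b)
  expPS-* a b = *-cancelʳ-ℕ→ℚ (b ! ℕ.* a !) {{b ℕ.!* a !≢0}} (begin
    expPS a * expPS b * ℕ→ℚ (b ! ℕ.* a !)
      ≡⟨ cong (expPS a * expPS b *_) (ℕ→ℚ-* (b !) (a !)) ⟩
    expPS a * expPS b * (ℕ→ℚ (b !) * ℕ→ℚ (a !))
      ≡⟨ solve 4 (λ x y u v → x :* y :* (u :* v) := (x :* v) :* (y :* u)) refl (expPS a) (expPS b) (ℕ→ℚ (b !)) (ℕ→ℚ (a !)) ⟩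
    (expPS a * ℕ→ℚ (a !)) * (expPS b * ℕ→ℚ (b !))
      ≡⟨ cong₂ _*_ (expPS-*-! a) (expPS-*-! b) ⟩
    1ℚ
      ≡⟨ expPS-*-! n ⟨
    expPS n * ℕ→ℚ (n !)
      ≡⟨ cong (λ m → expPS n * ℕ→ℚ m) (C-factorial (ℕ.m≤n+m b a)) ⟨
    expPS n * ℕ→ℚ ((n C b) ℕ.* (b ! ℕ.* (n ℕ.∸ b) !))
      ≡⟨ cong (λ m → expPS n * ℕ→ℚ ((n C b) ℕ.* (b ! ℕ.* m !))) (ℕ.m+n∸n≡m a b) ⟩
    expPS n * ℕ→ℚ ((n C b) ℕ.* (b ! ℕ.* a !))
      ≡⟨ cong (expPS n *_) (ℕ→ℚ-* (n C b) (b ! ℕ.* a !)) ⟩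
    expPS n * (ℕ→ℚ (n C b) * ℕ→ℚ (b ! ℕ.* a !))
      ≡⟨ solve 3 (λ x y z → x :* (y :* z) := y :* x :* z) refl (expPS n) (ℕ→ℚ (n C b)) (ℕ→ℚ (b ! ℕ.* a !)) ⟩
    ℕ→ℚ (n C b) * expPS n * ℕ→ℚ (b ! ℕ.* a !) ∎)
    where
    open ≡-Reasoning
    n = a ℕ.+ b

module Series where
  open import Algebra.Bundles using (Ring)
  open import Data.Nat.Base as ℕ using (ℕ; zero; suc; _∸_; _<_; _≤_; s≤s)
  import Data.Nat.Properties as ℕ
  open import Data.Nat.Combinatorics using (_C_)
  open import Data.Nat.Induction using (<-rec)
  open import Data.Fin.Base as Fin using (Fin; toℕ)
  open import Data.Fin.Properties using (toℕ<n)
  open import Data.Rational.Base using (ℚ; 1ℚ; _+_; _*_; _-_)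
  import Data.Rational.Properties as ℚ
  open import Data.Rational.Solver using (module +-*-Solver)
  open import Relation.Binary.PropositionalEquality

  open import Algebra.Properties.Semiring.Sum (Ring.semiring ℚ.+-*-ring)
    using (sum; sum-syntax; sum-cong-≗; *-distribʳ-sum)

  open import Defs using (PS; ℕ→ℚ; expPS; convo)
  open Rationals
  module ℕC = Binomial
  module ℕΣ = Indicators
  open ClosedForm using (shuffles)

  open +-*-Solver

  convo-sum : ∀ (A B : PS) k → convo A B k ≡ ∑[ j < suc k ] (A (k ∸ toℕ j) * B (toℕ j))
  convo-sum A B zero    = sym (ℚ.+-identityʳ (A 0 * B 0))
  convo-sum A B (suc k) = trans (cong (_+ A (suc k) * B 0) (convo-sum A (λ j → B (suc j)) k))
                                (ℚ.+-comm _ (A (suc k) * B 0))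

  convo-linear : ∀ a b (f g B : PS) k →
                 convo (λ j → a * f j + b * g j) B k ≡ a * convo f B k + b * convo g B k
  convo-linear a b f g B zero    =
    solve 5 (λ a b f g B → (a :* f :+ b :* g) :* B := a :* (f :* B) :+ b :* (g :* B)) refl a b (f 0) (g 0) (B 0)
  convo-linear a b f g B (suc k) =
    trans (cong (_+ (a * f (suc k) + b * g (suc k)) * B 0) (convo-linear a b f g (λ j → B (suc j)) k))
          (solve 7 (λ a b x y f g B → a :* x :+ b :* y :+ (a :* f :+ b :* g) :* B := a :* (x :+ f :* B) :+ b :* (y :+ g :* B))
                 refl a b (convo f (λ j → B (suc j)) k) (convo g (λ j → B (suc j)) k) (f (suc k)) (g (suc k)) (B 0))

  convo-expPS-injective : ∀ {Y Z : PS} → (∀ k → convo Y expPS k ≡ convo Z expPS k) → ∀ k → Y k ≡ Z k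
  convo-expPS-injective {Y} {Z} conv≡ = <-rec (λ k → Y k ≡ Z k) step
    where
    tail : PS → ℕ → ℚ
    tail W k = ∑[ j < k ] (W (k ∸ suc (toℕ j)) * expPS (suc (toℕ j)))
    step : ∀ k → (∀ {i} → i < k → Y i ≡ Z i) → Y k ≡ Z k
    step k ih = begin
      Y k                                      ≡⟨ solve 2 (λ y t → y := (y :* con 1ℚ :+ t) :- t) refl (Y k) (tail Y k) ⟩
      (Y k * 1ℚ + tail Y k) - tail Y k         ≡⟨ cong₂ _-_ (trans (sym (convo-sum Y expPS k)) (trans (conv≡ k) (convo-sum Z expPS k))) tails≡ ⟩
      (Z k * 1ℚ + tail Z k) - tail Z k         ≡⟨ solve 2 (λ y t → (y :* con 1ℚ :+ t) :- t := y) refl (Z k) (tail Z k) ⟩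
      Z k                                      ∎
      where
      open ≡-Reasoning
      tails≡ : tail Y k ≡ tail Z k
      tails≡ = sum-cong-≗ (λ j → cong (_* expPS (suc (toℕ j))) (ih (ℕ.∸-monoʳ-< (s≤s ℕ.z≤n) (toℕ<n j))))

  ℕ→ℚ-sum : ∀ n (f : Fin n → ℕ) → ℕ→ℚ (ℕΣ.sum f) ≡ ∑[ j < n ] ℕ→ℚ (f j)
  ℕ→ℚ-sum zero    f = refl
  ℕ→ℚ-sum (suc n) f = trans (ℕ→ℚ-+ (f Fin.zero) _) (cong (ℕ→ℚ (f Fin.zero) +_) (ℕ→ℚ-sum n (λ j → f (Fin.suc j))))

  laguerre : ℕ → PS
  laguerre m j = ℕ→ℚ (m C j) * expPS j

  convo-laguerre-expPS : ∀ m k → convo (laguerre m) expPS k ≡ ℕ→ℚ (shuffles m k) * expPS k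
  convo-laguerre-expPS m k = begin
    convo (laguerre m) expPS k
      ≡⟨ convo-sum (laguerre m) expPS k ⟩
    ∑[ j < suc k ] (ℕ→ℚ (m C (k ∸ toℕ j)) * expPS (k ∸ toℕ j) * expPS (toℕ j))
      ≡⟨ sum-cong-≗ (λ j → term (toℕ j) (ℕ.≤-pred (toℕ<n j))) ⟩
    ∑[ j < suc k ] (ℕ→ℚ ((k C toℕ j) ℕ.* (m C (k ∸ toℕ j))) * expPS k)
      ≡⟨ *-distribʳ-sum {suc k} (expPS k) (λ j → ℕ→ℚ ((k C toℕ j) ℕ.* (m C (k ∸ toℕ j)))) ⟨
    ∑[ j < suc k ] ℕ→ℚ ((k C toℕ j) ℕ.* (m C (k ∸ toℕ j))) * expPS k
      ≡⟨ cong (_* expPS k) (ℕ→ℚ-sum (suc k) (λ j → (k C toℕ j) ℕ.* (m C (k ∸ toℕ j)))) ⟨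
    ℕ→ℚ (ℕΣ.sum {suc k} (λ j → (k C toℕ j) ℕ.* (m C (k ∸ toℕ j)))) * expPS k
      ≡⟨ cong (λ n → ℕ→ℚ n * expPS k) (trans (ℕC.vandermonde k m k) (cong (_C k) (ℕ.+-comm k m))) ⟩
    ℕ→ℚ (shuffles m k) * expPS k ∎
    where
    open ≡-Reasoning
    term : ∀ j → j ≤ k → ℕ→ℚ (m C (k ∸ j)) * expPS (k ∸ j) * expPS j ≡ ℕ→ℚ ((k C j) ℕ.* (m C (k ∸ j))) * expPS k
    term j j≤k = begin
      ℕ→ℚ (m C (k ∸ j)) * expPS (k ∸ j) * expPS j
        ≡⟨ ℚ.*-assoc (ℕ→ℚ (m C (k ∸ j))) (expPS (k ∸ j)) (expPS j) ⟩
      ℕ→ℚ (m C (k ∸ j)) * (expPS (k ∸ j) * expPS j)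
        ≡⟨ cong (ℕ→ℚ (m C (k ∸ j)) *_) (expPS-* (k ∸ j) j) ⟩
      ℕ→ℚ (m C (k ∸ j)) * (ℕ→ℚ (((k ∸ j) ℕ.+ j) C j) * expPS ((k ∸ j) ℕ.+ j))
        ≡⟨ cong (λ n → ℕ→ℚ (m C (k ∸ j)) * (ℕ→ℚ (n C j) * expPS n)) (ℕ.m∸n+n≡m j≤k) ⟩
      ℕ→ℚ (m C (k ∸ j)) * (ℕ→ℚ (k C j) * expPS k)
        ≡⟨ solve 3 (λ a b e → a :* (b :* e) := b :* a :* e) refl (ℕ→ℚ (m C (k ∸ j))) (ℕ→ℚ (k C j)) (expPS k) ⟩
      ℕ→ℚ (k C j) * ℕ→ℚ (m C (k ∸ j)) * expPS k
        ≡⟨ cong (_* expPS k) (ℕ→ℚ-* (k C j) (m C (k ∸ j))) ⟨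
      ℕ→ℚ ((k C j) ℕ.* (m C (k ∸ j))) * expPS k ∎

module WeightedPascal where
  open import Data.Nat.Base as ℕ using (ℕ; zero; suc; _≤_; s≤s⁻¹)
  open import Data.Nat.Properties using (_<?_)
  import Data.Nat.Properties as ℕ
  open import Data.Nat.Combinatorics using (_C_; nCn≡1)
  open import Data.Rational.Base using (ℚ; 0ℚ; 1ℚ; _+_; _*_)
  import Data.Rational.Properties as ℚ
  open import Data.Rational.Solver using (module +-*-Solver)
  open import Relation.Binary.PropositionalEquality
  open import Relation.Nullary.Decidable using (Dec; yes; no)
  open import Relation.Nullary.Negation.Core using (¬_)

  open import Defs using (ℕ→ℚ)
  open Indicators using (χ)
  open Rationals
  open Binomial using (C-pascal; C-ratio)
  open ClosedForm using (boundedPaths)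

  open +-*-Solver

  -- For r = v / w: (p + 1) r(p, q + 1) + (q + 1) r(p + 1, q) = (p + q + 2) r(p + 1, q + 1), which makes
  -- C(p + q, q) r(p, q) satisfy Pascal's rule; stated without division.
  WeightedPascal : (P₁ Q₁ w₀₁ w₁₀ w₁₁ v₀₁ v₁₀ v₁₁ : ℚ) → Set
  WeightedPascal P₁ Q₁ w₀₁ w₁₀ w₁₁ v₀₁ v₁₀ v₁₁ = w₁₁ * (P₁ * v₀₁ * w₁₀ + Q₁ * v₁₀ * w₀₁) ≡ (P₁ + Q₁) * v₁₁ * w₀₁ * w₁₀

  WeightedPascal-cong : ∀ {P₁ Q₁ w₀₁ w₁₀ w₁₁ v₀₁ v₁₀ v₁₁ P₁′ Q₁′ w₀₁′ w₁₀′ w₁₁′ v₀₁′ v₁₀′ v₁₁′} →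
    P₁ ≡ P₁′ → Q₁ ≡ Q₁′ → w₀₁ ≡ w₀₁′ → w₁₀ ≡ w₁₀′ → w₁₁ ≡ w₁₁′ → v₀₁ ≡ v₀₁′ → v₁₀ ≡ v₁₀′ → v₁₁ ≡ v₁₁′ →
    WeightedPascal P₁′ Q₁′ w₀₁′ w₁₀′ w₁₁′ v₀₁′ v₁₀′ v₁₁′ → WeightedPascal P₁ Q₁ w₀₁ w₁₀ w₁₁ v₀₁ v₁₀ v₁₁
  WeightedPascal-cong refl refl refl refl refl refl refl refl wp = wp

  weighted-pascal-step : ∀ (X Y a₁ a₂ P₁ Q₁ w₀₁ w₁₀ w₁₁ v₀₁ v₁₀ v₁₁ : ℚ) →
    Y * Q₁ ≡ X * P₁ → a₁ * w₀₁ ≡ Y * v₀₁ → a₂ * w₁₀ ≡ X * v₁₀ →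
    WeightedPascal P₁ Q₁ w₀₁ w₁₀ w₁₁ v₀₁ v₁₀ v₁₁ →
    (a₁ + a₂) * w₁₁ * (w₀₁ * w₁₀ * Q₁) ≡ (X + Y) * v₁₁ * (w₀₁ * w₁₀ * Q₁)
  weighted-pascal-step X Y a₁ a₂ P₁ Q₁ w₀₁ w₁₀ w₁₁ v₀₁ v₁₀ v₁₁ ratio hyp₁ hyp₂ pascal = begin
    (a₁ + a₂) * w₁₁ * (w₀₁ * w₁₀ * Q₁)
      ≡⟨ solve 6 (λ a₁ a₂ Q₁ w₀₁ w₁₀ w₁₁ → (a₁ :+ a₂) :* w₁₁ :* (w₀₁ :* w₁₀ :* Q₁)
                                          := (a₁ :* w₀₁) :* (w₁₁ :* w₁₀ :* Q₁) :+ (a₂ :* w₁₀) :* (w₁₁ :* w₀₁ :* Q₁))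
                 refl a₁ a₂ Q₁ w₀₁ w₁₀ w₁₁ ⟩
    (a₁ * w₀₁) * (w₁₁ * w₁₀ * Q₁) + (a₂ * w₁₀) * (w₁₁ * w₀₁ * Q₁)
      ≡⟨ cong₂ (λ s t → s * (w₁₁ * w₁₀ * Q₁) + t * (w₁₁ * w₀₁ * Q₁)) hyp₁ hyp₂ ⟩
    (Y * v₀₁) * (w₁₁ * w₁₀ * Q₁) + (X * v₁₀) * (w₁₁ * w₀₁ * Q₁)
      ≡⟨ solve 8 (λ X Y Q₁ w₀₁ w₁₀ w₁₁ v₀₁ v₁₀ → (Y :* v₀₁) :* (w₁₁ :* w₁₀ :* Q₁) :+ (X :* v₁₀) :* (w₁₁ :* w₀₁ :* Q₁)
                                            := (Y :* Q₁) :* (v₀₁ :* w₁₁ :* w₁₀) :+ X :* (Q₁ :* v₁₀ :* w₁₁ :* w₀₁))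
                 refl X Y Q₁ w₀₁ w₁₀ w₁₁ v₀₁ v₁₀ ⟩
    (Y * Q₁) * (v₀₁ * w₁₁ * w₁₀) + X * (Q₁ * v₁₀ * w₁₁ * w₀₁)
      ≡⟨ cong (λ s → s * (v₀₁ * w₁₁ * w₁₀) + X * (Q₁ * v₁₀ * w₁₁ * w₀₁)) ratio ⟩
    (X * P₁) * (v₀₁ * w₁₁ * w₁₀) + X * (Q₁ * v₁₀ * w₁₁ * w₀₁)
      ≡⟨ solve 8 (λ X P₁ Q₁ w₀₁ w₁₀ w₁₁ v₀₁ v₁₀ → (X :* P₁) :* (v₀₁ :* w₁₁ :* w₁₀) :+ X :* (Q₁ :* v₁₀ :* w₁₁ :* w₀₁)
                                             := X :* (w₁₁ :* (P₁ :* v₀₁ :* w₁₀ :+ Q₁ :* v₁₀ :* w₀₁)))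
                 refl X P₁ Q₁ w₀₁ w₁₀ w₁₁ v₀₁ v₁₀ ⟩
    X * (w₁₁ * (P₁ * v₀₁ * w₁₀ + Q₁ * v₁₀ * w₀₁))
      ≡⟨ cong (X *_) pascal ⟩
    X * ((P₁ + Q₁) * v₁₁ * w₀₁ * w₁₀)
      ≡⟨ solve 6 (λ X P₁ Q₁ w₀₁ w₁₀ v₁₁ → X :* ((P₁ :+ Q₁) :* v₁₁ :* w₀₁ :* w₁₀)
                                         := (X :* Q₁ :+ X :* P₁) :* v₁₁ :* (w₀₁ :* w₁₀))
                 refl X P₁ Q₁ w₀₁ w₁₀ v₁₁ ⟩
    (X * Q₁ + X * P₁) * v₁₁ * (w₀₁ * w₁₀)
      ≡⟨ cong (λ s → (X * Q₁ + s) * v₁₁ * (w₀₁ * w₁₀)) ratio ⟨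
    (X * Q₁ + Y * Q₁) * v₁₁ * (w₀₁ * w₁₀)
      ≡⟨ solve 6 (λ X Y Q₁ w₀₁ w₁₀ v₁₁ → (X :* Q₁ :+ Y :* Q₁) :* v₁₁ :* (w₀₁ :* w₁₀) := (X :+ Y) :* v₁₁ :* (w₀₁ :* w₁₀ :* Q₁))
                 refl X Y Q₁ w₀₁ w₁₀ v₁₁ ⟩
    (X + Y) * v₁₁ * (w₀₁ * w₁₀ * Q₁) ∎
    where open ≡-Reasoning

  boundedPaths-column : ∀ start p → boundedPaths start p 0 ≡ start 0
  boundedPaths-column start zero    = refl
  boundedPaths-column start (suc p) = boundedPaths-column start p

  χ-cases : ∀ {P : Set} (d : Dec P) n {w z : ℚ} → (P → ℕ→ℚ n * w ≡ z) → (¬ P → z ≡ 0ℚ) → ℕ→ℚ (χ d ℕ.* n) * w ≡ z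
  χ-cases (yes p) n {w} hyp _ = trans (cong (λ m → ℕ→ℚ m * w) (ℕ.*-identityˡ n)) (hyp p)
  χ-cases (no ¬p) n {w} _ hyp = trans (ℚ.*-zeroˡ w) (sym (hyp ¬p))

  module BoundedPathsClosedForm
    (start : ℕ → ℕ) (w : ℕ → ℕ → ℕ) (v : ℕ → ℕ → ℚ)
    (w-nonZero : ∀ p q → ℕ.NonZero (w p (suc q) ℕ.* w (suc p) q))
    (start-row : ∀ q → q ≤ 2 → ℕ→ℚ (start q) * ℕ→ℚ (w 0 q) ≡ v 0 q)
    (start-column : ∀ p → ℕ→ℚ (start 0) * ℕ→ℚ (w p 0) ≡ v p 0)
    (boundary : ∀ p → v p (3 ℕ.+ p) ≡ 0ℚ)
    (weighted-pascal : ∀ p q → WeightedPascal (ℕ→ℚ (suc p)) (ℕ→ℚ (suc q))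
                                               (ℕ→ℚ (w p (suc q))) (ℕ→ℚ (w (suc p) q)) (ℕ→ℚ (w (suc p) (suc q)))
                                               (v p (suc q)) (v (suc p) q) (v (suc p) (suc q)))
    where

    u : ℕ → ℕ → ℕ
    u = boundedPaths start

    closed-form : ∀ p q → q ≤ 2 ℕ.+ p → ℕ→ℚ (u p q) * ℕ→ℚ (w p q) ≡ ℕ→ℚ ((p ℕ.+ q) C q) * v p q
    closed-form p zero _ = begin
      ℕ→ℚ (u p 0) * ℕ→ℚ (w p 0)  ≡⟨ cong (λ n → ℕ→ℚ n * ℕ→ℚ (w p 0)) (boundedPaths-column start p) ⟩
      ℕ→ℚ (start 0) * ℕ→ℚ (w p 0) ≡⟨ start-column p ⟩
      v p 0                       ≡⟨ ℚ.*-identityˡ (v p 0) ⟨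
      1ℚ * v p 0                  ∎
      where open ≡-Reasoning
    closed-form zero (suc q) q≤2 = trans (start-row (suc q) q≤2)
      (sym (trans (cong (λ n → ℕ→ℚ n * v 0 (suc q)) (nCn≡1 (suc q))) (ℚ.*-identityˡ (v 0 (suc q)))))
    closed-form (suc p) (suc q) q≤ = *-cancelʳ-ℕ→ℚ Z {{Z-nonZero}} (begin
      ℕ→ℚ (u (suc p) (suc q)) * ℕ→ℚ (w (suc p) (suc q)) * ℕ→ℚ Z
        ≡⟨ cong₂ (λ s t → s * ℕ→ℚ (w (suc p) (suc q)) * t) (ℕ→ℚ-+ (χ (suc q <? 3 ℕ.+ p) ℕ.* u p (suc q)) (u (suc p) q)) ℕZ ⟩
      (a₁ + a₂) * w₁₁ * (w₀₁ * w₁₀ * Q₁)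
        ≡⟨ weighted-pascal-step X Y a₁ a₂ (ℕ→ℚ (suc p)) Q₁ w₀₁ w₁₀ w₁₁ (v p (suc q)) (v (suc p) q) (v (suc p) (suc q))
                                ratio hyp₁ hyp₂ (weighted-pascal p q) ⟩
      (X + Y) * v (suc p) (suc q) * (w₀₁ * w₁₀ * Q₁)
        ≡⟨ cong₂ (λ s t → s * v (suc p) (suc q) * t)
                 (trans (sym (ℕ→ℚ-+ ((p ℕ.+ suc q) C q) ((p ℕ.+ suc q) C suc q))) (cong ℕ→ℚ (sym (C-pascal (p ℕ.+ suc q) q)))) (sym ℕZ) ⟩
      ℕ→ℚ ((suc p ℕ.+ suc q) C suc q) * v (suc p) (suc q) * ℕ→ℚ Z ∎)
      where
      open ≡-Reasoning
      X = ℕ→ℚ ((p ℕ.+ suc q) C q)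
      Y = ℕ→ℚ ((p ℕ.+ suc q) C suc q)
      a₁ = ℕ→ℚ (χ (suc q <? 3 ℕ.+ p) ℕ.* u p (suc q))
      a₂ = ℕ→ℚ (u (suc p) q)
      Q₁ = ℕ→ℚ (suc q)
      w₀₁ = ℕ→ℚ (w p (suc q))
      w₁₀ = ℕ→ℚ (w (suc p) q)
      w₁₁ = ℕ→ℚ (w (suc p) (suc q))
      Z = w p (suc q) ℕ.* w (suc p) q ℕ.* suc q
      Z-nonZero : ℕ.NonZero Z
      Z-nonZero = ℕ.m*n≢0 _ _ {{w-nonZero p q}}
      ℕZ : ℕ→ℚ Z ≡ w₀₁ * w₁₀ * Q₁
      ℕZ = trans (ℕ→ℚ-* (w p (suc q) ℕ.* w (suc p) q) (suc q)) (cong (_* Q₁) (ℕ→ℚ-* (w p (suc q)) (w (suc p) q)))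
      ratio : Y * Q₁ ≡ X * ℕ→ℚ (suc p)
      ratio = trans (sym (ℕ→ℚ-* ((p ℕ.+ suc q) C suc q) (suc q)))
                    (trans (cong ℕ→ℚ (C-ratio p q)) (ℕ→ℚ-* ((p ℕ.+ suc q) C q) (suc p)))
      hyp₂ : a₂ * w₁₀ ≡ X * v (suc p) q
      hyp₂ = trans (closed-form (suc p) q (ℕ.≤-trans (ℕ.n≤1+n q) q≤))
                   (cong (λ n → ℕ→ℚ (n C q) * v (suc p) q) (sym (ℕ.+-suc p q)))
      hyp₁ : a₁ * w₀₁ ≡ Y * v p (suc q)
      hyp₁ = χ-cases (suc q <? 3 ℕ.+ p) (u p (suc q)) (λ q< → closed-form p (suc q) (s≤s⁻¹ q<))
               λ ¬q< → trans (cong (λ q → Y * v p q) (ℕ.≤-antisym q≤ (ℕ.≮⇒≥ ¬q<))) (trans (cong (Y *_) (boundary p)) (ℚ.*-zeroʳ Y))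

module Coefficients where
  open import Data.Nat.Base as ℕ using (ℕ; suc; _≤_; s≤s)
  import Data.Nat.Properties as ℕ
  open import Data.Nat.Combinatorics using (_C_)
  open import Data.Rational.Base using (ℚ; 0ℚ; _+_; _*_; _-_)
  import Data.Rational.Properties as ℚ
  open import Data.Rational.Solver using (module +-*-Solver)
  open import Relation.Binary.PropositionalEquality

  open import Defs using (ℕ→ℚ)
  open Rationals
  open ClosedForm using (A; B; startB)
  open import Function.Base using (const)
  open WeightedPascal using (WeightedPascal; WeightedPascal-cong; module BoundedPathsClosedForm)

  open +-*-Solver

  KA K′ KB G : ℚ → ℚ
  KA x = (x + ℕ→ℚ 1) * (x + ℕ→ℚ 2) * (x + ℕ→ℚ 3)
  K′ y = y * (y - ℕ→ℚ 1) * (y - ℕ→ℚ 2)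
  KB x = (x + ℕ→ℚ 1) * (x + ℕ→ℚ 2)
  G  y = (y - ℕ→ℚ 1) * (y - ℕ→ℚ 2)

  ℕ→ℚ-+ʳ : ∀ k p → ℕ→ℚ (k ℕ.+ p) ≡ ℕ→ℚ p + ℕ→ℚ k
  ℕ→ℚ-+ʳ k p = trans (ℕ→ℚ-+ k p) (ℚ.+-comm (ℕ→ℚ k) (ℕ→ℚ p))

  private
    KAe K′e KBe Ge : ∀ {n} → Polynomial n → Polynomial n
    KAe x = (x :+ con (ℕ→ℚ 1)) :* (x :+ con (ℕ→ℚ 2)) :* (x :+ con (ℕ→ℚ 3))
    K′e y = y :* (y :- con (ℕ→ℚ 1)) :* (y :- con (ℕ→ℚ 2))
    KBe x = (x :+ con (ℕ→ℚ 1)) :* (x :+ con (ℕ→ℚ 2))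
    Ge  y = (y :- con (ℕ→ℚ 1)) :* (y :- con (ℕ→ℚ 2))

    infixl 6 _+1
    _+1 : ∀ {n} → Polynomial n → Polynomial n
    x +1 = x :+ con (ℕ→ℚ 1)

  KA-pascal : ∀ P Q → let P₁ = P + ℕ→ℚ 1 ; Q₁ = Q + ℕ→ℚ 1 in
    WeightedPascal P₁ Q₁ (KA P) (KA P₁) (KA P₁) (KA P - K′ Q₁) (KA P₁ - K′ Q) (KA P₁ - K′ Q₁)
  KA-pascal = solve 2 (λ P Q → KAe (P +1) :* ((P +1) :* (KAe P :- K′e (Q +1)) :* KAe (P +1) :+ (Q +1) :* (KAe (P +1) :- K′e Q) :* KAe P)
                               := ((P +1) :+ (Q +1)) :* (KAe (P +1) :- K′e (Q +1)) :* KAe P :* KAe (P +1)) refl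

  KB-pascal : ∀ P Q → let P₁ = P + ℕ→ℚ 1 ; Q₁ = Q + ℕ→ℚ 1 in
    WeightedPascal P₁ Q₁ (KB P * (P + Q₁)) (KB P₁ * (P₁ + Q)) (KB P₁ * (P₁ + Q₁))
                   (Q₁ * (KB P - G Q₁)) (Q * (KB P₁ - G Q)) (Q₁ * (KB P₁ - G Q₁))
  KB-pascal = solve 2 (λ P Q → KBe (P +1) :* ((P +1) :+ (Q +1)) :* ((P +1) :* ((Q +1) :* (KBe P :- Ge (Q +1))) :* (KBe (P +1) :* ((P +1) :+ Q))
                                                                :+ (Q +1) :* (Q :* (KBe (P +1) :- Ge Q)) :* (KBe P :* (P :+ (Q +1))))
                               := ((P +1) :+ (Q +1)) :* ((Q +1) :* (KBe (P +1) :- Ge (Q +1))) :* (KBe P :* (P :+ (Q +1))) :* (KBe (P +1) :* ((P +1) :+ Q))) refl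

  ℕ→ℚ-KA : ∀ p → ℕ→ℚ (suc p ℕ.* (2 ℕ.+ p) ℕ.* (3 ℕ.+ p)) ≡ KA (ℕ→ℚ p)
  ℕ→ℚ-KA p = trans (ℕ→ℚ-* (suc p ℕ.* (2 ℕ.+ p)) (3 ℕ.+ p))
               (cong₂ _*_ (trans (ℕ→ℚ-* (suc p) (2 ℕ.+ p)) (cong₂ _*_ (ℕ→ℚ-+ʳ 1 p) (ℕ→ℚ-+ʳ 2 p))) (ℕ→ℚ-+ʳ 3 p))

  private
    ℕ→ℚ-suc′ : ∀ n → ℕ→ℚ (suc n) ≡ ℕ→ℚ n + ℕ→ℚ 1
    ℕ→ℚ-suc′ = ℕ→ℚ-+ʳ 1

    wA wB : ℕ → ℕ → ℕ
    wA p q = suc p ℕ.* (2 ℕ.+ p) ℕ.* (3 ℕ.+ p)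
    wB p q = suc p ℕ.* (2 ℕ.+ p) ℕ.* (p ℕ.+ q)

    vA vB : ℕ → ℕ → ℚ
    vA p q = KA (ℕ→ℚ p) - K′ (ℕ→ℚ q)
    vB p q = ℕ→ℚ q * (KB (ℕ→ℚ p) - G (ℕ→ℚ q))

    ℕ→ℚ-wA : ∀ p q → ℕ→ℚ (wA p q) ≡ KA (ℕ→ℚ p)
    ℕ→ℚ-wA p q = ℕ→ℚ-KA p

    ℕ→ℚ-wB : ∀ p q → ℕ→ℚ (wB p q) ≡ KB (ℕ→ℚ p) * (ℕ→ℚ p + ℕ→ℚ q)
    ℕ→ℚ-wB p q = trans (ℕ→ℚ-* (suc p ℕ.* (2 ℕ.+ p)) (p ℕ.+ q))
                   (cong₂ _*_ (trans (ℕ→ℚ-* (suc p) (2 ℕ.+ p)) (cong₂ _*_ (ℕ→ℚ-+ʳ 1 p) (ℕ→ℚ-+ʳ 2 p))) (ℕ→ℚ-+ p q))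

  private
    A-start-row : ∀ q → q ≤ 2 → ℕ→ℚ 1 * ℕ→ℚ (wA 0 q) ≡ vA 0 q
    A-start-row 0 _ = refl
    A-start-row 1 _ = refl
    A-start-row 2 _ = refl
    A-start-row (suc (suc (suc q))) (s≤s (s≤s ()))

    A-start-column : ∀ p → ℕ→ℚ 1 * ℕ→ℚ (wA p 0) ≡ vA p 0
    A-start-column p = trans (ℚ.*-identityˡ _) (trans (ℕ→ℚ-wA p 0)
                         (solve 1 (λ P → KAe P := KAe P :- K′e (con (ℕ→ℚ 0))) refl (ℕ→ℚ p)))

    A-boundary : ∀ p → vA p (3 ℕ.+ p) ≡ 0ℚ
    A-boundary p = trans (cong (λ x → KA (ℕ→ℚ p) - K′ x) (ℕ→ℚ-+ʳ 3 p))
                         (solve 1 (λ P → KAe P :- K′e (P :+ con (ℕ→ℚ 3)) := con 0ℚ) refl (ℕ→ℚ p))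

    A-pascal : ∀ p q → WeightedPascal (ℕ→ℚ (suc p)) (ℕ→ℚ (suc q)) (ℕ→ℚ (wA p (suc q))) (ℕ→ℚ (wA (suc p) q))
                                      (ℕ→ℚ (wA (suc p) (suc q))) (vA p (suc q)) (vA (suc p) q) (vA (suc p) (suc q))
    A-pascal p q = WeightedPascal-cong (ℕ→ℚ-suc′ p) (ℕ→ℚ-suc′ q)
      (ℕ→ℚ-wA p (suc q)) (trans (ℕ→ℚ-wA (suc p) q) (cong KA (ℕ→ℚ-suc′ p)))
      (trans (ℕ→ℚ-wA (suc p) (suc q)) (cong KA (ℕ→ℚ-suc′ p)))
      (cong (λ y → KA P - K′ y) (ℕ→ℚ-suc′ q)) (cong (λ x → KA x - K′ Q) (ℕ→ℚ-suc′ p))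
      (cong₂ (λ x y → KA x - K′ y) (ℕ→ℚ-suc′ p) (ℕ→ℚ-suc′ q))
      (KA-pascal P Q)
      where
      P = ℕ→ℚ p
      Q = ℕ→ℚ q

    A-nonZero : ∀ p q → ℕ.NonZero (wA p (suc q) ℕ.* wA (suc p) q)
    A-nonZero p q = ℕ.m*n≢0 (wA p (suc q)) (wA (suc p) q)

    module A-paths = BoundedPathsClosedForm (const 1) wA vA A-nonZero A-start-row A-start-column A-boundary A-pascal

  A-closed-form : ∀ p q → q ≤ 2 ℕ.+ p → ℕ→ℚ (A p q) * KA (ℕ→ℚ p) ≡ ℕ→ℚ ((p ℕ.+ q) C q) * (KA (ℕ→ℚ p) - K′ (ℕ→ℚ q))
  A-closed-form p q q≤ = trans (cong (ℕ→ℚ (A p q) *_) (sym (ℕ→ℚ-wA p q))) (A-paths.closed-form p q q≤)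

  private
    B-nonZero : ∀ p q → ℕ.NonZero (wB p (suc q) ℕ.* wB (suc p) q)
    B-nonZero p q = ℕ.m*n≢0 (wB p (suc q)) (wB (suc p) q)
      {{ℕ.m*n≢0 (suc p ℕ.* (2 ℕ.+ p)) (p ℕ.+ suc q) {{_}} {{subst ℕ.NonZero (sym (ℕ.+-suc p q)) _}}}}

    B-start-row : ∀ q → q ≤ 2 → ℕ→ℚ (startB q) * ℕ→ℚ (wB 0 q) ≡ vB 0 q
    B-start-row 0 _ = refl
    B-start-row 1 _ = refl
    B-start-row 2 _ = refl
    B-start-row (suc (suc (suc q))) (s≤s (s≤s ()))

    B-start-column : ∀ p → ℕ→ℚ 0 * ℕ→ℚ (wB p 0) ≡ vB p 0
    B-start-column p = trans (ℚ.*-zeroˡ (ℕ→ℚ (wB p 0))) (sym (ℚ.*-zeroˡ (KB (ℕ→ℚ p) - G (ℕ→ℚ 0))))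

    B-boundary : ∀ p → vB p (3 ℕ.+ p) ≡ 0ℚ
    B-boundary p = trans (cong (λ x → x * (KB (ℕ→ℚ p) - G x)) (ℕ→ℚ-+ʳ 3 p))
                         (solve 1 (λ P → (P :+ con (ℕ→ℚ 3)) :* (KBe P :- Ge (P :+ con (ℕ→ℚ 3))) := con 0ℚ) refl (ℕ→ℚ p))

    B-pascal : ∀ p q → WeightedPascal (ℕ→ℚ (suc p)) (ℕ→ℚ (suc q)) (ℕ→ℚ (wB p (suc q))) (ℕ→ℚ (wB (suc p) q))
                                      (ℕ→ℚ (wB (suc p) (suc q))) (vB p (suc q)) (vB (suc p) q) (vB (suc p) (suc q))
    B-pascal p q = WeightedPascal-cong (ℕ→ℚ-suc′ p) (ℕ→ℚ-suc′ q)
      (trans (ℕ→ℚ-wB p (suc q)) (cong (λ y → KB P * (P + y)) (ℕ→ℚ-suc′ q)))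
      (trans (ℕ→ℚ-wB (suc p) q) (cong (λ x → KB x * (x + Q)) (ℕ→ℚ-suc′ p)))
      (trans (ℕ→ℚ-wB (suc p) (suc q)) (cong₂ (λ x y → KB x * (x + y)) (ℕ→ℚ-suc′ p) (ℕ→ℚ-suc′ q)))
      (cong (λ y → y * (KB P - G y)) (ℕ→ℚ-suc′ q)) (cong (λ x → Q * (KB x - G Q)) (ℕ→ℚ-suc′ p))
      (cong₂ (λ x y → y * (KB x - G y)) (ℕ→ℚ-suc′ p) (ℕ→ℚ-suc′ q))
      (KB-pascal P Q)
      where
      P = ℕ→ℚ p
      Q = ℕ→ℚ q

    module B-paths = BoundedPathsClosedForm startB wB vB B-nonZero B-start-row B-start-column B-boundary B-pascal

  B-closed-form : ∀ p q → q ≤ 2 ℕ.+ p →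
    ℕ→ℚ (B p q) * (KB (ℕ→ℚ p) * (ℕ→ℚ p + ℕ→ℚ q)) ≡ ℕ→ℚ ((p ℕ.+ q) C q) * (ℕ→ℚ q * (KB (ℕ→ℚ p) - G (ℕ→ℚ q)))
  B-closed-form p q q≤ = trans (cong (ℕ→ℚ (B p q) *_) (sym (ℕ→ℚ-wB p q))) (B-paths.closed-form p q q≤)

module Polynomials where
  open import Data.Nat.Base using (ℕ)
  open import Data.Rational.Base using (ℚ; 0ℚ; 1ℚ; _+_; _*_; _-_)
  open import Data.Rational.Solver using (module +-*-Solver)
  open import Relation.Binary.PropositionalEquality

  open import Defs using (ℕ→ℚ; module Consts)
  open Coefficients using (KA; K′; KB; G)

  open +-*-Solver

  private
    pochₑ : ∀ {n} → Polynomial n → ℕ → Polynomial n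
    pochₑ z ℕ.zero    = con 1ℚ
    pochₑ z (ℕ.suc k) = pochₑ z k :* (z :+ con (ℕ→ℚ k))

    αₑ βₑ γₑ : ∀ {n} → Polynomial n → Polynomial n → Polynomial n
    αₑ a b = pochₑ (a :+ b :- con (ℕ→ℚ 2)) 3 :* pochₑ (a :+ b :- con 1ℚ) 2
    βₑ a b = a :* (b :+ con 1ℚ) :* (a :* a :+ b :* b :+ a :* b :- con (ℕ→ℚ 2) :* a :- b)
    γₑ a b = pochₑ (a :+ b :- con (ℕ→ℚ 2)) 3
             :* (a :* a :* a :+ b :* b :* b :+ con (ℕ→ℚ 3) :* a :* a :* b :+ con (ℕ→ℚ 3) :* a :* b :* b
                 :- con (ℕ→ℚ 3) :* a :* a :- con (ℕ→ℚ 3) :* b :* b :- con (ℕ→ℚ 7) :* a :* b :+ a :+ con (ℕ→ℚ 2) :* b)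

  KAₑ K′ₑ KBₑ Gₑ : ∀ {n} → Polynomial n → Polynomial n
  KAₑ x = (x :+ con (ℕ→ℚ 1)) :* (x :+ con (ℕ→ℚ 2)) :* (x :+ con (ℕ→ℚ 3))
  K′ₑ y = y :* (y :- con (ℕ→ℚ 1)) :* (y :- con (ℕ→ℚ 2))
  KBₑ x = (x :+ con (ℕ→ℚ 1)) :* (x :+ con (ℕ→ℚ 2))
  Gₑ  y = (y :- con (ℕ→ℚ 1)) :* (y :- con (ℕ→ℚ 2))

  module CoefficientIdentities (n₁ n₂ : ℕ) where
    open Consts n₁ n₂

    P : ℚ
    P = b - ℕ→ℚ 2

    S : ℚ
    S = (KA P - K′ a) * s + a * (KB P - G a) * (P + ℕ→ℚ 3)

    identity₁ : (KA P - K′ a) * (α * s - γ) ≡ β * S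
    identity₁ = solve 2 (λ a b → let P = b :- con (ℕ→ℚ 2) ; s = a :+ b :- con (ℕ→ℚ 2) in
                          (KAₑ P :- K′ₑ a) :* (αₑ a b :* s :- γₑ a b)
                          := βₑ a b :* ((KAₑ P :- K′ₑ a) :* s :+ a :* (KBₑ P :- Gₑ a) :* (P :+ con (ℕ→ℚ 3))))
                        refl a b

    identity₂ : a * (KB P - G a) * (P + ℕ→ℚ 3) * (α * (s - 1ℚ) - γ) + s * β * S ≡ 0ℚ
    identity₂ = solve 2 (λ a b → let P = b :- con (ℕ→ℚ 2) ; s = a :+ b :- con (ℕ→ℚ 2) in
                          a :* (KBₑ P :- Gₑ a) :* (P :+ con (ℕ→ℚ 3)) :* (αₑ a b :* (s :- con 1ℚ) :- γₑ a b)
                          :+ s :* βₑ a b :* ((KAₑ P :- K′ₑ a) :* s :+ a :* (KBₑ P :- Gₑ a) :* (P :+ con (ℕ→ℚ 3)))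
                          := con 0ℚ)
                        refl a b

module ODE where
  open import Data.Nat.Base as ℕ using (ℕ; zero; suc)
  import Data.Nat.Properties as ℕ
  open import Data.Nat.Combinatorics using (_C_)
  open import Data.Rational.Base using (ℚ; 0ℚ; 1ℚ; _+_; _*_; _-_; -_)
  import Data.Rational.Properties as ℚ
  open import Data.Rational.Solver using (module +-*-Solver)
  open import Relation.Binary.PropositionalEquality hiding (J)

  open import Defs using (PS; ℕ→ℚ; expPS; D; shiftX; _⊕_; odeLHS; module Consts)
  open Rationals
  open Binomial using (C-pascal; C-suc-index; C-absorption)
  open Series using (laguerre)

  open +-*-Solver

  D-laguerre : ∀ n j → D (laguerre n) j ≡ ℕ→ℚ (n C suc j) * expPS j
  D-laguerre n j = begin
    ℕ→ℚ (suc j) * (ℕ→ℚ (n C suc j) * expPS (suc j))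
      ≡⟨ solve 3 (λ k c e → k :* (c :* e) := c :* (e :* k)) refl (ℕ→ℚ (suc j)) (ℕ→ℚ (n C suc j)) (expPS (suc j)) ⟩
    ℕ→ℚ (n C suc j) * (expPS (suc j) * ℕ→ℚ (suc j))
      ≡⟨ cong (ℕ→ℚ (n C suc j) *_) (expPS-suc j) ⟩
    ℕ→ℚ (n C suc j) * expPS j ∎
    where open ≡-Reasoning

  D-laguerre-suc : ∀ n j → D (laguerre (suc n)) j ≡ D (laguerre n) j + laguerre n j
  D-laguerre-suc n j = begin
    D (laguerre (suc n)) j
      ≡⟨ D-laguerre (suc n) j ⟩
    ℕ→ℚ (suc n C suc j) * expPS j
      ≡⟨ cong (λ c → ℕ→ℚ c * expPS j) (trans (C-pascal n j) (ℕ.+-comm (n C j) (n C suc j))) ⟩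
    ℕ→ℚ ((n C suc j) ℕ.+ (n C j)) * expPS j
      ≡⟨ trans (cong (_* expPS j) (ℕ→ℚ-+ (n C suc j) (n C j))) (ℚ.*-distribʳ-+ (expPS j) (ℕ→ℚ (n C suc j)) _) ⟩
    ℕ→ℚ (n C suc j) * expPS j + laguerre n j
      ≡⟨ cong (_+ laguerre n j) (D-laguerre n j) ⟨
    D (laguerre n) j + laguerre n j ∎
    where open ≡-Reasoning

  laguerreOp : PS → PS
  laguerreOp Y = shiftX (D (D Y)) ⊕ (D Y ⊕ shiftX (D Y))

  shiftX-D : ∀ Z j → shiftX (D Z) j ≡ ℕ→ℚ j * Z j
  shiftX-D Z zero    = sym (ℚ.*-zeroˡ (Z 0))
  shiftX-D Z (suc j) = refl

  laguerreOp-coeff : ∀ Y j → laguerreOp Y j ≡ ℕ→ℚ (suc j) * (ℕ→ℚ (suc j) * Y (suc j)) + ℕ→ℚ j * Y j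
  laguerreOp-coeff Y j = begin
    shiftX (D (D Y)) j + (D Y j + shiftX (D Y) j)
      ≡⟨ cong₂ (λ s t → s + (D Y j + t)) (shiftX-D (D Y) j) (shiftX-D Y j) ⟩
    J * (J₁ * Y (suc j)) + (J₁ * Y (suc j) + J * Y j)
      ≡⟨ cong (λ t → J * (t * Y (suc j)) + (t * Y (suc j) + J * Y j)) (ℕ→ℚ-suc j) ⟩
    J * ((1ℚ + J) * Y (suc j)) + ((1ℚ + J) * Y (suc j) + J * Y j)
      ≡⟨ solve 3 (λ J y₁ y → J :* ((con 1ℚ :+ J) :* y₁) :+ ((con 1ℚ :+ J) :* y₁ :+ J :* y)
                          := (con 1ℚ :+ J) :* ((con 1ℚ :+ J) :* y₁) :+ J :* y) refl J (Y (suc j)) (Y j) ⟩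
    (1ℚ + J) * ((1ℚ + J) * Y (suc j)) + J * Y j
      ≡⟨ cong (λ t → t * (t * Y (suc j)) + J * Y j) (ℕ→ℚ-suc j) ⟨
    J₁ * (J₁ * Y (suc j)) + J * Y j ∎
    where
    open ≡-Reasoning
    J = ℕ→ℚ j
    J₁ = ℕ→ℚ (suc j)

  laguerre-eigen : ∀ n j → laguerreOp (laguerre n) j ≡ ℕ→ℚ n * laguerre n j
  laguerre-eigen n j = begin
    laguerreOp (laguerre n) j
      ≡⟨ laguerreOp-coeff (laguerre n) j ⟩
    ℕ→ℚ (suc j) * D (laguerre n) j + ℕ→ℚ j * (ℕ→ℚ (n C j) * expPS j)
      ≡⟨ cong (λ t → ℕ→ℚ (suc j) * t + ℕ→ℚ j * (ℕ→ℚ (n C j) * expPS j)) (D-laguerre n j) ⟩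
    ℕ→ℚ (suc j) * (ℕ→ℚ (n C suc j) * expPS j) + ℕ→ℚ j * (ℕ→ℚ (n C j) * expPS j)
      ≡⟨ solve 5 (λ j₁ c₁ j c e → j₁ :* (c₁ :* e) :+ j :* (c :* e) := (c₁ :* j₁ :+ c :* j) :* e)
               refl (ℕ→ℚ (suc j)) (ℕ→ℚ (n C suc j)) (ℕ→ℚ j) (ℕ→ℚ (n C j)) (expPS j) ⟩
    (ℕ→ℚ (n C suc j) * ℕ→ℚ (suc j) + ℕ→ℚ (n C j) * ℕ→ℚ j) * expPS j
      ≡⟨ cong (_* expPS j) (trans (cong₂ _+_ (sym (ℕ→ℚ-* (n C suc j) (suc j))) (sym (ℕ→ℚ-* (n C j) j)))
                                  (sym (ℕ→ℚ-+ ((n C suc j) ℕ.* suc j) ((n C j) ℕ.* j)))) ⟩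
    ℕ→ℚ ((n C suc j) ℕ.* suc j ℕ.+ (n C j) ℕ.* j) * expPS j
      ≡⟨ cong (λ c → ℕ→ℚ c * expPS j) (trans (C-suc-index n j) (ℕ.*-comm (n C j) n)) ⟩
    ℕ→ℚ (n ℕ.* (n C j)) * expPS j
      ≡⟨ trans (cong (_* expPS j) (ℕ→ℚ-* n (n C j))) (ℚ.*-assoc (ℕ→ℚ n) (ℕ→ℚ (n C j)) (expPS j)) ⟩
    ℕ→ℚ n * laguerre n j ∎
    where open ≡-Reasoning

  laguerre-lower : ∀ n j → ℕ→ℚ j * laguerre (suc n) j ≡ ℕ→ℚ (suc n) * laguerre (suc n) j - ℕ→ℚ (suc n) * laguerre n j
  laguerre-lower n j = begin
    J * (C₁ * e)
      ≡⟨ solve 4 (λ J C₁ N₁ e → J :* (C₁ :* e) := N₁ :* (C₁ :* e) :- (C₁ :* N₁ :- C₁ :* J) :* e) refl J C₁ N₁ e ⟩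
    N₁ * (C₁ * e) - (C₁ * N₁ - C₁ * J) * e
      ≡⟨ cong (λ t → N₁ * (C₁ * e) - t * e) absorbed ⟩
    N₁ * (C₁ * e) - (N₁ * C₀) * e
      ≡⟨ cong (λ t → N₁ * (C₁ * e) - t) (ℚ.*-assoc N₁ C₀ e) ⟩
    N₁ * (C₁ * e) - N₁ * (C₀ * e) ∎
    where
    open ≡-Reasoning
    J = ℕ→ℚ j
    N₁ = ℕ→ℚ (suc n)
    C₁ = ℕ→ℚ (suc n C j)
    C₀ = ℕ→ℚ (n C j)
    e = expPS j
    absorbed-ℕ : (suc n C j) ℕ.* suc n ≡ suc n ℕ.* (n C j) ℕ.+ (suc n C j) ℕ.* j
    absorbed-ℕ = trans (sym (C-suc-index (suc n) j))
                       (cong (ℕ._+ (suc n C j) ℕ.* j) (trans (ℕ.*-comm (suc n C suc j) (suc j)) (C-absorption n j)))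
    absorbed : C₁ * N₁ - C₁ * J ≡ N₁ * C₀
    absorbed = begin
      C₁ * N₁ - C₁ * J
        ≡⟨ cong₂ (λ s t → s - t) (trans (sym (ℕ→ℚ-* (suc n C j) (suc n))) (trans (cong ℕ→ℚ absorbed-ℕ)
                   (trans (ℕ→ℚ-+ (suc n ℕ.* (n C j)) _) (cong₂ _+_ (ℕ→ℚ-* (suc n) (n C j)) (ℕ→ℚ-* (suc n C j) j)))))
                 refl ⟩
      (N₁ * C₀ + C₁ * J) - C₁ * J
        ≡⟨ solve 2 (λ x y → (x :+ y) :- y := x) refl (N₁ * C₀) (C₁ * J) ⟩
      N₁ * C₀ ∎

  cong₃ : ∀ {A B C D : Set} (f : A → B → C → D) {a a′ b b′ c c′} → a ≡ a′ → b ≡ b′ → c ≡ c′ → f a b c ≡ f a′ b′ c′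
  cong₃ f refl refl refl = refl

  module LaguerreCombination (r : ℕ) (x y : ℚ) (Y : PS) (Y≡ : ∀ j → Y j ≡ x * laguerre (suc r) j + y * laguerre r j) where

    private
      M R : ℚ
      M = ℕ→ℚ (suc r)
      R = ℕ→ℚ r
      l κ : PS
      l = laguerre (suc r)
      κ = laguerre r

    laguerreOp-combination : ∀ j → laguerreOp Y j ≡ x * (M * l j) + y * (R * κ j)
    laguerreOp-combination j = begin
      laguerreOp Y j
        ≡⟨ laguerreOp-coeff Y j ⟩
      J₁ * (J₁ * Y (suc j)) + J * Y j
        ≡⟨ cong₂ (λ a b → J₁ * (J₁ * a) + J * b) (Y≡ (suc j)) (Y≡ j) ⟩
      J₁ * (J₁ * (x * l (suc j) + y * κ (suc j))) + J * (x * l j + y * κ j)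
        ≡⟨ solve 8 (λ J₁ J x y l₁ κ₁ l κ → J₁ :* (J₁ :* (x :* l₁ :+ y :* κ₁)) :+ J :* (x :* l :+ y :* κ)
                                        := x :* (J₁ :* (J₁ :* l₁) :+ J :* l) :+ y :* (J₁ :* (J₁ :* κ₁) :+ J :* κ))
                 refl J₁ J x y (l (suc j)) (κ (suc j)) (l j) (κ j) ⟩
      x * (J₁ * (J₁ * l (suc j)) + J * l j) + y * (J₁ * (J₁ * κ (suc j)) + J * κ j)
        ≡⟨ cong₂ (λ a b → x * a + y * b) (laguerreOp-coeff l j) (laguerreOp-coeff κ j) ⟨
      x * laguerreOp l j + y * laguerreOp κ j
        ≡⟨ cong₂ (λ a b → x * a + y * b) (laguerre-eigen (suc r) j) (laguerre-eigen r j) ⟩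
      x * (M * l j) + y * (R * κ j) ∎
      where
      open ≡-Reasoning
      J₁ = ℕ→ℚ (suc j)
      J = ℕ→ℚ j

    remainder : PS
    remainder j = laguerreOp Y j - D Y j - M * Y j

    remainder≡ : ∀ j → remainder j ≡ - (x + y) * D l j
    remainder≡ j = begin
      laguerreOp Y j - J₁ * Y (suc j) - M * Y j
        ≡⟨ cong₃ (λ a b c → a - J₁ * b - M * c) (laguerreOp-combination j) (Y≡ (suc j)) (Y≡ j) ⟩
      x * (M * l j) + y * (R * κ j) - J₁ * (x * l (suc j) + y * κ (suc j)) - M * (x * l j + y * κ j)
        ≡⟨ cong (λ m → x * (m * l j) + y * (R * κ j) - J₁ * (x * l (suc j) + y * κ (suc j)) - m * (x * l j + y * κ j))
                (ℕ→ℚ-suc r) ⟩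
      x * ((1ℚ + R) * l j) + y * (R * κ j) - J₁ * (x * l (suc j) + y * κ (suc j)) - (1ℚ + R) * (x * l j + y * κ j)
        ≡⟨ solve 8 (λ x y R l κ J₁ l₁ κ₁ →
                     x :* ((con 1ℚ :+ R) :* l) :+ y :* (R :* κ) :- J₁ :* (x :* l₁ :+ y :* κ₁) :- (con 1ℚ :+ R) :* (x :* l :+ y :* κ)
                     := :- x :* (J₁ :* l₁) :- y :* (J₁ :* κ₁ :+ κ))
                 refl x y R (l j) (κ j) J₁ (l (suc j)) (κ (suc j)) ⟩
      - x * D l j - y * (D κ j + κ j)
        ≡⟨ cong (λ t → - x * D l j - y * t) (D-laguerre-suc r j) ⟨
      - x * D l j - y * D l j
        ≡⟨ solve 3 (λ x y d → :- x :* d :- y :* d := :- (x :+ y) :* d) refl x y (D l j) ⟩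
      - (x + y) * D l j ∎
      where
      open ≡-Reasoning
      J₁ = ℕ→ℚ (suc j)

    shiftX-remainder : ∀ k → shiftX remainder k ≡ - (x + y) * (M * l k - M * κ k)
    shiftX-remainder zero    = solve 4 (λ x y M v → con 0ℚ := :- (x :+ y) :* (M :* v :- M :* v)) refl x y M (l 0)
    shiftX-remainder (suc j) = trans (remainder≡ j) (cong (- (x + y) *_) (laguerre-lower r (suc j)))

  module _ (n₁ n₂ : ℕ) where
    open Consts n₁ n₂

    odeLHS-laguerreOp : ∀ Y k →
      odeLHS n₁ n₂ Y k ≡ α * laguerreOp Y k + β * shiftX (λ j → laguerreOp Y j - D Y j - s * Y j) k - γ * Y k
    odeLHS-laguerreOp Y zero =
      solve 6 (λ α β γ s d y → ((α :* con 0ℚ :+ β :* con 0ℚ) :+ ((α :* d :+ α :* con 0ℚ) :+ β :* con 0ℚ)) :- (γ :* y :+ (s :* β) :* con 0ℚ)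
                             := α :* (con 0ℚ :+ (d :+ con 0ℚ)) :+ β :* con 0ℚ :- γ :* y)
            refl α β γ s (D Y 0) (Y 0)
    odeLHS-laguerreOp Y (suc j) =
      solve 11 (λ α β γ s a b c d e y₁ y₀ →
                 ((α :* a :+ β :* b) :+ ((α :* c :+ α :* d) :+ β :* e)) :- (γ :* y₁ :+ (s :* β) :* y₀)
                 := α :* (a :+ (c :+ d)) :+ β :* ((b :+ (d :+ e)) :- d :- s :* y₀) :- γ :* y₁)
            refl α β γ s (D (D Y) j) (shiftX (D (D Y)) j) (D Y (suc j)) (D Y j) (shiftX (D Y) j) (Y (suc j)) (Y j)

    laguerre-combination-ode : ∀ r (x y : ℚ) (Y : PS) → (∀ j → Y j ≡ x * laguerre (suc r) j + y * laguerre r j) →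
      s ≡ ℕ→ℚ (suc r) →
      x * (α * s - γ) - s * β * (x + y) ≡ 0ℚ →
      y * (α * (s - 1ℚ) - γ) + s * β * (x + y) ≡ 0ℚ →
      ∀ k → odeLHS n₁ n₂ Y k ≡ 0ℚ
    laguerre-combination-ode r x y Y Y≡ s≡M relₗ relₖ k = begin
      odeLHS n₁ n₂ Y k
        ≡⟨ odeLHS-laguerreOp Y k ⟩
      α * laguerreOp Y k + β * shiftX (λ j → laguerreOp Y j - D Y j - s * Y j) k - γ * Y k
        ≡⟨ cong (λ m → α * laguerreOp Y k + β * shiftX (λ j → laguerreOp Y j - D Y j - m * Y j) k - γ * Y k) s≡M ⟩
      α * laguerreOp Y k + β * shiftX remainder k - γ * Y k
        ≡⟨ cong₃ (λ a b c → α * a + β * b - γ * c) (laguerreOp-combination k) (shiftX-remainder k) (Y≡ k) ⟩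
      α * (x * (M * l k) + y * (R * κ k)) + β * (- (x + y) * (M * l k - M * κ k)) - γ * (x * l k + y * κ k)
        ≡⟨ solve 9 (λ α β γ M R x y l κ →
                     α :* (x :* (M :* l) :+ y :* (R :* κ)) :+ β :* (:- (x :+ y) :* (M :* l :- M :* κ)) :- γ :* (x :* l :+ y :* κ)
                     := l :* (x :* (α :* M :- γ) :- M :* β :* (x :+ y)) :+ κ :* (y :* (α :* R :- γ) :+ M :* β :* (x :+ y)))
                 refl α β γ M R x y (l k) (κ k) ⟩
      l k * (x * (α * M - γ) - M * β * (x + y)) + κ k * (y * (α * R - γ) + M * β * (x + y))
        ≡⟨ cong₂ (λ a b → l k * a + κ k * b) coeffₗ coeffₖ ⟩
      l k * 0ℚ + κ k * 0ℚ
        ≡⟨ solve 2 (λ a b → a :* con 0ℚ :+ b :* con 0ℚ := con 0ℚ) refl (l k) (κ k) ⟩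
      0ℚ ∎
      where
      open ≡-Reasoning
      open LaguerreCombination r x y Y Y≡
      M = ℕ→ℚ (suc r)
      R = ℕ→ℚ r
      l = laguerre (suc r)
      κ = laguerre r
      coeffₗ : x * (α * M - γ) - M * β * (x + y) ≡ 0ℚ
      coeffₗ = subst (λ m → x * (α * m - γ) - m * β * (x + y) ≡ 0ℚ) s≡M relₗ
      R≡ : s - 1ℚ ≡ R
      R≡ = trans (cong (_- 1ℚ) (trans s≡M (ℕ→ℚ-suc r))) (solve 1 (λ r → (con 1ℚ :+ r) :- con 1ℚ := r) refl R)
      coeffₖ : y * (α * R - γ) + M * β * (x + y) ≡ 0ℚ
      coeffₖ = subst₂ (λ m r → y * (α * r - γ) + m * β * (x + y) ≡ 0ℚ) s≡M R≡ relₖ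

module Companion where
  open import Data.Nat.Base as ℕ using (ℕ; zero; suc; pred; _≤_; s≤s; z≤n; _!)
  import Data.Nat.Properties as ℕ
  open import Data.Nat.Combinatorics using (_C_)
  open import Data.Rational.Base using (ℚ; 0ℚ; 1ℚ; _+_; _*_; _-_)
  import Data.Rational.Properties as ℚ
  open import Data.Rational.Solver using (module +-*-Solver)
  open import Relation.Binary.PropositionalEquality

  open import Defs
  open Rationals
  open ExtendedGraph using (σ-extend-𝔊)
  open ClosedForm using (A; B; shuffles; σ𝔊-closedForm)
  open Series using (laguerre; convo-laguerre-expPS; convo-linear; convo-expPS-injective)
  open Coefficients using (KA; K′; KB; G; ℕ→ℚ-+ʳ; ℕ→ℚ-KA; A-closed-form; B-closed-form)
  open Polynomials using (module CoefficientIdentities; KAₑ; K′ₑ; KBₑ; Gₑ)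
  open ODE using (laguerreOp; odeLHS-laguerreOp; laguerre-combination-ode)

  open +-*-Solver

  companion-closed-form : ∀ p q (le : q ≤ 2 ℕ.+ p) (h : 2 ≤ 2 ℕ.+ p) (Y : PS) →
    IsCompanion (𝔊 q (2 ℕ.+ p) le) (v₂ q (2 ℕ.+ p) h) Y →
    ∀ j → Y j ≡ ℕ→ℚ (A p q) * laguerre (p ℕ.+ q) j + ℕ→ℚ (B p q) * laguerre (pred (p ℕ.+ q)) j
  companion-closed-form p q le h Y companion = convo-expPS-injective λ k → begin
    convo Y expPS k
      ≡⟨ companion k ⟩
    sigmaEGF graph v k
      ≡⟨ /≡ℕ→ℚ*1/ (σ (extend graph v k)) (k !) {{k ℕ.!≢0}} ⟩
    ℕ→ℚ (σ (extend graph v k)) * expPS k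
      ≡⟨ cong (λ n → ℕ→ℚ n * expPS k) (trans (σ-extend-𝔊 q (2 ℕ.+ p) le h k) (σ𝔊-closedForm p q k le)) ⟩
    ℕ→ℚ (A p q ℕ.* shuffles m k ℕ.+ B p q ℕ.* shuffles m′ k) * expPS k
      ≡⟨ cong (_* expPS k) (trans (ℕ→ℚ-+ (A p q ℕ.* shuffles m k) (B p q ℕ.* shuffles m′ k))
                                  (cong₂ _+_ (ℕ→ℚ-* (A p q) (shuffles m k)) (ℕ→ℚ-* (B p q) (shuffles m′ k)))) ⟩
    (x * ℕ→ℚ (shuffles m k) + y * ℕ→ℚ (shuffles m′ k)) * expPS k
      ≡⟨ solve 5 (λ x y f f′ e → (x :* f :+ y :* f′) :* e := x :* (f :* e) :+ y :* (f′ :* e))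
               refl x y (ℕ→ℚ (shuffles m k)) (ℕ→ℚ (shuffles m′ k)) (expPS k) ⟩
    x * (ℕ→ℚ (shuffles m k) * expPS k) + y * (ℕ→ℚ (shuffles m′ k) * expPS k)
      ≡⟨ cong₂ (λ s t → x * s + y * t) (convo-laguerre-expPS m k) (convo-laguerre-expPS m′ k) ⟨
    x * convo (laguerre m) expPS k + y * convo (laguerre m′) expPS k
      ≡⟨ convo-linear x y (laguerre m) (laguerre m′) expPS k ⟨
    convo (λ j → x * laguerre m j + y * laguerre m′ j) expPS k ∎
    where
    open ≡-Reasoning
    graph = 𝔊 q (2 ℕ.+ p) le
    v = v₂ q (2 ℕ.+ p) h
    m = p ℕ.+ q
    m′ = pred m
    x = ℕ→ℚ (A p q)
    y = ℕ→ℚ (B p q)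

  module CoefficientRelations (p q r : ℕ) (q≤ : q ≤ 2 ℕ.+ p) (p+q≡ : p ℕ.+ q ≡ suc r) where
    open Consts q (2 ℕ.+ p)
    open CoefficientIdentities q (2 ℕ.+ p)

    x y c : ℚ
    x = ℕ→ℚ (A p q)
    y = ℕ→ℚ (B p q)
    c = ℕ→ℚ ((p ℕ.+ q) C q)

    P≡ : ℕ→ℚ p ≡ P
    P≡ = trans (solve 2 (λ P t → P := (P :+ t) :- t) refl (ℕ→ℚ p) (ℕ→ℚ 2)) (cong (_- ℕ→ℚ 2) (sym (ℕ→ℚ-+ʳ 2 p)))

    s≡P+a : s ≡ P + a
    s≡P+a = solve 2 (λ a b → a :+ b :- con (ℕ→ℚ 2) := (b :- con (ℕ→ℚ 2)) :+ a) refl a b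

    s≡ : s ≡ ℕ→ℚ (suc r)
    s≡ = trans s≡P+a (trans (cong (_+ a) (sym P≡)) (trans (sym (ℕ→ℚ-+ p q)) (cong ℕ→ℚ p+q≡)))

    A-closed : x * KA P ≡ c * (KA P - K′ a)
    A-closed = subst (λ P → x * KA P ≡ c * (KA P - K′ a)) P≡ (A-closed-form p q q≤)

    B-closed : y * (KB P * s) ≡ c * (a * (KB P - G a))
    B-closed = subst₂ (λ P t → y * (KB P * t) ≡ c * (a * (KB P - G a))) P≡ (trans (cong (_+ a) P≡) (sym s≡P+a))
                      (B-closed-form p q q≤)

    private
      N = suc r ℕ.* (suc p ℕ.* (2 ℕ.+ p) ℕ.* (3 ℕ.+ p))
      ℕ→ℚN : ℕ→ℚ N ≡ s * KA P
      ℕ→ℚN = trans (ℕ→ℚ-* (suc r) (suc p ℕ.* (2 ℕ.+ p) ℕ.* (3 ℕ.+ p))) (cong₂ _*_ (sym s≡) (trans (ℕ→ℚ-KA p) (cong KA P≡)))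

    relation₁ : x * (α * s - γ) - s * β * (x + y) ≡ 0ℚ
    relation₁ = *-cancelʳ-ℕ→ℚ N (begin
      (x * (α * s - γ) - s * β * (x + y)) * ℕ→ℚ N
        ≡⟨ cong ((x * (α * s - γ) - s * β * (x + y)) *_) ℕ→ℚN ⟩
      (x * (α * s - γ) - s * β * (x + y)) * (s * KA P)
        ≡⟨ solve 7 (λ x y s P α β γ → (x :* (α :* s :- γ) :- s :* β :* (x :+ y)) :* (s :* KAₑ P)
                                     := (x :* KAₑ P) :* s :* (α :* s :- γ)
                                        :- s :* β :* ((x :* KAₑ P) :* s :+ (y :* (KBₑ P :* s)) :* (P :+ con (ℕ→ℚ 3))))
                 refl x y s P α β γ ⟩
      (x * KA P) * s * (α * s - γ) - s * β * ((x * KA P) * s + (y * (KB P * s)) * (P + ℕ→ℚ 3))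
        ≡⟨ cong₂ (λ u v → u * s * (α * s - γ) - s * β * (u * s + v * (P + ℕ→ℚ 3))) A-closed B-closed ⟩
      c * (KA P - K′ a) * s * (α * s - γ) - s * β * (c * (KA P - K′ a) * s + c * (a * (KB P - G a)) * (P + ℕ→ℚ 3))
        ≡⟨ solve 7 (λ c s P a α β γ →
                     c :* (KAₑ P :- K′ₑ a) :* s :* (α :* s :- γ)
                       :- s :* β :* (c :* (KAₑ P :- K′ₑ a) :* s :+ c :* (a :* (KBₑ P :- Gₑ a)) :* (P :+ con (ℕ→ℚ 3)))
                     := c :* s :* ((KAₑ P :- K′ₑ a) :* (α :* s :- γ)
                                   :- β :* ((KAₑ P :- K′ₑ a) :* s :+ a :* (KBₑ P :- Gₑ a) :* (P :+ con (ℕ→ℚ 3)))))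
                 refl c s P a α β γ ⟩
      c * s * ((KA P - K′ a) * (α * s - γ) - β * S)
        ≡⟨ cong (λ t → c * s * (t - β * S)) identity₁ ⟩
      c * s * (β * S - β * S)
        ≡⟨ solve 4 (λ c s β S → c :* s :* (β :* S :- β :* S) := con 0ℚ :* (s :* S)) refl c s β S ⟩
      0ℚ * (s * S)
        ≡⟨ trans (ℚ.*-zeroˡ (s * S)) (sym (ℚ.*-zeroˡ (ℕ→ℚ N))) ⟩
      0ℚ * ℕ→ℚ N ∎)
      where open ≡-Reasoning

    relation₂ : y * (α * (s - 1ℚ) - γ) + s * β * (x + y) ≡ 0ℚ
    relation₂ = *-cancelʳ-ℕ→ℚ N (begin
      (y * (α * (s - 1ℚ) - γ) + s * β * (x + y)) * ℕ→ℚ N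
        ≡⟨ cong ((y * (α * (s - 1ℚ) - γ) + s * β * (x + y)) *_) ℕ→ℚN ⟩
      (y * (α * (s - 1ℚ) - γ) + s * β * (x + y)) * (s * KA P)
        ≡⟨ solve 7 (λ x y s P α β γ → (y :* (α :* (s :- con 1ℚ) :- γ) :+ s :* β :* (x :+ y)) :* (s :* KAₑ P)
                                     := (y :* (KBₑ P :* s)) :* (P :+ con (ℕ→ℚ 3)) :* (α :* (s :- con 1ℚ) :- γ)
                                        :+ s :* β :* ((x :* KAₑ P) :* s :+ (y :* (KBₑ P :* s)) :* (P :+ con (ℕ→ℚ 3))))
                 refl x y s P α β γ ⟩
      (y * (KB P * s)) * (P + ℕ→ℚ 3) * (α * (s - 1ℚ) - γ) + s * β * ((x * KA P) * s + (y * (KB P * s)) * (P + ℕ→ℚ 3))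
        ≡⟨ cong₂ (λ u v → v * (P + ℕ→ℚ 3) * (α * (s - 1ℚ) - γ) + s * β * (u * s + v * (P + ℕ→ℚ 3))) A-closed B-closed ⟩
      c * (a * (KB P - G a)) * (P + ℕ→ℚ 3) * (α * (s - 1ℚ) - γ)
        + s * β * (c * (KA P - K′ a) * s + c * (a * (KB P - G a)) * (P + ℕ→ℚ 3))
        ≡⟨ solve 7 (λ c s P a α β γ →
                     c :* (a :* (KBₑ P :- Gₑ a)) :* (P :+ con (ℕ→ℚ 3)) :* (α :* (s :- con 1ℚ) :- γ)
                       :+ s :* β :* (c :* (KAₑ P :- K′ₑ a) :* s :+ c :* (a :* (KBₑ P :- Gₑ a)) :* (P :+ con (ℕ→ℚ 3)))
                     := c :* (a :* (KBₑ P :- Gₑ a) :* (P :+ con (ℕ→ℚ 3)) :* (α :* (s :- con 1ℚ) :- γ)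
                              :+ s :* β :* ((KAₑ P :- K′ₑ a) :* s :+ a :* (KBₑ P :- Gₑ a) :* (P :+ con (ℕ→ℚ 3)))))
                 refl c s P a α β γ ⟩
      c * (a * (KB P - G a) * (P + ℕ→ℚ 3) * (α * (s - 1ℚ) - γ) + s * β * S)
        ≡⟨ cong (c *_) identity₂ ⟩
      c * 0ℚ
        ≡⟨ trans (ℚ.*-zeroʳ c) (sym (ℚ.*-zeroˡ (ℕ→ℚ N))) ⟩
      0ℚ * ℕ→ℚ N ∎)
      where open ≡-Reasoning

  odeLHS-0-2 : ∀ Y k → odeLHS 0 2 Y k ≡ 0ℚ
  odeLHS-0-2 Y k = trans (odeLHS-laguerreOp 0 2 Y k)
    (solve 3 (λ u v w → con 0ℚ :* u :+ con 0ℚ :* v :- con 0ℚ :* w := con 0ℚ) refl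
           (laguerreOp Y k) (shiftX (λ j → laguerreOp Y j - D Y j - Consts.s 0 2 * Y j) k) (Y k))

  companion-ode : ∀ p q r → p ℕ.+ q ≡ suc r → (le : q ≤ 2 ℕ.+ p) (h : 2 ≤ 2 ℕ.+ p) (Y : PS) →
                  IsCompanion (𝔊 q (2 ℕ.+ p) le) (v₂ q (2 ℕ.+ p) h) Y → ∀ k → odeLHS q (2 ℕ.+ p) Y k ≡ 0ℚ
  companion-ode p q r p+q≡ le h Y companion =
    laguerre-combination-ode q (2 ℕ.+ p) r (ℕ→ℚ (A p q)) (ℕ→ℚ (B p q)) Y Y≡ s≡ relation₁ relation₂
    where
    open CoefficientRelations p q r le p+q≡
    Y≡ : ∀ j → Y j ≡ ℕ→ℚ (A p q) * laguerre (suc r) j + ℕ→ℚ (B p q) * laguerre r j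
    Y≡ j = trans (companion-closed-form p q le h Y companion j)
                 (cong (λ m → ℕ→ℚ (A p q) * laguerre m j + ℕ→ℚ (B p q) * laguerre (pred m) j) p+q≡)

open import Data.Nat.Base as ℕ using (zero; suc; s≤s; z≤n)
open import Relation.Binary.PropositionalEquality using (refl)
open Companion using (companion-ode; odeLHS-0-2)

mainTheorem12 : (n₁ n₂ : ℕ) (le : n₁ ≤ n₂) (h : 2 ≤ n₂) (Y : PS) →
                IsCompanion (𝔊 n₁ n₂ le) (v₂ n₁ n₂ h) Y →
                ∀ k → odeLHS n₁ n₂ Y k ≡ 0ℚ
mainTheorem12 zero    .2         le (s≤s (s≤s {n = zero} z≤n))  Y companion = odeLHS-0-2 Y
mainTheorem12 (suc q) .2         le h@(s≤s (s≤s {n = zero} z≤n))  = companion-ode 0 (suc q) q refl le h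
mainTheorem12 q       .(3 ℕ.+ p) le h@(s≤s (s≤s {n = suc p} z≤n)) = companion-ode (suc p) q (p ℕ.+ q) refl le h
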